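{- Consider a (single-processor) cup game on $n$ cups, without resource augmentation. Suppose the emptier is a dynamic score-based emptier, and suppose the filler follows the extended oblivious fuzzing filling algorithm. Then at the beginning of the $n^{2/3}$-cup phase, the average fill of cups $1,2,\ldots,n^{2/3}$ (in the filler's labeling) is $\Omega(\log n)$ in expectation.
   Context: **Cup game.** There are $n$ initially empty cups. In each step the filler distributes $1$ unit of water among the cups, and then the emptier may remove water from a single cup. The fill of a cup is the (nonnegative) amount of water in it. **Score-based emptier.** A score-based emptying algorithm has real-valued score functions $\sigma_1,\ldots,\sigma_n$, each strictly increasing ($\sigma_i(a)<\sigma_i(b)$ whenever $a<b$), such that all the scores in the multiset $\{\sigma_i(j/2)\mid i\in[n],\ j\in\mathbb{Z}^+\}$ are distinct. In each step the emptier selects the cup $j$ whose fill $f_j$ maximizes $\sigma_j(f_j)$. It then either (a) removes $1$ full unit of water from that cup, or (b) skips its turn; this decision is an arbitrary function of the state of the cups. **Dynamic score-based emptier.** A dynamic score-based emptying algorithm is given by a sequence $\langle \mathcal{X}_1,\mathcal{X}_2,\mathcal{X}_3,\ldots\rangle$ of score-based emptying algorithms; on step $t$ of the cup game it follows $\mathcal{X}_t$. **Extended oblivious fuzzing filling algorithm.** The filler first relabels the cups by a uniformly random permutation of $1,\ldots,n$ (from the filler's perspective). The strategy consists of $n$ phases of $T(n)$ steps each, where $T$ is a sufficiently large function of $n$. The $i$-th phase is called the $(n-i+1)$-cup phase. In each step of the $i$-th phase, the filler selects $x_1,x_2\in\{1,2,\ldots,n-i+1\}$ independently and uniformly at random and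 places $\tfrac12$ unit of water into each of cups $x_1,x_2$ (so cup $x_1$ receives a full unit if $x_1=x_2$). The quantity $n^{2/3}$ is understood as rounded to an integer. The function $T$ and the constant hidden in $\Omega(\cdot)$ do not depend on the emptier. -}

module Defs where

open import Data.Bool using (Bool; if_then_else_; _∧_)
open import Data.Fin using (Fin; zero; toℕ)
open import Data.Fin.Permutation using (Permutation′; _⟨$⟩ʳ_; insert) renaming (id to idₚ)
open import Data.Integer using (+_)
open import Data.List using (List; []; _∷_; [_]; map; foldr; length; filter; concatMap; replicate; upTo; allFin; cartesianProduct; cartesianProductWith)
open import Data.Nat as ℕ using (ℕ; zero; suc)
open import Data.Product using (_×_; _,_; ∃-syntax)
open import Data.Rational using (ℚ; 0ℚ; 1ℚ; ½; _/_; _+_; _-_; _*_; ∣_∣; _≤_; _<_; _≤?_)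
open import Data.Vec as Vec using (Vec; lookup; _[_]%=_)
open import Relation.Binary.PropositionalEquality using (_≢_)
open import Relation.Nullary using (¬_; does)

-- Real numbers, as Bishop's regular sequences of rationals (indices shifted
-- by one, so that the n-th term is within 1/(n+1) of the limit).

record ℝ : Set where
  field
    approx  : ℕ → ℚ
    regular : ∀ m n → ∣ approx m - approx n ∣ ≤ (+ 1) / suc m + (+ 1) / suc n

open ℝ public

infix 4 _<ᵣ_ _≤ᵣ_ _≈ᵣ_

_<ᵣ_ : ℝ → ℝ → Set
x <ᵣ y = ∃[ n ] (+ 2) / suc n < approx y n - approx x n

_≤ᵣ_ : ℝ → ℝ → Set
x ≤ᵣ y = ¬ (y <ᵣ x)

_≈ᵣ_ : ℝ → ℝ → Set
x ≈ᵣ y = x ≤ᵣ y × y ≤ᵣ x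

-- The fills of the cups.  Rational fills suffice, since the filler moves water
-- in half units and the emptier in full units.

State : ℕ → Set
State n = Vec ℚ n

-- The domain of the score functions is the type of fills, ℚ; a function on all
-- nonnegative reals restricts to one.  Scores at fill 0 are not required to be
-- distinct from other scores, so `select` includes a choice among maximizers.

record ScoreBased (n : ℕ) : Set where
  field
    σ          : Fin n → ℚ → ℝ
    increasing : ∀ i {a b} → 0ℚ ≤ a → a < b → σ i a <ᵣ σ i b
    distinct   : ∀ i j k l → (i , j) ≢ (k , l) →
                 ¬ (σ i ((+ suc j) / 2) ≈ᵣ σ k ((+ suc l) / 2))
    select     : State n → Fin n
    maximal    : ∀ s i → σ i (lookup s i) ≤ᵣ σ (select s) (lookup s (select s))
    remove?    : State n → Bool

-- The t-th entry (counting from 0) is the algorithm followed on step t + 1.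

DynamicScoreBased : ℕ → Set
DynamicScoreBased n = ℕ → ScoreBased n

pour½ : ∀ {n} → Fin n → State n → State n
pour½ i s = s [ i ]%= (_+ ½)

-- A full unit can only be removed from a cup that contains one, so a decision
-- to remove from a cup with fill below 1 amounts to skipping.

emptierMove : ∀ {n} → ScoreBased n → State n → State n
emptierMove X s =
  if remove? s ∧ does (1ℚ ≤? lookup s (select s))
  then s [ select s ]%= (_- 1ℚ)
  else s
  where open ScoreBased X

-- In `play X π t s cs`, steps t + 1, t + 2, … are played from state s, with the
-- filler's choices cs in the filler's labeling; π takes the filler's label of
-- a cup to the cup itself.

play : ∀ {n} → DynamicScoreBased n → Permutation′ n →
       ℕ → State n → List (Fin n × Fin n) → State n
play X π t s []               = s
play X π t s ((x₁ , x₂) ∷ cs) =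
  play X π (suc t)
    (emptierMove (X t) (pour½ (π ⟨$⟩ʳ x₂) (pour½ (π ⟨$⟩ʳ x₁) s))) cs

-- Average of f over a list; the expectation of f when the list enumerates
-- equally likely outcomes.

mean : {A : Set} → List A → (A → ℚ) → ℚ
mean []       f = 0ℚ
mean (x ∷ xs) f = foldr _+_ 0ℚ (map f (x ∷ xs)) * ((+ 1) / suc (length xs))

-- Each permutation of Fin n exactly once: `insert zero j π` sends zero to j.

permutations : ∀ n → List (Permutation′ n)
permutations zero    = [ idₚ ]
permutations (suc n) =
  concatMap (λ j → map (insert zero j) (permutations n)) (allFin (suc n))

-- The cups with filler labels 1, …, k (here 0, …, k - 1).

firstCups : ∀ n → ℕ → List (Fin n)
firstCups n k = filter (λ x → toℕ x ℕ.<? k) (allFin n)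

sequences : {A : Set} → List (List A) → List (List A)
sequences []         = [ [] ]
sequences (xs ∷ xss) = cartesianProductWith _∷_ xs (sequences xss)

-- For each step preceding the m-cup phase, the number of cups then in use:
-- T steps of each of the n-, (n-1)-, …, (m+1)-cup phases.

schedule : ℕ → ℕ → ℕ → List ℕ
schedule n m T = concatMap (λ i → replicate T (n ℕ.∸ i)) (upTo (n ℕ.∸ m))

fillerChoices : ∀ n → ℕ → ℕ → List (List (Fin n × Fin n))
fillerChoices n m T =
  sequences (map (λ k → cartesianProduct (firstCups n k) (firstCups n k))
                 (schedule n m T))

fillerOutcomes : ∀ n → ℕ → ℕ → List (Permutation′ n × List (Fin n × Fin n))
fillerOutcomes n m T = cartesianProduct (permutations n) (fillerChoices n m T)

averageFill : ∀ {n} → ℕ → Permutation′ n → State n → ℚ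
averageFill {n} m π s = mean (firstCups n m) (λ x → lookup s (π ⟨$⟩ʳ x))

-- At the beginning of the m-cup phase, with phases of T steps each.

expectedAverageFill : ∀ {n} → DynamicScoreBased n → (m T : ℕ) → ℚ
expectedAverageFill {n} X m T =
  mean (fillerOutcomes n m T) λ (π , cs) →
    averageFill m π (play X π 0 (Vec.replicate n 0ℚ) cs)

-- |m - n^(2/3)| < 1, that is, m is n^(2/3) rounded up or down
-- (for n = 0 no m qualifies).

IsRounded-⅔-power : ℕ → ℕ → Set
IsRounded-⅔-power n m =
  (m ℕ.∸ 1) ℕ.^ 3 ℕ.< n ℕ.^ 2 × n ℕ.^ 2 ℕ.< (m ℕ.+ 1) ℕ.^ 3

{-# OPTIONS --safe #-}

-- Fills are counted in half units, so that a step pours two units and removes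
-- at most two.  Call a step of a phase wasted if nothing is removed from the
-- active cups.  Every wasted step raises the total of the active cups, whereas
-- dropping a uniformly random cup between two phases does not change the
-- expected average fill.  It therefore suffices to find a constant
-- expected number of wasted steps in any two consecutive phases, with k + 1 and
-- k active cups, since the resulting gains Ω(1/k) add up to Ω(log n).
--
-- Let s be the total of the k + 1 cups.  A long window of the k-cup phase comes
-- with levels g, one for each of the k + 1 cups and of sum at most s + 1, such
-- that a dropped cup above its level can be made to cost the emptier a step.
-- The levels do not depend on the choices made in the previous phase, whereas
-- these make the parities of the fills nearly uniform.  So the fills differ from
-- the levels at a constant fraction of the cups, and a random dropped cup has
-- a constant expected excess over its level.  Over sufficiently many windows
-- this excess is wasted.  The score functions being real-valued, levels exist
-- only up to double negation, which is harmless as the final inequality between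
-- rationals is decidable.

module Submission where

open import Defs
open import Algebra.Bundles using (CommutativeRing)
open import Data.Bool using (Bool; true; false; if_then_else_; _∧_)
open import Data.Fin as Fin using (Fin; zero; suc; punchIn; toℕ; inject₁; inject≤)
open import Data.Fin.Permutation using (Permutation′; _⟨$⟩ʳ_; insert; insert-punchIn)
import Data.Fin.Properties as Fin
open import Data.Integer as ℤ using (+_)
import Data.Integer.Properties as ℤ
open import Data.Integer.Tactic.RingSolver using () renaming (solve-∀ to solveℤ)
open import Data.List as List using (List; []; _∷_; length; foldr; map; filter; _++_; replicate; tabulate; allFin; concatMap; upTo; applyUpTo; cartesianProduct; cartesianProductWith)
open import Data.List.Membership.Propositional using (_∈_)
open import Data.List.Membership.Propositional.Properties using (∈-++⁻)
import Data.List.Properties as List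
open import Data.List.Relation.Unary.Any using (here; there)
open import Data.Nat as ℕ using (ℕ; zero; suc; z≤n; s≤s)
open import Data.Nat.DivMod using (m≡m%n+[m/n]*n; m%n<n)
open import Data.Nat.Logarithm using (⌈log₂_⌉; ⌈log₂⌉-mono-≤; ⌈log₂2^n⌉≡n)
import Data.Nat.Properties as ℕ
open import Data.Nat.Tactic.RingSolver using () renaming (solve-∀ to solveℕ)
open import Data.Product using (_×_; _,_; Σ-syntax; ∃-syntax; proj₁; proj₂)
open import Data.Rational using (ℚ; 0ℚ; 1ℚ; ½; mkℚ; _/_; _+_; _-_; -_; _*_; ∣_∣; _≤_; _<_; _≤?_; toℚᵘ; *≤*; *<*; nonNegative)
open import Data.Rational.Properties
import Data.Rational.Unnormalised as ℚᵘ
import Data.Rational.Unnormalised.Properties as ℚᵘ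
open import Data.Sum using (_⊎_; inj₁; inj₂)
open import Data.Unit using (⊤; tt)
open import Data.Vec as Vec using (Vec; lookup; _[_]%=_)
import Data.Vec.Properties as Vec
open import Function using (_∘_; case_of_)
open import Relation.Binary.Definitions using (tri<; tri≈; tri>)
open import Relation.Binary.PropositionalEquality
open import Relation.Nullary using (¬_; Dec; yes; no; does; contradiction)
open import Relation.Nullary.Decidable using (dec⇒maybe; decidable-stable; ¬¬-excluded-middle; _×-dec_)
open import Relation.Unary using (Decidable)
open import Tactic.RingSolver using (solve-∀)
open import Tactic.RingSolver.Core.AlmostCommutativeRing using (AlmostCommutativeRing; fromCommutativeRing)
open import Algebra.Properties.Semiring.Sum ℕ.+-*-semiring using (sum; sum-remove; ∑-distrib-+; sum-cong-≗; sum-permute; *-distribˡ-sum)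
import Algebra.Properties.Semiring.Sum (CommutativeRing.semiring +-*-commutativeRing) as ℚΣ

-- Rational and real arithmetic

-- The emptier changes with time and may skip at will, so no state of the cups is bad for it by
-- itself. What can be exploited is that the same emptiers, at the same moments, have to avoid waste
-- in several games at once, one for each cup that might have been dropped. If the levels added up
-- to `s + 2` or more, these games could be advanced together, one being played at each time and the
-- others held still, with a bounded excess that falls at every step. There is a danger of
-- circularity in the phase length: a window must be longer than the number of cups times the total
-- `s`, and the windows must outnumber the ways to play one, whereas `s` itself could grow with the
-- length of the phases. A length depending on `n` alone is possible because a total above `n * n`
-- already gives a large enough average. The growth of a phase enters two inequalities, together
-- with the phase before and with the phase after. The inductive bound `value-≥` therefore carries a
-- separate term for the growth of the current phase, reserving half of its effect for the phase
-- before.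

ring : AlmostCommutativeRing _ _
ring = fromCommutativeRing +-*-commutativeRing (λ x → dec⇒maybe (0ℚ ≟ x))

≤⇒0≤ : ∀ {p q} → p ≤ q → 0ℚ ≤ q - p
≤⇒0≤ {p} {q} p≤q = subst (_≤ q - p) (+-inverseʳ p) (+-monoˡ-≤ (- p) p≤q)

cancel : ∀ a b → b - a + a ≡ b
cancel = solve-∀ ring

-- Most inequalities are proved by writing the difference as a visibly nonnegative expression `e`,
-- the identity being left to the ring solver.
by-diff : ∀ {a b e} → 0ℚ ≤ e → b - a ≡ e → a ≤ b
by-diff {a} {b} 0≤e eq =
  subst₂ _≤_ (+-identityˡ a) (trans (cong (_+ a) (sym eq)) (cancel a b)) (+-monoˡ-≤ a 0≤e)

0≤+ : ∀ {p q} → 0ℚ ≤ p → 0ℚ ≤ q → 0ℚ ≤ p + q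
0≤+ {p} {q} 0≤p 0≤q = subst (_≤ p + q) (+-identityˡ 0ℚ) (+-mono-≤ 0≤p 0≤q)

0≤* : ∀ {p q} → 0ℚ ≤ p → 0ℚ ≤ q → 0ℚ ≤ p * q
0≤* {p} {q} 0≤p 0≤q = subst (_≤ p * q) (*-zeroʳ p) (*-monoˡ-≤-nonNeg p {{nonNegative 0≤p}} 0≤q)

<⇒≱ : ∀ {p q} → p < q → ¬ q ≤ p
<⇒≱ p<q q≤p = <-irrefl refl (<-≤-trans p<q q≤p)

p≤∣p∣ : ∀ p → p ≤ ∣ p ∣
p≤∣p∣ p with ≤-total 0ℚ p
... | inj₁ 0≤p = ≤-reflexive (sym (0≤p⇒∣p∣≡p 0≤p))
... | inj₂ p≤0 = ≤-trans p≤0 (0≤∣p∣ p)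

toℚᵘ-/ : ∀ p q → toℚᵘ (p / suc q) ℚᵘ.≃ ℚᵘ.mkℚᵘ p q
toℚᵘ-/ p q = toℚᵘ-fromℚᵘ (ℚᵘ.mkℚᵘ p q)

/-distrib-+ : ∀ a b n → (+ (a ℕ.+ b)) / suc n ≡ (+ a) / suc n + (+ b) / suc n
/-distrib-+ a b n = toℚᵘ-injective (begin
  toℚᵘ ((+ (a ℕ.+ b)) / suc n)                    ≈⟨ toℚᵘ-/ (+ (a ℕ.+ b)) n ⟩
  ℚᵘ.mkℚᵘ (+ (a ℕ.+ b)) n                         ≈⟨ ℚᵘ.*≡* (ℤlem (+ a) (+ b) (+ suc n)) ⟩
  ℚᵘ.mkℚᵘ (+ a) n ℚᵘ.+ ℚᵘ.mkℚᵘ (+ b) n            ≈⟨ ℚᵘ.+-cong (ℚᵘ.≃-sym (toℚᵘ-/ (+ a) n)) (ℚᵘ.≃-sym (toℚᵘ-/ (+ b) n)) ⟩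
  toℚᵘ ((+ a) / suc n) ℚᵘ.+ toℚᵘ ((+ b) / suc n)  ≈⟨ ℚᵘ.≃-sym (toℚᵘ-homo-+ ((+ a) / suc n) ((+ b) / suc n)) ⟩
  toℚᵘ ((+ a) / suc n + (+ b) / suc n)            ∎)
  where
  open ℚᵘ.≃-Reasoning
  ℤlem : ∀ p q d → (p ℤ.+ q) ℤ.* (d ℤ.* d) ≡ (p ℤ.* d ℤ.+ q ℤ.* d) ℤ.* d
  ℤlem = solveℤ

archimedean : ∀ c {ε} → (∀ N → ε ≤ (+ c) / suc N) → ε ≤ 0ℚ
archimedean c {ε@(mkℚ (ℤ.-[1+ a ]) b _)} small = *≤* ℤ.-≤+
archimedean c {ε@(mkℚ (+ zero) b _)} small = *≤* (ℤ.+≤+ z≤n)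
-- The index `c * suc b` is large enough: c / (c * (b + 1) + 1) is below 1 / (b + 1), which is at
-- most `ε`.
archimedean c {ε@(mkℚ (+ suc a) b _)} small =
  contradiction (ℤ.drop‿+≤+ (subst₂ ℤ._≤_ refl (sym (ℤ.pos-* c (suc b))) (ℚᵘ.drop-*≤* ε≤ᵘ)))
    (ℕ.<⇒≱ (ℕ.≤-trans (ℕ.n<1+n (c ℕ.* suc b)) (ℕ.m≤m+n _ _)))
  where
  ε≤ᵘ : ℚᵘ.mkℚᵘ (+ suc a) b ℚᵘ.≤ ℚᵘ.mkℚᵘ (+ c) (c ℕ.* suc b)
  ε≤ᵘ = ℚᵘ.≤-respʳ-≃ (toℚᵘ-/ (+ c) (c ℕ.* suc b)) (toℚᵘ-mono-≤ (small (c ℕ.* suc b)))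

inv : ℕ → ℚ
inv n = (+ 1) / suc n

2/n≡inv+inv : ∀ n → (+ 2) / suc n ≡ inv n + inv n
2/n≡inv+inv = /-distrib-+ 1 1

<ᵣ⇒< : ∀ x y → (x<y : x <ᵣ y) → inv (proj₁ x<y) + inv (proj₁ x<y) < approx y (proj₁ x<y) - approx x (proj₁ x<y)
<ᵣ⇒< x y (n , lt) = subst (_< approx y n - approx x n) (2/n≡inv+inv n) lt

≤ᵣ⇒≤ : ∀ x y → x ≤ᵣ y → ∀ n → approx x n - approx y n ≤ inv n + inv n
≤ᵣ⇒≤ x y x≤y n = ≮⇒≥ λ lt → x≤y (n , subst (_< approx x n - approx y n) (sym (2/n≡inv+inv n)) lt)

approx-close : ∀ x m n → approx x m - approx x n ≤ inv m + inv n
approx-close x m n = ≤-trans (p≤∣p∣ _) (regular x m n)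

-- A witness of `z <ᵣ x` has a fixed index `n`, whereas the hypotheses bound the approximations at
-- every index `N`. They cost 2 / (N + 1) each, and passing between `n` and `N` costs another 1 / (N
-- + 1) for `x` and for `z`. The resulting error 6 / (N + 1) vanishes.
≤ᵣ-trans : ∀ x y z → x ≤ᵣ y → y ≤ᵣ z → x ≤ᵣ z
≤ᵣ-trans x y z x≤y y≤z z<x@(n , _) =
  <⇒≱ (<ᵣ⇒< z x z<x) (by-diff (≤⇒0≤ (archimedean 6 small)) (eq (approx x n) (approx z n) (inv n + inv n)))
  where
  eq : ∀ a b c → c - (a - b) ≡ 0ℚ - (a - b - c)
  eq = solve-∀ ring

  small : ∀ N → approx x n - approx z n - (inv n + inv n) ≤ (+ 6) / suc N
  small N = by-diff
    (0≤+ (0≤+ (≤⇒0≤ (≤ᵣ⇒≤ x y x≤y N)) (≤⇒0≤ (≤ᵣ⇒≤ y z y≤z N)))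
         (0≤+ (≤⇒0≤ (approx-close x n N)) (≤⇒0≤ (approx-close z N n))))
    (trans
      (cong (_- (approx x n - approx z n - (inv n + inv n))) six)
      (rearranged (approx x n) (approx z n) (approx x N) (approx y N) (approx z N) (inv N) (inv n)))
    where
    six : (+ 6) / suc N ≡ (inv N + inv N) + ((inv N + inv N) + (inv N + inv N))
    six = trans (/-distrib-+ 2 4 N) (cong₂ _+_ (2/n≡inv+inv N)
            (trans (/-distrib-+ 2 2 N) (cong₂ _+_ (2/n≡inv+inv N) (2/n≡inv+inv N))))
    rearranged : ∀ xn zn xN yN zN e d →
      (e + e) + ((e + e) + (e + e)) - (xn - zn - (d + d)) ≡
      ((e + e) - (xN - yN)) + ((e + e) - (yN - zN)) + ((d + e - (xn - xN)) + (e + d - (zN - zn)))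
    rearranged = solve-∀ ring

<ᵣ⇒≤ᵣ : ∀ x y → x <ᵣ y → x ≤ᵣ y
<ᵣ⇒≤ᵣ x y x<y@(n , _) y<x@(m , _) =
  <⇒≱ (+-mono-< (<ᵣ⇒< x y x<y) (<ᵣ⇒< y x y<x))
    (by-diff (0≤+ (≤⇒0≤ (approx-close x m n)) (≤⇒0≤ (approx-close y n m)))
      (rearranged (approx x n) (approx y n) (approx x m) (approx y m) (inv n) (inv m)))
  where
  rearranged : ∀ xn yn xm ym e d →
    (e + e) + (d + d) - ((yn - xn) + (xm - ym)) ≡ (d + e - (xm - xn)) + (e + d - (yn - ym))
  rearranged = solve-∀ ring

≤ᵣ-refl : ∀ x → x ≤ᵣ x
≤ᵣ-refl x x<x = <ᵣ⇒≤ᵣ x x x<x x<x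

-- The game in half units

abstract
  half : ℕ → ℚ
  half a = (+ a) / 2

  half≡/2 : ∀ a → half a ≡ (+ a) / 2
  half≡/2 a = refl

half-+ : ∀ a b → half (a ℕ.+ b) ≡ half a + half b
half-+ a b = trans (half≡/2 (a ℕ.+ b)) (trans (/-distrib-+ a b 1) (sym (cong₂ _+_ (half≡/2 a) (half≡/2 b))))

half-suc : ∀ a → half (suc a) ≡ half a + ½
half-suc a = trans (half-+ 1 a) (trans (cong (_+ half a) (half≡/2 1)) (+-comm ½ (half a)))

half-2+ : ∀ a → half (suc (suc a)) ≡ half a + 1ℚ
half-2+ a = trans (half-suc (suc a)) (trans (cong (_+ ½) (half-suc a)) (+-assoc (half a) ½ ½))

0≤half : ∀ a → 0ℚ ≤ half a
0≤half a = subst (0ℚ ≤_) (sym (half≡/2 a)) (nonNegative⁻¹ _ {{normalize-nonNeg a 2}})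

half-mono-< : ∀ {a b} → a ℕ.< b → half a < half b
half-mono-< {a} {b} a<b = subst (half a <_)
  (trans (sym (half-+ a (b ℕ.∸ a))) (cong half (ℕ.m+[n∸m]≡n (ℕ.<⇒≤ a<b))))
  (subst (_< half a + half (b ℕ.∸ a)) (+-identityʳ (half a)) (+-monoʳ-< (half a) positive-gap))
  where
  positive-gap : 0ℚ < half (b ℕ.∸ a)
  positive-gap = subst (0ℚ <_) (sym (half≡/2 (b ℕ.∸ a)))
    (positive⁻¹ _ {{normalize-pos (b ℕ.∸ a) 2 {{_}} {{ℕ.>-nonZero (ℕ.m<n⇒0<n∸m a<b)}}}})

∧-does⇒ : ∀ b {P : Set} (P? : Dec P) → b ∧ does P? ≡ true → P
∧-does⇒ true (yes p) refl = p

module _ {n} (X : ScoreBased n) where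
  open ScoreBased X

  score : Fin n → ℕ → ℝ
  score i a = σ i (half a)

  score-mono : ∀ i {a b} → a ℕ.≤ b → score i a ≤ᵣ score i b
  score-mono i {a} {b} a≤b with ℕ.m≤n⇒m<n∨m≡n a≤b
  ... | inj₁ a<b  = <ᵣ⇒≤ᵣ (score i a) (score i b) (increasing i (0≤half a) (half-mono-< a<b))
  ... | inj₂ refl = ≤ᵣ-refl (score i a)

  score-cancel-≤ : ∀ i {a b} → score i a ≤ᵣ score i b → a ℕ.≤ b
  score-cancel-≤ i {a} {b} le with a ℕ.≤? b
  ... | yes a≤b = a≤b
  ... | no  a≰b = contradiction (increasing i (0≤half b) (half-mono-< (ℕ.≰⇒> a≰b))) le

  score-distinct : ∀ {i j a b} → i ≢ j → 1 ℕ.≤ a → 1 ℕ.≤ b →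
                   score i a ≤ᵣ score j b → ¬ score j b ≤ᵣ score i a
  score-distinct {i} {j} {suc a} {suc b} i≢j _ _ le ge =
    distinct i a j b (λ eq → i≢j (cong proj₁ eq))
      (subst₂ (λ p q → σ i p ≤ᵣ σ j q) (half≡/2 (suc a)) (half≡/2 (suc b)) le ,
       subst₂ (λ p q → σ j q ≤ᵣ σ i p) (half≡/2 (suc a)) (half≡/2 (suc b)) ge)

  sel : Vec ℕ n → Fin n
  sel f = select (Vec.map half f)

  removes : Vec ℕ n → Bool
  removes f = remove? (Vec.map half f) ∧ does (1ℚ ≤? lookup (Vec.map half f) (sel f))

  move : Vec ℕ n → Vec ℕ n
  move f = if removes f then f [ sel f ]%= (ℕ._∸ 2) else f

  sel-max : ∀ f i → score i (lookup f i) ≤ᵣ score (sel f) (lookup f (sel f))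
  sel-max f i = subst₂ (λ p q → σ i p ≤ᵣ σ (sel f) q) (Vec.lookup-map i half f) (Vec.lookup-map (sel f) half f)
    (maximal (Vec.map half f) i)

  -- The emptier only removes from a cup holding a full unit, so the truncated subtraction in `move`
  -- agrees with the subtraction of fills.
  removes⇒2≤ : ∀ f → removes f ≡ true → 2 ℕ.≤ lookup f (sel f)
  removes⇒2≤ f eq with 2 ℕ.≤? lookup f (sel f)
  ... | yes 2≤ = 2≤
  ... | no  2≰ = contradiction 1≤ (<⇒≱ (subst (half (lookup f (sel f)) <_) half2 (half-mono-< (ℕ.≰⇒> 2≰))))
    where
    half2 : half 2 ≡ 1ℚ
    half2 = half≡/2 2
    1≤ : 1ℚ ≤ half (lookup f (sel f))
    1≤ = subst (1ℚ ≤_) (Vec.lookup-map (sel f) half f) (∧-does⇒ (remove? (Vec.map half f)) (1ℚ ≤? _) eq)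

  emptierMove-half : ∀ f → emptierMove X (Vec.map half f) ≡ Vec.map half (move f)
  emptierMove-half f with removes f in eq
  ... | false = refl
  ... | true  = sym (Vec.map-updateAt f (sel f) (lower (lookup f (sel f)) (removes⇒2≤ f eq)))
    where
    lower : ∀ a → 2 ℕ.≤ a → half (a ℕ.∸ 2) ≡ half a - 1ℚ
    lower (suc zero) (s≤s ())
    lower (suc (suc a)) _ = trans (minus-plus (half a) 1ℚ) (cong (_- 1ℚ) (sym (half-2+ a)))
      where
      minus-plus : ∀ p q → p ≡ p + q - q
      minus-plus = solve-∀ ring

  turn : Fin n → Fin n → Vec ℕ n → Vec ℕ n
  turn i j f = move ((f [ i ]%= suc) [ j ]%= suc)

  turn-half : ∀ i j f → emptierMove X (pour½ j (pour½ i (Vec.map half f))) ≡ Vec.map half (turn i j f)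
  turn-half i j f = trans (cong (emptierMove X) (trans (cong (pour½ j) (pour-half i f)) (pour-half j (f [ i ]%= suc))))
                          (emptierMove-half _)
    where
    pour-half : ∀ i f → pour½ i (Vec.map half f) ≡ Vec.map half (f [ i ]%= suc)
    pour-half i f = sym (Vec.map-updateAt f i (half-suc (lookup f i)))

-- Totals over the active cups

sum-mono : ∀ {k} {f g : Fin k → ℕ} → (∀ x → f x ℕ.≤ g x) → sum f ℕ.≤ sum g
sum-mono {zero}  f≤g = z≤n
sum-mono {suc k} f≤g = ℕ.+-mono-≤ (f≤g zero) (sum-mono (f≤g ∘ suc))

sum-mono-< : ∀ {k} {f g : Fin k → ℕ} → (∀ x → f x ℕ.≤ g x) → ∀ y → f y ℕ.< g y → sum f ℕ.< sum g
sum-mono-< f≤g zero    f<g = ℕ.+-mono-<-≤ f<g (sum-mono (f≤g ∘ suc))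
sum-mono-< f≤g (suc y) f<g = ℕ.+-mono-≤-< (f≤g zero) (sum-mono-< (f≤g ∘ suc) y f<g)

sum-<⇒∃< : ∀ {k} (f g : Fin k → ℕ) → sum f ℕ.< sum g → Σ[ x ∈ Fin k ] f x ℕ.< g x
sum-<⇒∃< {suc k} f g lt with f zero ℕ.<? g zero
... | yes f<g = zero , f<g
... | no  f≮g with sum-<⇒∃< (f ∘ suc) (g ∘ suc) (ℕ.≰⇒> λ ge → ℕ.<⇒≱ lt (ℕ.+-mono-≤ (ℕ.≮⇒≥ f≮g) ge))
...   | x , f<g = suc x , f<g

Distinct : ∀ {k n} → (Fin k → Fin n) → Set
Distinct ι = ∀ {x y} → ι x ≡ ι y → x ≡ y

total : ∀ {k n} → (Fin k → Fin n) → Vec ℕ n → ℕ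
total ι f = sum (λ x → lookup f (ι x))

without : ∀ {k n} → (Fin (suc k) → Fin n) → Fin (suc k) → Fin k → Fin n
without ι d = ι ∘ punchIn d

Distinct-without : ∀ {k n} {ι : Fin (suc k) → Fin n} → Distinct ι → ∀ d → Distinct (without ι d)
Distinct-without ι-inj d eq = Fin.punchIn-injective d _ _ (ι-inj eq)

total-without : ∀ {k n} (ι : Fin (suc k) → Fin n) d f → total ι f ≡ lookup f (ι d) ℕ.+ total (without ι d) f
total-without ι d f = sum-remove {i = d} (λ x → lookup f (ι x))

sum-change : ∀ {k} (a b : Fin k → ℕ) x → (∀ y → y ≢ x → b y ≡ a y) → sum b ℕ.+ a x ≡ sum a ℕ.+ b x
sum-change {suc k} a b x same = begin
  sum b ℕ.+ a x                              ≡⟨ cong (ℕ._+ a x) (sum-remove {i = x} b) ⟩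
  (b x ℕ.+ sum (b ∘ punchIn x)) ℕ.+ a x      ≡⟨ cong (λ p → (b x ℕ.+ p) ℕ.+ a x) (sum-cong-≗ λ y → same _ (Fin.punchInᵢ≢i x y)) ⟩
  (b x ℕ.+ sum (a ∘ punchIn x)) ℕ.+ a x      ≡⟨ swap (b x) (sum (a ∘ punchIn x)) (a x) ⟩
  (a x ℕ.+ sum (a ∘ punchIn x)) ℕ.+ b x      ≡⟨ cong (ℕ._+ b x) (sum-remove {i = x} a) ⟨
  sum a ℕ.+ b x                              ∎
  where
  open ≡-Reasoning
  swap : ∀ p q r → (p ℕ.+ q) ℕ.+ r ≡ (r ℕ.+ q) ℕ.+ p
  swap = solveℕ

total-update : ∀ {k n} (ι : Fin k → Fin n) → Distinct ι → ∀ x (h : ℕ → ℕ) f →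
               total ι (f [ ι x ]%= h) ℕ.+ lookup f (ι x) ≡ total ι f ℕ.+ h (lookup f (ι x))
total-update ι ι-inj x h f = trans
  (sum-change _ _ x λ y y≢x → Vec.lookup∘updateAt′ (ι y) (ι x) (y≢x ∘ ι-inj) f)
  (cong (total ι f ℕ.+_) (Vec.lookup∘updateAt (ι x) f))

total-minimal : ∀ {k n} (ι : Fin k → Fin n) {i} → (∀ x → ι x ≢ i) → ∀ (h : ℕ → ℕ) f →
                total ι (f [ i ]%= h) ≡ total ι f
total-minimal ι {i} i∉ι h f = sum-cong-≗ λ x → Vec.lookup∘updateAt′ (ι x) i (i∉ι x) f

total-suc : ∀ {k n} (ι : Fin k → Fin n) → Distinct ι → ∀ x f → total ι (f [ ι x ]%= suc) ≡ suc (total ι f)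
total-suc ι ι-inj x f = ℕ.+-cancelʳ-≡ (lookup f (ι x)) _ _
  (trans (total-update ι ι-inj x suc f) (ℕ.+-suc (total ι f) (lookup f (ι x))))

poured : ∀ {k n} → (Fin k → Fin n) → Fin k → Fin k → Vec ℕ n → Vec ℕ n
poured ι x y f = (f [ ι x ]%= suc) [ ι y ]%= suc

play₁ : ∀ {k n} → ScoreBased n → (Fin k → Fin n) → Fin k → Fin k → Vec ℕ n → Vec ℕ n
play₁ X ι x y f = turn X (ι x) (ι y) f

module _ {n} (X : ScoreBased n) {k} (ι : Fin k → Fin n) (ι-inj : Distinct ι) where

  total-poured : ∀ x y f → total ι (poured ι x y f) ≡ 2 ℕ.+ total ι f
  total-poured x y f = trans (total-suc ι ι-inj y (f [ ι x ]%= suc)) (cong suc (total-suc ι ι-inj x f))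

  record Spent (f : Vec ℕ n) : Set where
    field
      cup     : Fin k
      is-sel  : ι cup ≡ sel X f
      enough  : 2 ℕ.≤ lookup f (ι cup)
      removed : move X f ≡ f [ ι cup ]%= (ℕ._∸ 2)

  total-move : ∀ f → (Spent f × 2 ℕ.+ total ι (move X f) ≡ total ι f) ⊎ total ι (move X f) ≡ total ι f
  total-move f with removes X f in eq
  ... | false = inj₂ refl
  ... | true with Fin.any? (λ x → ι x Fin.≟ sel X f)
  ...   | no  ∄x         = inj₂ (total-minimal ι (λ x eq → ∄x (x , eq)) _ f)
  ...   | yes (x , ιx≡s) = inj₁ (record { cup = x ; is-sel = ιx≡s ; enough = 2≤ ; removed = moved } , total-eq)
    where
    2≤ : 2 ℕ.≤ lookup f (ι x)
    2≤ = subst (λ i → 2 ℕ.≤ lookup f i) (sym ιx≡s) (removes⇒2≤ X f eq)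
    moved : move X f ≡ f [ ι x ]%= (ℕ._∸ 2)
    moved = trans (cong (λ b → if b then f [ sel X f ]%= (ℕ._∸ 2) else f) eq)
                  (cong (λ i → f [ i ]%= (ℕ._∸ 2)) (sym ιx≡s))
    cancel-2 : ∀ {a t t′} → 2 ℕ.≤ a → t′ ℕ.+ a ≡ t ℕ.+ (a ℕ.∸ 2) → 2 ℕ.+ t′ ≡ t
    cancel-2 {suc zero} (s≤s ())
    cancel-2 {suc (suc a)} {t} {t′} _ e = ℕ.+-cancelʳ-≡ a _ _ (trans (assoc t′ a) e)
      where
      assoc : ∀ t a → 2 ℕ.+ t ℕ.+ a ≡ t ℕ.+ (2 ℕ.+ a)
      assoc = solveℕ
    total-eq : 2 ℕ.+ total ι (f [ sel X f ]%= (ℕ._∸ 2)) ≡ total ι f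
    total-eq = subst (λ i → 2 ℕ.+ total ι (f [ i ]%= (ℕ._∸ 2)) ≡ total ι f) ιx≡s
      (cancel-2 2≤ (total-update ι ι-inj x (ℕ._∸ 2) f))

  total-play₁-≥ : ∀ x y f → total ι f ℕ.≤ total ι (play₁ X ι x y f)
  total-play₁-≥ x y f with total-move (poured ι x y f)
  ... | inj₁ (_ , eq) = ℕ.≤-reflexive (sym (ℕ.+-cancelˡ-≡ 2 _ _ (trans eq (total-poured x y f))))
  ... | inj₂ eq       = ℕ.≤-trans (ℕ.m≤n+m _ 2) (ℕ.≤-reflexive (sym (trans eq (total-poured x y f))))

  -- Two half units have been poured, so a constant total means that the selected cup is active and
  -- was emptied. The arbitrary decision to skip enters the construction of the levels only through
  -- this fact.
  stall⇒spent : ∀ x y f → total ι (play₁ X ι x y f) ≡ total ι f → Spent (poured ι x y f)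
  stall⇒spent x y f stall with total-move (poured ι x y f)
  ... | inj₁ (spent , _) = spent
  ... | inj₂ eq          = contradiction (trans (sym (total-poured x y f)) (trans (sym eq) stall)) (ℕ.<⇒≢ (ℕ.m<n+m _ (s≤s z≤n)) ∘ sym)

-- Levels of the dropped cup

¬¬-∀ : ∀ {k} {P : Fin k → Set} → (∀ x → ¬ ¬ P x) → ¬ ¬ (∀ x → P x)
¬¬-∀ {zero}  ¬¬P ¬all = ¬all λ ()
¬¬-∀ {suc k} ¬¬P ¬all = ¬¬P zero λ p → ¬¬-∀ (¬¬P ∘ suc) λ ps → ¬all λ { zero → p ; (suc x) → ps x }

¬¬-argmax : ∀ {k} (r : Fin k → ℝ) {P : Fin k → Set} → Decidable P →
            ¬ ¬ ((∀ x → ¬ P x) ⊎ (Σ[ x ∈ Fin k ] P x × (∀ y → P y → r y ≤ᵣ r x)))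
¬¬-argmax {zero}  r P? ¬goal = ¬goal (inj₁ λ ())
¬¬-argmax {suc k} r P? ¬goal = ¬¬-argmax (r ∘ suc) (P? ∘ suc) λ where
  (inj₁ none) → case P? zero of λ where
    (no ¬p) → ¬goal (inj₁ λ { zero → ¬p ; (suc x) → none x })
    (yes p) → ¬goal (inj₂ (zero , p , λ { zero _ → ≤ᵣ-refl (r zero) ; (suc y) q → contradiction q (none y) }))
  (inj₂ (x , px , max)) → case P? zero of λ where
    (no ¬p) → ¬goal (inj₂ (suc x , px , λ { zero p → contradiction p ¬p ; (suc y) q → max y q }))
    (yes p) → ¬¬-excluded-middle {A = r zero <ᵣ r (suc x)} λ where
      (yes lt) → ¬goal (inj₂ (suc x , px , λ { zero _ → <ᵣ⇒≤ᵣ (r zero) (r (suc x)) lt ; (suc y) q → max y q }))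
      (no ≥)   → ¬goal (inj₂ (zero , p , λ { zero _ → ≤ᵣ-refl (r zero)
                                           ; (suc y) q → ≤ᵣ-trans (r (suc y)) (r (suc x)) (r zero) (max y q) ≥ }))

-- The default value 0 need not satisfy `P`; in the application `P a` asks for a safe state in which
-- the dropped cup holds at least `a`.
¬¬-max : ∀ (P : ℕ → Set) s → ¬ ¬ (Σ[ a ∈ ℕ ] (a ≡ 0 ⊎ P a) × (∀ b → a ℕ.< b → b ℕ.≤ s → ¬ P b))
¬¬-max P zero    ¬goal = ¬goal (0 , inj₁ refl , λ b 0<b b≤0 _ → ℕ.<⇒≱ 0<b b≤0)
¬¬-max P (suc s) ¬goal = ¬¬-excluded-middle {A = P (suc s)} λ where
  (yes p) → ¬goal (suc s , inj₂ p , λ b s<b b≤s _ → ℕ.<⇒≱ s<b b≤s)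
  (no ¬p) → ¬¬-max P s λ where
    (a , witness , max) → ¬goal (a , witness , λ b a<b b≤1+s → case ℕ.m≤n⇒m<n∨m≡n b≤1+s of λ where
      (inj₁ (s≤s b≤s)) → max b a<b b≤s
      (inj₂ refl)      → ¬p)

module _ {n} (X : ℕ → ScoreBased n) {k} (A : Fin k → Fin n) where

  Safe : ℕ → ℕ → Vec ℕ n → Set
  Safe zero    t f = ⊤
  Safe (suc i) t f = ∀ x y → total A (play₁ (X t) A x y f) ≡ total A f × Safe i (suc t) (play₁ (X t) A x y f)

  -- Only finitely many plays are concerned. Decidability discharges the double negation in
  -- `Safe-stay` and locates a wasted step in `unsafe⇒growth`.
  Safe? : ∀ i t f → Dec (Safe i t f)
  Safe? zero    t f = yes tt
  Safe? (suc i) t f = Fin.all? λ x → Fin.all? λ y →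
    (total A (play₁ (X t) A x y f) ℕ.≟ total A f) ×-dec Safe? i (suc t) (play₁ (X t) A x y f)

lookup-poured-≢ : ∀ {k n} (A : Fin k → Fin n) x y {i} f → i ≢ A x → i ≢ A y → lookup (poured A x y f) i ≡ lookup f i
lookup-poured-≢ A x y {i} f i≢x i≢y =
  trans (Vec.lookup∘updateAt′ i (A y) i≢y (f [ A x ]%= suc)) (Vec.lookup∘updateAt′ i (A x) i≢x f)

lookup-poured² : ∀ {k n} (A : Fin k → Fin n) x f → lookup (poured A x x f) (A x) ≡ 2 ℕ.+ lookup f (A x)
lookup-poured² A x f = trans (Vec.lookup∘updateAt (A x) (f [ A x ]%= suc)) (cong suc (Vec.lookup∘updateAt (A x) f))

module _ {n} (X : ℕ → ScoreBased n) {k} (A : Fin (suc k) → Fin n) (A-inj : Distinct A) where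

  -- Pouring a full unit into the cup whose score would then be largest makes
  -- the emptier undo that very step.
  Safe-stay : ∀ i t f → Safe X A (suc i) t f → Safe X A i (suc t) f
  Safe-stay i t f safe = decidable-stable (Safe? X A i (suc t) f) λ ¬safe →
    ¬¬-argmax (λ x → score (X t) (A x) (2 ℕ.+ lookup f (A x))) (λ _ → yes tt) λ where
      (inj₁ none)          → none zero tt
      (inj₂ (x , _ , max)) → ¬safe (subst (Safe X A i (suc t)) (undone x (λ y → max y tt)) (proj₂ (safe x x)))
    where
    undone : ∀ x → (∀ y → score (X t) (A y) (2 ℕ.+ lookup f (A y)) ≤ᵣ score (X t) (A x) (2 ℕ.+ lookup f (A x))) →
             play₁ (X t) A x x f ≡ f
    undone x max with stall⇒spent (X t) A A-inj x x f (proj₁ (safe x x))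
    ... | record { cup = z ; is-sel = z≡sel ; removed = removed } with z Fin.≟ x
    ...   | yes refl = trans removed (trans (cong (_[ A z ]%= (ℕ._∸ 2)) (Vec.updateAt-updateAt (A z) f))
                         (trans (Vec.updateAt-updateAt (A z) f) (Vec.updateAt-id-local (A z) f refl)))
    -- A different choice `z` would have, at its present fill, at least the score of `x` after the
    -- pour, which is maximal among the scores of all cups raised by two.
    ...   | no z≢x = contradiction (score-cancel-≤ (X t) (A z) 2+fz≤fz) (ℕ.<⇒≱ (ℕ.m<n+m (lookup f (A z)) {2} (s≤s z≤n)))
      where
      fₚ = poured A x x f
      2+fz≤fz : score (X t) (A z) (2 ℕ.+ lookup f (A z)) ≤ᵣ score (X t) (A z) (lookup f (A z))
      2+fz≤fz = ≤ᵣ-trans (score (X t) (A z) (2 ℕ.+ lookup f (A z))) (score (X t) (A x) (2 ℕ.+ lookup f (A x)))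
        (score (X t) (A z) (lookup f (A z))) (max z)
        (subst₂ (λ a b → score (X t) (A x) a ≤ᵣ score (X t) (A z) b)
          (lookup-poured² A x f)
          (lookup-poured-≢ A x x f (z≢x ∘ A-inj) (z≢x ∘ A-inj))
          (subst (λ s → score (X t) (A x) (lookup fₚ (A x)) ≤ᵣ score (X t) s (lookup fₚ s)) (sym z≡sel) (sel-max (X t) fₚ (A x))))

excess : ∀ {k n} → (Fin k → Fin n) → (Fin k → ℕ) → Vec ℕ n → ℕ
excess A g f = sum λ x → lookup f (A x) ℕ.∸ g x

module _ {k n} (A : Fin k → Fin n) (A-inj : Distinct A) (g : Fin k → ℕ) where

  excess-pour : ∀ x f → lookup f (A x) ℕ.< g x → excess A g (f [ A x ]%= suc) ≡ excess A g f
  excess-pour x f fx<gx = sum-cong-≗ same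
    where
    same : ∀ z → lookup (f [ A x ]%= suc) (A z) ℕ.∸ g z ≡ lookup f (A z) ℕ.∸ g z
    same z with z Fin.≟ x
    ... | yes refl = trans (cong (ℕ._∸ g z) (Vec.lookup∘updateAt (A z) f))
                       (trans (ℕ.m≤n⇒m∸n≡0 fx<gx) (sym (ℕ.m≤n⇒m∸n≡0 (ℕ.<⇒≤ fx<gx))))
    ... | no z≢x   = cong (ℕ._∸ g z) (Vec.lookup∘updateAt′ (A z) (A x) (z≢x ∘ A-inj) f)

  excess-remove : ∀ x f → g x ℕ.< lookup f (A x) → excess A g (f [ A x ]%= (ℕ._∸ 2)) ℕ.< excess A g f
  excess-remove x f gx<fx = sum-mono-< less x strict
    where
    at-x : lookup (f [ A x ]%= (ℕ._∸ 2)) (A x) ≡ lookup f (A x) ℕ.∸ 2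
    at-x = Vec.lookup∘updateAt (A x) f
    strict : lookup (f [ A x ]%= (ℕ._∸ 2)) (A x) ℕ.∸ g x ℕ.< lookup f (A x) ℕ.∸ g x
    strict = subst (λ a → a ℕ.∸ g x ℕ.< lookup f (A x) ℕ.∸ g x) (sym at-x) (drop (lookup f (A x)) gx<fx)
      where
      drop : ∀ a → g x ℕ.< a → a ℕ.∸ 2 ℕ.∸ g x ℕ.< a ℕ.∸ g x
      drop (suc a) (s≤s g≤a) = ℕ.≤-<-trans (ℕ.∸-monoˡ-≤ (g x) (ℕ.m∸n≤m a 1)) (subst (a ℕ.∸ g x ℕ.<_) (sym (ℕ.+-∸-assoc 1 g≤a)) (ℕ.n<1+n _))
    less : ∀ z → lookup (f [ A x ]%= (ℕ._∸ 2)) (A z) ℕ.∸ g z ℕ.≤ lookup f (A z) ℕ.∸ g z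
    less z with z Fin.≟ x
    ... | yes refl = ℕ.<⇒≤ strict
    ... | no z≢x   = ℕ.≤-reflexive (cong (ℕ._∸ g z) (Vec.lookup∘updateAt′ (A z) (A x) (z≢x ∘ A-inj) f))

module _ {n} (X : ℕ → ScoreBased n) {k} (ι : Fin (suc (suc k)) → Fin n) where

  -- A total of `s` is divided into `a` for the dropped cup and `s - a` for the others. The dropped
  -- cup may hold more than its share, because the actual total may have grown beyond `s`.
  SafeAt : ℕ → ℕ → ℕ → Fin (suc (suc k)) → ℕ → Vec ℕ n → Set
  SafeAt s i t d a f = a ℕ.≤ lookup f (ι d) × total (without ι d) f ℕ.+ a ≡ s × Safe X (without ι d) i t f

  -- g d is a level of the cup d above which the filler, playing on the other
  -- cups only, can make the emptier waste a step.
  Threshold : ℕ → ℕ → ℕ → (Fin (suc (suc k)) → ℕ) → Set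
  Threshold L s t g = sum g ℕ.≤ suc s ×
    (∀ d f → s ℕ.≤ total ι f → g d ℕ.+ total (without ι d) f ℕ.< s → ¬ Safe X (without ι d) L t f)

  Thresholds : ℕ → ℕ → ℕ → List (Fin (suc (suc k)) → ℕ) → Set
  Thresholds L s t []       = ⊤
  Thresholds L s t (g ∷ gs) = Threshold L s t g × Thresholds L s (L ℕ.+ t) gs

module _ {n} (X : ℕ → ScoreBased n) {k} (ι : Fin (suc (suc k)) → Fin n) (ι-inj : Distinct ι) where

  module _ (s : ℕ) (g : Fin (suc (suc k)) → ℕ) (s+2≤g : 2 ℕ.+ s ℕ.≤ sum g) where

    excesses : (Fin (suc (suc k)) → Vec ℕ n) → ℕ
    excesses F = sum λ d → excess (without ι d) (g ∘ punchIn d) (F d)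

    module _ (t : ℕ) (d : Fin (suc (suc k))) (f : Vec ℕ n) (1≤gd : 1 ℕ.≤ g d) (gd≤fd : g d ℕ.≤ lookup f (ι d))
             (max : ∀ e → 1 ℕ.≤ g e → score (X t) (ι e) (g e) ≤ᵣ score (X t) (ι d) (g d))
             (x y : Fin (suc k)) where

      private
        A = without ι d
        f₂ = poured A x y f
        S = score (X t)

      outside : ∀ z → ι d ≢ A z
      outside z eq = Fin.punchInᵢ≢i d z (sym (ι-inj eq))

      poured-outside : lookup f₂ (ι d) ≡ lookup f (ι d)
      poured-outside = lookup-poured-≢ A x y f (outside x) (outside y)

      module _ (spent : Spent (X t) A (Distinct-without ι-inj d) f₂) where
        open Spent spent renaming (cup to c)

        play-outside : lookup (play₁ (X t) A x y f) (ι d) ≡ lookup f (ι d)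
        play-outside = trans (cong (λ v → lookup v (ι d)) removed)
          (trans (Vec.lookup∘updateAt′ (ι d) (A c) (outside c) f₂) poured-outside)

        -- The emptier preferred `c` to the cup `d`, whose score is at least the one at `g d`, and
        -- this is at least the score of `c` at its own level. If `c` were not above its level, two
        -- scores at positive fills would coincide.
        spent-above : g (punchIn d c) ℕ.< lookup f₂ (A c)
        spent-above = ℕ.≰⇒> λ le →
          let 1≤h = ℕ.≤-trans (s≤s z≤n) (ℕ.≤-trans enough le) in
          score-distinct (X t) (outside c ∘ sym) 1≤h 1≤gd (max (punchIn d c) 1≤h) (chain le)
          where
          chain : lookup f₂ (A c) ℕ.≤ g (punchIn d c) → S (ι d) (g d) ≤ᵣ S (A c) (g (punchIn d c))
          chain le = ≤ᵣ-trans (S (ι d) (g d)) (S (ι d) (lookup f₂ (ι d))) (S (A c) (g (punchIn d c)))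
            (score-mono (X t) (ι d) (subst (g d ℕ.≤_) (sym poured-outside) gd≤fd))
            (≤ᵣ-trans (S (ι d) (lookup f₂ (ι d))) (S (A c) (lookup f₂ (A c))) (S (A c) (g (punchIn d c)))
              (subst (λ j → S (ι d) (lookup f₂ (ι d)) ≤ᵣ S j (lookup f₂ j)) (sym is-sel) (sel-max (X t) f₂ (ι d)))
              (score-mono (X t) (A c) le))

        excess-play : lookup f (A x) ℕ.< g (punchIn d x) → lookup (f [ A x ]%= suc) (A y) ℕ.< g (punchIn d y) →
                      excess A (g ∘ punchIn d) (play₁ (X t) A x y f) ℕ.< excess A (g ∘ punchIn d) f
        excess-play x-below y-below = subst₂ ℕ._<_ (cong (excess A (g ∘ punchIn d)) (sym removed))
          (trans (excess-pour A (Distinct-without ι-inj d) (g ∘ punchIn d) y (f [ A x ]%= suc) y-below)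
                 (excess-pour A (Distinct-without ι-inj d) (g ∘ punchIn d) x f x-below))
          (excess-remove A (Distinct-without ι-inj d) (g ∘ punchIn d) c f₂ spent-above)

    -- Two half units fit below the levels of the other cups, one for each pour of a step. This is
    -- why the sum of the levels is bounded by `suc s`.
    room : ∀ d f → total (without ι d) f ℕ.+ g d ≡ s → 1 ℕ.+ total (without ι d) f ℕ.< sum (g ∘ punchIn d)
    room d f total-f = ℕ.+-cancelˡ-≤ (g d) _ _ (ℕ.≤-trans
      (ℕ.≤-reflexive (trans (rearranged (g d) (total (without ι d) f)) (cong (2 ℕ.+_) total-f)))
      (ℕ.≤-trans s+2≤g (ℕ.≤-reflexive (sum-remove {i = d} g))))
      where
      rearranged : ∀ a b → a ℕ.+ (2 ℕ.+ b) ≡ 2 ℕ.+ (b ℕ.+ a)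
      rearranged = solveℕ

    -- In the game without the cup d whose score at level g d is largest, the
    -- filler can pour into cups below their levels, and then the emptier has to
    -- remove water from a cup above its level.
    lower-excess : ∀ i t d f → 1 ℕ.≤ g d → SafeAt X ι s (suc i) t d (g d) f →
                   (∀ e → 1 ℕ.≤ g e → score (X t) (ι e) (g e) ≤ᵣ score (X t) (ι d) (g d)) →
                   Σ[ f′ ∈ Vec ℕ n ] SafeAt X ι s i (suc t) d (g d) f′ ×
                     excess (without ι d) (g ∘ punchIn d) f′ ℕ.< excess (without ι d) (g ∘ punchIn d) f
    lower-excess i t d f 1≤gd (gd≤fd , total-f , safe) max =
      pour-x (sum-<⇒∃< (λ z → lookup f (A z)) (g ∘ punchIn d) (ℕ.<-trans (ℕ.n<1+n _) (room d f total-f)))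
      where
      A = without ι d
      Goal = Σ[ f′ ∈ Vec ℕ n ] SafeAt X ι s i (suc t) d (g d) f′ ×
               excess (without ι d) (g ∘ punchIn d) f′ ℕ.< excess (without ι d) (g ∘ punchIn d) f
      pour-xy : ∀ x y → lookup f (A x) ℕ.< g (punchIn d x) → lookup (f [ A x ]%= suc) (A y) ℕ.< g (punchIn d y) → Goal
      pour-xy x y x-below y-below =
        play₁ (X t) A x y f ,
        (subst (g d ℕ.≤_) (sym (play-outside t d f 1≤gd gd≤fd max x y spent)) gd≤fd ,
         trans (cong (ℕ._+ g d) (proj₁ (safe x y))) total-f , proj₂ (safe x y)) ,
        excess-play t d f 1≤gd gd≤fd max x y spent x-below y-below
        where
        spent = stall⇒spent (X t) A (Distinct-without ι-inj d) x y f (proj₁ (safe x y))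
      pour-x : Σ[ x ∈ Fin (suc k) ] lookup f (A x) ℕ.< g (punchIn d x) → Goal
      pour-x (x , x-below) = pour-y (sum-<⇒∃< (λ z → lookup (f [ A x ]%= suc) (A z)) (g ∘ punchIn d)
        (subst (ℕ._< sum (g ∘ punchIn d)) (sym (total-suc A (Distinct-without ι-inj d) x f)) (room d f total-f)))
        where
        pour-y : Σ[ y ∈ Fin (suc k) ] lookup (f [ A x ]%= suc) (A y) ℕ.< g (punchIn d y) → Goal
        pour-y (y , y-below) = pour-xy x y x-below y-below

    -- All games share the time `t`, since the score functions change with it. A step is played in
    -- the game whose cup has the largest score at its level now, and this lowers the excess there;
    -- meanwhile `Safe-stay` preserves the states of all other games. So `i` safe steps require a
    -- combined excess of at least `i`.
    descent : ∀ i t (F : Fin (suc (suc k)) → Vec ℕ n) →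
              (∀ d → 1 ℕ.≤ g d → SafeAt X ι s i t d (g d) (F d)) → i ℕ.≤ excesses F
    descent zero    t F safe = z≤n
    descent (suc i) t F safe = decidable-stable (suc i ℕ.≤? excesses F) λ ≰ →
      ¬¬-argmax (λ d → score (X t) (ι d) (g d)) (λ d → 1 ℕ.≤? g d) λ where
        (inj₁ none) → contradiction (sum-<⇒∃< (λ _ → 0) g (ℕ.≤-<-trans (ℕ.≤-reflexive (sum-zero (suc (suc k)))) (ℕ.≤-trans (s≤s z≤n) s+2≤g)))
                        λ { (d , 0<g) → none d 0<g }
        (inj₂ (d , 1≤gd , max)) → ≰ (ℕ.≤-<-trans
          (descent i (suc t) (F′ d 1≤gd max) (safe′ d 1≤gd max))
          (sum-mono-< (less d 1≤gd max) d (strict d 1≤gd max)))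
      where
      sum-zero : ∀ k → sum {k} (λ _ → 0) ≡ 0
      sum-zero zero    = refl
      sum-zero (suc k) = sum-zero k
      module _ d (1≤gd : 1 ℕ.≤ g d) (max : ∀ e → 1 ℕ.≤ g e → score (X t) (ι e) (g e) ≤ᵣ score (X t) (ι d) (g d)) where
        lowered = lower-excess i t d (F d) 1≤gd (safe d 1≤gd) max
        F′ : Fin (suc (suc k)) → Vec ℕ n
        F′ e with e Fin.≟ d
        ... | yes _ = proj₁ lowered
        ... | no _  = F e
        safe′ : ∀ e → 1 ℕ.≤ g e → SafeAt X ι s i (suc t) e (g e) (F′ e)
        safe′ e 1≤ge with e Fin.≟ d
        ... | yes refl = proj₁ (proj₂ lowered)
        ... | no _ with safe e 1≤ge
        ...   | ge≤ , total-e , safe-e = ge≤ , total-e , Safe-stay X (without ι e) (Distinct-without ι-inj e) i t (F e) safe-e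
        less : ∀ e → excess (without ι e) (g ∘ punchIn e) (F′ e) ℕ.≤ excess (without ι e) (g ∘ punchIn e) (F e)
        less e with e Fin.≟ d
        ... | yes refl = ℕ.<⇒≤ (proj₂ (proj₂ lowered))
        ... | no _     = ℕ.≤-refl
        strict : excess (without ι d) (g ∘ punchIn d) (F′ d) ℕ.< excess (without ι d) (g ∘ punchIn d) (F d)
        strict with d Fin.≟ d
        ... | yes refl = proj₂ (proj₂ lowered)
        ... | no d≢d   = contradiction refl d≢d

  excess≤total : ∀ d g f → excess (without ι d) g f ℕ.≤ total (without ι d) f
  excess≤total d g f = sum-mono λ x → ℕ.m∸n≤m (lookup f (without ι d x)) (g x)

  -- The level `g d` is the largest share of `s` that the cup `d` can have in a safe state, or 0 if
  -- there is none; a larger share is unsafe by maximality. Were the levels to sum to `s + 2` or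
  -- more, `descent` would bound `L` by the excesses of the witnessing states, which are at most `s`
  -- each.
  ¬¬-threshold : ∀ L s t → suc (suc k) ℕ.* s ℕ.< L → ¬ ¬ (Σ[ g ∈ (Fin (suc (suc k)) → ℕ) ] Threshold X ι L s t g)
  ¬¬-threshold L s t long ¬goal = ¬¬-∀ (λ d → ¬¬-max (λ a → ∃[ f ] SafeAt X ι s L t d a f) s) λ best →
    let g = λ d → proj₁ (best d) in
    ¬goal (g , ℕ.≮⇒≥ (λ s+2≤g → too-long g s+2≤g (λ d → proj₁ (proj₂ (best d)))) ,
      λ d f s≤f g<s safe →
        let a = s ℕ.∸ total (without ι d) f
            total≤s = ℕ.≤-trans (ℕ.m≤n+m (total (without ι d) f) (g d)) (ℕ.<⇒≤ g<s)
        in proj₂ (proj₂ (best d)) a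
             (ℕ.m+n≤o⇒m≤o∸n (suc (g d)) g<s)
             (ℕ.m∸n≤m s (total (without ι d) f))
             (f , ℕ.m≤n+o⇒m∸n≤o s (total (without ι d) f) (ℕ.≤-trans s≤f (ℕ.≤-reflexive (trans (total-without ι d f) (ℕ.+-comm (lookup f (ι d)) (total (without ι d) f))))) ,
              ℕ.m+[n∸m]≡n total≤s , safe))
    where
    too-long : ∀ g → 2 ℕ.+ s ℕ.≤ sum g → ¬ (∀ d → g d ≡ 0 ⊎ (∃[ f ] SafeAt X ι s L t d (g d) f))
    too-long g s+2≤g attained = ℕ.<⇒≱ long (ℕ.≤-trans (descent s g s+2≤g L t F safe) (sum≤ _ _ small))
      where
      F : Fin (suc (suc k)) → Vec ℕ n
      -- A cup of level 0 may come without a safe state. `descent` asks nothing of it, and the empty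
      -- state contributes no excess.
      F d with attained d
      ... | inj₁ _       = Vec.replicate n 0
      ... | inj₂ (f , _) = f
      safe : ∀ d → 1 ℕ.≤ g d → SafeAt X ι s L t d (g d) (F d)
      safe d 1≤gd with attained d
      ... | inj₁ gd≡0    = contradiction (sym gd≡0) (ℕ.<⇒≢ 1≤gd)
      ... | inj₂ (f , p) = p
      zeros : ∀ d → total (without ι d) (Vec.replicate n 0) ℕ.≤ 0
      zeros d = go (without ι d)
        where
        go : ∀ {k} (A : Fin k → Fin n) → total A (Vec.replicate n 0) ℕ.≤ 0
        go {zero}  A = z≤n
        go {suc k} A = ℕ.+-mono-≤ (ℕ.≤-reflexive (Vec.lookup-replicate (A zero) 0)) (go (A ∘ suc))
      small : ∀ d → excess (without ι d) (g ∘ punchIn d) (F d) ℕ.≤ s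
      small d with attained d
      ... | inj₁ _                    = ℕ.≤-trans (excess≤total d (g ∘ punchIn d) (Vec.replicate n 0)) (ℕ.≤-trans (zeros d) z≤n)
      ... | inj₂ (f , _ , total-f , _) = ℕ.≤-trans (excess≤total d (g ∘ punchIn d) f) (ℕ.≤-trans (ℕ.m≤m+n (total (without ι d) f) (g d)) (ℕ.≤-reflexive total-f))
      sum≤ : ∀ m (h : Fin m → ℕ) → (∀ d → h d ℕ.≤ s) → sum h ℕ.≤ m ℕ.* s
      sum≤ zero    h h≤s = z≤n
      sum≤ (suc m) h h≤s = ℕ.+-mono-≤ (h≤s zero) (sum≤ m (h ∘ suc) (h≤s ∘ suc))

  ¬¬-thresholds : ∀ L s → suc (suc k) ℕ.* s ℕ.< L → ∀ N t →
                  ¬ ¬ (Σ[ gs ∈ List (Fin (suc (suc k)) → ℕ) ] length gs ≡ N × Thresholds X ι L s t gs)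
  ¬¬-thresholds L s long zero    t ¬goal = ¬goal ([] , refl , tt)
  ¬¬-thresholds L s long (suc N) t ¬goal = ¬¬-threshold L s t long λ { (g , thr) →
    ¬¬-thresholds L s long N (L ℕ.+ t) λ { (gs , len , thrs) → ¬goal (g ∷ gs , cong suc len , thr , thrs) } }

-- Expectations

abstract
  ⟦_⟧ : ℕ → ℚ
  ⟦ a ⟧ = (+ a) / 1

  ⟦⟧≡/1 : ∀ a → ⟦ a ⟧ ≡ (+ a) / 1
  ⟦⟧≡/1 a = refl

  ⟦⟧-+ : ∀ a b → ⟦ a ℕ.+ b ⟧ ≡ ⟦ a ⟧ + ⟦ b ⟧
  ⟦⟧-+ a b = /-distrib-+ a b 0

  ⟦0⟧ : ⟦ 0 ⟧ ≡ 0ℚ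
  ⟦0⟧ = refl

  ⟦1⟧ : ⟦ 1 ⟧ ≡ 1ℚ
  ⟦1⟧ = refl

  0≤⟦⟧ : ∀ a → 0ℚ ≤ ⟦ a ⟧
  0≤⟦⟧ a = nonNegative⁻¹ _ {{normalize-nonNeg a 1}}

⟦⟧-suc : ∀ a → ⟦ suc a ⟧ ≡ 1ℚ + ⟦ a ⟧
⟦⟧-suc a = trans (⟦⟧-+ 1 a) (cong (_+ ⟦ a ⟧) ⟦1⟧)

⟦⟧-* : ∀ a b → ⟦ a ℕ.* b ⟧ ≡ ⟦ a ⟧ * ⟦ b ⟧
⟦⟧-* zero    b = trans ⟦0⟧ (sym (trans (cong (_* ⟦ b ⟧) ⟦0⟧) (*-zeroˡ ⟦ b ⟧)))
⟦⟧-* (suc a) b = begin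
  ⟦ b ℕ.+ a ℕ.* b ⟧         ≡⟨ ⟦⟧-+ b (a ℕ.* b) ⟩
  ⟦ b ⟧ + ⟦ a ℕ.* b ⟧       ≡⟨ cong (λ z → ⟦ b ⟧ + z) (⟦⟧-* a b) ⟩
  ⟦ b ⟧ + ⟦ a ⟧ * ⟦ b ⟧     ≡⟨ factor ⟦ a ⟧ ⟦ b ⟧ ⟩
  (1ℚ + ⟦ a ⟧) * ⟦ b ⟧      ≡⟨ cong (_* ⟦ b ⟧) (⟦⟧-suc a) ⟨
  ⟦ suc a ⟧ * ⟦ b ⟧         ∎
  where
  open ≡-Reasoning
  factor : ∀ a b → b + a * b ≡ (1ℚ + a) * b
  factor = solve-∀ ring

⟦⟧-mono : ∀ {a b} → a ℕ.≤ b → ⟦ a ⟧ ≤ ⟦ b ⟧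
⟦⟧-mono {a} {b} a≤b = subst (λ c → ⟦ a ⟧ ≤ ⟦ c ⟧) (ℕ.m+[n∸m]≡n a≤b)
  (subst₂ _≤_ (+-identityʳ ⟦ a ⟧) (sym (⟦⟧-+ a (b ℕ.∸ a))) (+-monoʳ-≤ ⟦ a ⟧ (0≤⟦⟧ (b ℕ.∸ a))))

abstract
  1/ₛ : ℕ → ℚ
  1/ₛ k = (+ 1) / suc k

  1/ₛ≡ : ∀ k → 1/ₛ k ≡ (+ 1) / suc k
  1/ₛ≡ k = refl

  0≤1/ₛ : ∀ k → 0ℚ ≤ 1/ₛ k
  0≤1/ₛ k = nonNegative⁻¹ _ {{normalize-nonNeg 1 (suc k)}}

  ⟦⟧*1/ₛ : ∀ k → ⟦ suc k ⟧ * 1/ₛ k ≡ 1ℚ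
  ⟦⟧*1/ₛ k = toℚᵘ-injective (begin
    toℚᵘ (⟦ suc k ⟧ * 1/ₛ k)                     ≈⟨ toℚᵘ-homo-* ⟦ suc k ⟧ (1/ₛ k) ⟩
    toℚᵘ ((+ suc k) / 1) ℚᵘ.* toℚᵘ ((+ 1) / suc k) ≈⟨ ℚᵘ.*-cong (toℚᵘ-/ (+ suc k) 0) (toℚᵘ-/ (+ 1) k) ⟩
    ℚᵘ.mkℚᵘ (+ suc k) 0 ℚᵘ.* ℚᵘ.mkℚᵘ (+ 1) k       ≈⟨ ℚᵘ.*≡* (ℤlem (+ suc k)) ⟩
    toℚᵘ 1ℚ ∎)
    where
    open ℚᵘ.≃-Reasoning
    ℤlem : ∀ d → (d ℤ.* (+ 1)) ℤ.* (+ 1) ≡ (+ 1) ℤ.* ((+ 1) ℤ.* d)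
    ℤlem = solveℤ

abstract
  𝔼 : ∀ {k} → (Fin (suc k) → ℚ) → ℚ
  𝔼 {k} φ = ℚΣ.sum φ * 1/ₛ k

  𝔼≡ : ∀ {k} (φ : Fin (suc k) → ℚ) → 𝔼 φ ≡ ℚΣ.sum φ * 1/ₛ k
  𝔼≡ φ = refl

sumℚ-mono : ∀ {k} {φ ψ : Fin k → ℚ} → (∀ x → φ x ≤ ψ x) → ℚΣ.sum φ ≤ ℚΣ.sum ψ
sumℚ-mono {zero}  φ≤ψ = ≤-refl
sumℚ-mono {suc k} φ≤ψ = +-mono-≤ (φ≤ψ zero) (sumℚ-mono (φ≤ψ ∘ suc))

sumℚ-const : ∀ k c → ℚΣ.sum {k} (λ _ → c) ≡ ⟦ k ⟧ * c
sumℚ-const zero    c = sym (trans (cong (_* c) ⟦0⟧) (*-zeroˡ c))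
sumℚ-const (suc k) c = trans (cong (λ z → c + z) (sumℚ-const k c)) (trans (factor c ⟦ k ⟧) (cong (_* c) (sym (⟦⟧-suc k))))
  where
  factor : ∀ c k → c + k * c ≡ (1ℚ + k) * c
  factor = solve-∀ ring

sumℚ-⟦⟧ : ∀ {k} (a : Fin k → ℕ) → ℚΣ.sum (λ x → ⟦ a x ⟧) ≡ ⟦ sum a ⟧
sumℚ-⟦⟧ {zero}  a = sym ⟦0⟧
sumℚ-⟦⟧ {suc k} a = trans (cong (λ z → ⟦ a zero ⟧ + z) (sumℚ-⟦⟧ (a ∘ suc))) (sym (⟦⟧-+ (a zero) (sum (a ∘ suc))))

sumℚ-term : ∀ {k} (φ : Fin k → ℚ) → (∀ x → 0ℚ ≤ φ x) → ∀ x → φ x ≤ ℚΣ.sum φ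
sumℚ-term {suc k} φ 0≤φ x = subst (φ x ≤_) (sym (ℚΣ.sum-remove {i = x} φ))
  (subst (_≤ φ x + rest) (+-identityʳ (φ x)) (+-monoʳ-≤ (φ x) 0≤rest))
  where
  rest = ℚΣ.sum (λ y → φ (punchIn x y))
  0≤rest : 0ℚ ≤ rest
  0≤rest = subst (_≤ rest) (trans (sumℚ-const k 0ℚ) (*-zeroʳ ⟦ k ⟧)) (sumℚ-mono (λ y → 0≤φ (punchIn x y)))

module _ {k : ℕ} where abstract

  𝔼-cong : {φ ψ : Fin (suc k) → ℚ} → (∀ x → φ x ≡ ψ x) → 𝔼 φ ≡ 𝔼 ψ
  𝔼-cong eq = cong (_* 1/ₛ k) (ℚΣ.sum-cong-≗ eq)

  𝔼-mono : {φ ψ : Fin (suc k) → ℚ} → (∀ x → φ x ≤ ψ x) → 𝔼 φ ≤ 𝔼 ψ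
  𝔼-mono φ≤ψ = *-monoʳ-≤-nonNeg (1/ₛ k) {{nonNegative (0≤1/ₛ k)}} (sumℚ-mono φ≤ψ)

  ⟦⟧*𝔼 : (φ : Fin (suc k) → ℚ) → ⟦ suc k ⟧ * 𝔼 φ ≡ ℚΣ.sum φ
  ⟦⟧*𝔼 φ = trans (rearranged ⟦ suc k ⟧ (ℚΣ.sum φ) (1/ₛ k)) (trans (cong (_* ℚΣ.sum φ) (⟦⟧*1/ₛ k)) (*-identityˡ _))
    where
    rearranged : ∀ a b c → a * (b * c) ≡ (a * c) * b
    rearranged = solve-∀ ring

  𝔼-const : ∀ c → 𝔼 {k} (λ _ → c) ≡ c
  𝔼-const c = trans (cong (_* 1/ₛ k) (sumℚ-const (suc k) c))
    (trans (rearranged ⟦ suc k ⟧ c (1/ₛ k)) (trans (cong (_* c) (⟦⟧*1/ₛ k)) (*-identityˡ c)))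
    where
    rearranged : ∀ a b c → (a * b) * c ≡ (a * c) * b
    rearranged = solve-∀ ring

  𝔼-+ : (φ ψ : Fin (suc k) → ℚ) → 𝔼 (λ x → φ x + ψ x) ≡ 𝔼 φ + 𝔼 ψ
  𝔼-+ φ ψ = trans (cong (_* 1/ₛ k) (ℚΣ.∑-distrib-+ φ ψ)) (*-distribʳ-+ (1/ₛ k) (ℚΣ.sum φ) (ℚΣ.sum ψ))

  𝔼-* : ∀ c (φ : Fin (suc k) → ℚ) → 𝔼 (λ x → c * φ x) ≡ c * 𝔼 φ
  𝔼-* c φ = trans (cong (_* 1/ₛ k) (sym (ℚΣ.*-distribˡ-sum c φ))) (*-assoc c (ℚΣ.sum φ) (1/ₛ k))

  𝔼-term : (φ : Fin (suc k) → ℚ) → (∀ x → 0ℚ ≤ φ x) → ∀ x → φ x ≤ ⟦ suc k ⟧ * 𝔼 φ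
  𝔼-term φ 0≤φ x = subst (φ x ≤_) (sym (⟦⟧*𝔼 φ)) (sumℚ-term φ 0≤φ x)

abstract
  𝔼-comm : ∀ {k m} (φ : Fin (suc k) → Fin (suc m) → ℚ) → 𝔼 (λ x → 𝔼 (λ y → φ x y)) ≡ 𝔼 (λ y → 𝔼 (λ x → φ x y))
  𝔼-comm {k} {m} φ = begin
    ℚΣ.sum (λ x → ℚΣ.sum (φ x) * 1/ₛ m) * 1/ₛ k       ≡⟨ cong (_* 1/ₛ k) (ℚΣ.*-distribʳ-sum (1/ₛ m) (λ x → ℚΣ.sum (φ x))) ⟨
    ℚΣ.sum (λ x → ℚΣ.sum (φ x)) * 1/ₛ m * 1/ₛ k       ≡⟨ cong (λ z → z * 1/ₛ m * 1/ₛ k) (ℚΣ.∑-comm φ) ⟩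
    ℚΣ.sum (λ y → ℚΣ.sum (λ x → φ x y)) * 1/ₛ m * 1/ₛ k ≡⟨ rearranged (ℚΣ.sum (λ y → ℚΣ.sum (λ x → φ x y))) (1/ₛ m) (1/ₛ k) ⟩
    ℚΣ.sum (λ y → ℚΣ.sum (λ x → φ x y)) * 1/ₛ k * 1/ₛ m ≡⟨ cong (_* 1/ₛ m) (ℚΣ.*-distribʳ-sum (1/ₛ k) (λ y → ℚΣ.sum (λ x → φ x y))) ⟩
    ℚΣ.sum (λ y → ℚΣ.sum (λ x → φ x y) * 1/ₛ k) * 1/ₛ m ∎
    where
    open ≡-Reasoning
    rearranged : ∀ a b c → a * b * c ≡ a * c * b
    rearranged = solve-∀ ring

-- Expected values after a number of steps with fixed active cups

module _ {n} (X : ℕ → ScoreBased n) {k} (ι : Fin (suc k) → Fin n) where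

  run : ℕ → ℕ → (Vec ℕ n → ℚ) → Vec ℕ n → ℚ
  run zero    t φ f = φ f
  run (suc i) t φ f = 𝔼 λ x → 𝔼 λ y → run i (suc t) φ (play₁ (X t) ι x y f)

  run-mono-inv : (I : Vec ℕ n → Set) → (∀ t x y f → I f → I (play₁ (X t) ι x y f)) →
                 ∀ {φ ψ} → (∀ f → I f → φ f ≤ ψ f) → ∀ i t f → I f → run i t φ f ≤ run i t ψ f
  run-mono-inv I step φ≤ψ zero    t f If = φ≤ψ f If
  run-mono-inv I step φ≤ψ (suc i) t f If =
    𝔼-mono λ x → 𝔼-mono λ y → run-mono-inv I step φ≤ψ i (suc t) _ (step t x y f If)

  run-mono : ∀ {φ ψ} → (∀ f → φ f ≤ ψ f) → ∀ i t f → run i t φ f ≤ run i t ψ f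
  run-mono φ≤ψ i t f = run-mono-inv (λ _ → ⊤) (λ _ _ _ _ _ → tt) (λ f _ → φ≤ψ f) i t f tt

  run-cong : ∀ {φ ψ} → (∀ f → φ f ≡ ψ f) → ∀ i t f → run i t φ f ≡ run i t ψ f
  run-cong eq zero    t f = eq f
  run-cong eq (suc i) t f = 𝔼-cong λ x → 𝔼-cong λ y → run-cong eq i (suc t) _

  run-const : ∀ c i t f → run i t (λ _ → c) f ≡ c
  run-const c zero    t f = refl
  run-const c (suc i) t f = trans (𝔼-cong λ x → trans (𝔼-cong λ y → run-const c i (suc t) _) (𝔼-const c)) (𝔼-const c)

  run-+ : ∀ φ ψ i t f → run i t (λ f → φ f + ψ f) f ≡ run i t φ f + run i t ψ f
  run-+ φ ψ zero    t f = refl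
  run-+ φ ψ (suc i) t f =
    trans (𝔼-cong λ x → trans (𝔼-cong λ y → run-+ φ ψ i (suc t) _) (𝔼-+ _ _)) (𝔼-+ _ _)

  run-* : ∀ c φ i t f → run i t (λ f → c * φ f) f ≡ c * run i t φ f
  run-* c φ zero    t f = refl
  run-* c φ (suc i) t f =
    trans (𝔼-cong λ x → trans (𝔼-cong λ y → run-* c φ i (suc t) _) (𝔼-* c _)) (𝔼-* c _)

  run-++ : ∀ i j t φ f → run (i ℕ.+ j) t φ f ≡ run i t (run j (i ℕ.+ t) φ) f
  run-++ zero    j t φ f = refl
  run-++ (suc i) j t φ f = 𝔼-cong λ x → 𝔼-cong λ y →
    trans (run-++ i j (suc t) φ _) (cong (λ t′ → run i (suc t) (run j t′ φ) (play₁ (X t) ι x y f)) (ℕ.+-suc i t))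

  run-𝔼 : ∀ {m} (φ : Fin (suc m) → Vec ℕ n → ℚ) i t f → run i t (λ f → 𝔼 λ j → φ j f) f ≡ 𝔼 λ j → run i t (φ j) f
  run-𝔼 φ zero    t f = refl
  run-𝔼 φ (suc i) t f = trans
    (𝔼-cong λ x → trans (𝔼-cong λ y → run-𝔼 φ i (suc t) _) (𝔼-comm λ y j → run i (suc t) (φ j) (play₁ (X t) ι x y f)))
    (𝔼-comm λ x j → 𝔼 λ y → run i (suc t) (φ j) (play₁ (X t) ι x y f))

  level : Vec ℕ n → ℚ
  level f = ⟦ total ι f ⟧

  growth : ℕ → ℕ → Vec ℕ n → ℚ
  growth i t f = run i t level f - level f

-- Waste over many windows

-- As `by-diff`, for identities that hold only modulo a known equation `p ≡ q`, such as `r * K ≡ 1`;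
-- `c` is its cofactor.
by-diff-mod : ∀ {a b e p q} c → 0ℚ ≤ e → b - a ≡ e + c * (p - q) → p ≡ q → a ≤ b
by-diff-mod {e = e} {p = p} c 0≤e eq refl = by-diff 0≤e (trans eq (vanish e c p))
  where
  vanish : ∀ e c p → e + c * (p - p) ≡ e
  vanish = solve-∀ ring

paths : ℕ → ℕ → ℕ
paths k i = (suc k ℕ.* suc k) ℕ.^ i

1≤paths : ∀ k i → 1 ℕ.≤ paths k i
1≤paths k i = ℕ.m^n>0 (suc k ℕ.* suc k) i

*-mono-≤ˡ : ∀ {c p q} → 0ℚ ≤ c → p ≤ q → c * p ≤ c * q
*-mono-≤ˡ {c} 0≤c = *-monoˡ-≤-nonNeg c {{nonNegative 0≤c}}

module _ {n} (X : ℕ → ScoreBased n) {k} (ι : Fin (suc k) → Fin n) (ι-inj : Distinct ι) where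

  level≤run : ∀ i t f → level X ι f ≤ run X ι i t (level X ι) f
  level≤run i t f = subst (_≤ run X ι i t (level X ι) f) (run-const X ι (level X ι f) i t f)
    (run-mono-inv X ι (λ f′ → total ι f ℕ.≤ total ι f′)
      (λ t x y f′ ≤f′ → ℕ.≤-trans ≤f′ (total-play₁-≥ (X t) ι ι-inj x y f′)) (λ f′ ≤f′ → ⟦⟧-mono ≤f′) i t f ℕ.≤-refl)

  0≤growth : ∀ i t f → 0ℚ ≤ growth X ι i t f
  0≤growth i t f = ≤⇒0≤ (level≤run i t f)

  growth-mono : ∀ {i j} → i ℕ.≤ j → ∀ t f → growth X ι i t f ≤ growth X ι j t f
  growth-mono {i} {j} i≤j t f = +-monoˡ-≤ (- level X ι f)
    (subst (λ j → run X ι i t (level X ι) f ≤ run X ι j t (level X ι) f) (ℕ.m+[n∸m]≡n i≤j)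
      (subst (run X ι i t (level X ι) f ≤_) (sym (run-++ X ι i (j ℕ.∸ i) t (level X ι) f))
        (run-mono X ι (level≤run (j ℕ.∸ i) (i ℕ.+ t)) i t f)))

  growth-suc : ∀ i t f → growth X ι (suc i) t f ≡
               𝔼 λ x → 𝔼 λ y → run X ι i (suc t) (level X ι) (play₁ (X t) ι x y f) - level X ι f
  growth-suc i t f = sym (trans
    (𝔼-cong λ x → trans (𝔼-+ _ _) (cong (λ z → 𝔼 (λ y → run X ι i (suc t) (level X ι) (play₁ (X t) ι x y f)) + z) (𝔼-const (- level X ι f))))
    (trans (𝔼-+ _ _) (cong (λ z → run X ι (suc i) t (level X ι) f + z) (𝔼-const (- level X ι f)))))

  -- Each of the (suc k * suc k) ^ i equally likely sequences of choices is taken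
  -- with this probability, and a wasted step raises the total by 2.
  unsafe⇒growth : ∀ i t f → ¬ Safe X ι i t f → 1ℚ ≤ ⟦ paths k i ⟧ * growth X ι i t f
  unsafe⇒growth zero    t f unsafe = contradiction tt unsafe
  unsafe⇒growth (suc i) t f unsafe = ≤-trans (special x y bad-xy) (≤-trans (*-mono-≤ˡ (0≤⟦⟧ (paths k i)) collect) (≤-reflexive weights))
    where
    K = ⟦ suc k ⟧
    next : Fin (suc k) → Fin (suc k) → Vec ℕ n
    next x y = play₁ (X t) ι x y f
    good? : ∀ x y → Dec (total ι (next x y) ≡ total ι f × Safe X ι i (suc t) (next x y))
    good? x y = (total ι (next x y) ℕ.≟ total ι f) ×-dec Safe? X ι i (suc t) (next x y)
    bad-x = Fin.¬∀⟶∃¬ _ _ (λ x → Fin.all? (good? x)) unsafe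
    x = proj₁ bad-x
    bad-y = Fin.¬∀⟶∃¬ _ _ (good? x) (proj₂ bad-x)
    y = proj₁ bad-y
    bad-xy = proj₂ bad-y
    h : Fin (suc k) → Fin (suc k) → ℚ
    h x y = run X ι i (suc t) (level X ι) (next x y) - level X ι f
    0≤h : ∀ x y → 0ℚ ≤ h x y
    0≤h x y = ≤⇒0≤ (≤-trans (⟦⟧-mono (total-play₁-≥ (X t) ι ι-inj x y f)) (level≤run i (suc t) (next x y)))
    0≤𝔼h : ∀ x → 0ℚ ≤ 𝔼 (h x)
    0≤𝔼h x = subst (_≤ 𝔼 (h x)) (𝔼-const {k} 0ℚ) (𝔼-mono (0≤h x))
    collect : h x y ≤ K * (K * growth X ι (suc i) t f)
    collect = ≤-trans (𝔼-term (h x) (0≤h x) y) (*-mono-≤ˡ (0≤⟦⟧ (suc k))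
      (subst (λ e → 𝔼 (h x) ≤ K * e) (sym (growth-suc i t f)) (𝔼-term (λ x → 𝔼 (h x)) 0≤𝔼h x)))
    weights : ⟦ paths k i ⟧ * (K * (K * growth X ι (suc i) t f)) ≡ ⟦ paths k (suc i) ⟧ * growth X ι (suc i) t f
    weights = trans (rearranged ⟦ paths k i ⟧ K _)
      (cong (_* growth X ι (suc i) t f) (sym (trans (⟦⟧-* (suc k ℕ.* suc k) (paths k i)) (cong (_* ⟦ paths k i ⟧) (⟦⟧-* (suc k) (suc k))))))
      where
      rearranged : ∀ p K g → p * (K * (K * g)) ≡ K * K * p * g
      rearranged = solve-∀ ring
    special : ∀ x y → ¬ (total ι (next x y) ≡ total ι f × Safe X ι i (suc t) (next x y)) → 1ℚ ≤ ⟦ paths k i ⟧ * h x y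
    special x y bad with total ι (next x y) ℕ.≟ total ι f
    ... | yes eq = subst (λ l → 1ℚ ≤ ⟦ paths k i ⟧ * (run X ι i (suc t) (level X ι) (next x y) - ⟦ l ⟧)) eq
                     (unsafe⇒growth i (suc t) (next x y) (λ safe → bad (eq , safe)))
    ... | no neq = ≤-trans 1≤p (subst (_≤ p * h x y) (*-identityʳ p) (*-mono-≤ˡ (0≤⟦⟧ (paths k i)) 1≤h))
      where
      p = ⟦ paths k i ⟧
      1≤p : 1ℚ ≤ p
      1≤p = subst (_≤ p) ⟦1⟧ (⟦⟧-mono (1≤paths k i))
      1≤h : 1ℚ ≤ h x y
      1≤h = ≤-trans (by-diff ≤-refl (trans (cong (λ l → l - level X ι f - 1ℚ) (⟦⟧-suc (total ι f))) (zero-diff (level X ι f))))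
              (+-monoˡ-≤ (- level X ι f) (≤-trans
                (⟦⟧-mono (ℕ.≤∧≢⇒< (total-play₁-≥ (X t) ι ι-inj x y f) (neq ∘ sym))) (level≤run i (suc t) (next x y))))
        where
        zero-diff : ∀ l → 1ℚ + l - l - 1ℚ ≡ 0ℚ
        zero-diff = solve-∀ ring

module _ {n k} (ι : Fin (suc (suc k)) → Fin n) (d : Fin (suc (suc k))) (s : ℕ) where

  -- For a total of exactly `s`, this is the excess of the dropped cup over its level. It is
  -- expressed through the remaining cups, as these are the ones that play on.
  shortfall : (Fin (suc (suc k)) → ℕ) → Vec ℕ n → ℕ
  shortfall g f = s ℕ.∸ (g d ℕ.+ total (without ι d) f)

  shortfalls : List (Fin (suc (suc k)) → ℕ) → Vec ℕ n → ℚ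
  shortfalls []       f = 0ℚ
  shortfalls (g ∷ gs) f = ⟦ shortfall g f ⟧ + shortfalls gs f

module _ {n} (X : ℕ → ScoreBased n) {k} (ι : Fin (suc (suc k)) → Fin n) (ι-inj : Distinct ι)
         (d : Fin (suc (suc k))) (L s b : ℕ) (s≤b : s ℕ.≤ b) where

  private
    A = without ι d
    A-inj = Distinct-without ι-inj d
    Q = paths k L
    C = ⟦ b ℕ.* Q ⟧

  -- A positive shortfall is at most `b` and makes the window unsafe, so that the expected growth in
  -- the window is at least 1 / `Q`.
  growth-window : ∀ {t g f} → Threshold X ι L s t g → s ℕ.≤ total ι f → ⟦ shortfall ι d s g f ⟧ ≤ C * growth X A L t f
  growth-window {t} {g} {f} (_ , unsafe) s≤f with g d ℕ.+ total A f ℕ.<? s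
  ... | no ≮ = subst (_≤ C * growth X A L t f) (sym (trans (cong ⟦_⟧ (ℕ.m≤n⇒m∸n≡0 (ℕ.≮⇒≥ ≮))) ⟦0⟧))
                 (0≤* (0≤⟦⟧ (b ℕ.* Q)) (0≤growth X A A-inj L t f))
  ... | yes lt = ≤-trans (⟦⟧-mono (ℕ.≤-trans (ℕ.m∸n≤m s (g d ℕ.+ total A f)) s≤b))
                   (subst₂ _≤_ (*-identityʳ ⟦ b ⟧) (trans (sym (*-assoc ⟦ b ⟧ ⟦ Q ⟧ _)) (cong (_* growth X A L t f) (sym (⟦⟧-* b Q))))
                     (*-mono-≤ˡ (0≤⟦⟧ b) (unsafe⇒growth X A A-inj L t f (unsafe d f s≤f lt))))

  shortfalls-drop : ∀ gs {f f′} → total A f ℕ.≤ total A f′ →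
                    shortfalls ι d s gs f ≤ shortfalls ι d s gs f′ + ⟦ length gs ⟧ * (level X A f′ - level X A f)
  shortfalls-drop []       {f} {f′} f≤f′ = ≤-reflexive (sym (trans (cong (λ z → 0ℚ + z * (level X A f′ - level X A f)) ⟦0⟧) (zero-prod (level X A f′ - level X A f))))
    where
    zero-prod : ∀ p → 0ℚ + 0ℚ * p ≡ 0ℚ
    zero-prod = solve-∀ ring
  shortfalls-drop (g ∷ gs) {f} {f′} f≤f′ = ≤-trans (+-mono-≤ head (shortfalls-drop gs f≤f′))
    (≤-reflexive (trans (rearranged ⟦ shortfall ι d s g f′ ⟧ (level X A f′ - level X A f) (shortfalls ι d s gs f′) ⟦ length gs ⟧)
      (cong (λ l → ⟦ shortfall ι d s g f′ ⟧ + shortfalls ι d s gs f′ + l * (level X A f′ - level X A f)) (sym (⟦⟧-suc (length gs))))))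
    where
    rearranged : ∀ y δ z l → (y + δ) + (z + l * δ) ≡ y + z + (1ℚ + l) * δ
    rearranged = solve-∀ ring
    -- Adding `q` to `p ∸ q` gives `p ⊔ q`, which is monotone in `q`.
    ℕ-head : shortfall ι d s g f ℕ.+ total A f ℕ.≤ shortfall ι d s g f′ ℕ.+ total A f′
    ℕ-head = subst₂ (λ p q → p ℕ.+ total A f ℕ.≤ q ℕ.+ total A f′) (ℕ.∸-+-assoc s (g d) (total A f)) (ℕ.∸-+-assoc s (g d) (total A f′))
      (subst₂ ℕ._≤_ (⊔-∸ (s ℕ.∸ g d) (total A f)) (⊔-∸ (s ℕ.∸ g d) (total A f′)) (ℕ.⊔-monoʳ-≤ (s ℕ.∸ g d) f≤f′))
      where
      ⊔-∸ : ∀ p q → p ℕ.⊔ q ≡ p ℕ.∸ q ℕ.+ q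
      ⊔-∸ p q with ℕ.≤-total p q
      ... | inj₁ p≤q = trans (ℕ.m≤n⇒m⊔n≡n p≤q) (sym (cong (ℕ._+ q) (ℕ.m≤n⇒m∸n≡0 p≤q)))
      ... | inj₂ q≤p = trans (ℕ.m≥n⇒m⊔n≡m q≤p) (sym (ℕ.m∸n+n≡m q≤p))
    head : ⟦ shortfall ι d s g f ⟧ ≤ ⟦ shortfall ι d s g f′ ⟧ + (level X A f′ - level X A f)
    head = by-diff (≤⇒0≤ (subst₂ _≤_ (⟦⟧-+ (shortfall ι d s g f) (total A f)) (⟦⟧-+ (shortfall ι d s g f′) (total A f′)) (⟦⟧-mono ℕ-head)))
      (move-level ⟦ shortfall ι d s g f ⟧ ⟦ shortfall ι d s g f′ ⟧ (level X A f) (level X A f′))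
      where
      move-level : ∀ y y′ l l′ → y′ + (l′ - l) - y ≡ (y′ + l′) - (y + l)
      move-level = solve-∀ ring

  -- A shortfall either persists into a window, which then pays for it at the rate `C`, or has
  -- shrunk because the total has grown. Thus growth is charged `C` times for the window in which it
  -- occurs and once for each later window whose shortfall it reduces.
  growth-windows : ∀ gs t f → Thresholds X ι L s t gs → s ℕ.≤ total ι f →
                   shortfalls ι d s gs f ≤ (C + ⟦ length gs ⟧) * growth X A (length gs ℕ.* L) t f
  growth-windows []       t f _ _ =
    0≤* (0≤+ (0≤⟦⟧ (b ℕ.* Q)) (0≤⟦⟧ 0)) (0≤growth X A A-inj 0 t f)
  growth-windows (g ∷ gs) t f (thr , thrs) s≤f = ≤-trans (+-mono-≤ (growth-window {g = g} thr s≤f) tail)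
    (subst (λ m → C * growth X A L t f + run X A L t ψ f ≤ (C + m) * growth X A (L ℕ.+ M) t f) (sym (⟦⟧-suc (length gs)))
      (by-diff (0≤growth X A A-inj (L ℕ.+ M) t f)
        (trans (cong₂ (λ r ψ → (C + (1ℚ + N)) * (r - l) - (C * (run X A L t (level X A) f - l) + ψ)) (run-++ X A L M t (level X A) f) run-ψ)
          (trans (combined C N l (run X A L t (level X A) f) (run X A L t R f))
            (cong (_- l) (sym (run-++ X A L M t (level X A) f)))))))
    where
    M = length gs ℕ.* L
    N = ⟦ length gs ⟧
    l = level X A f
    R : Vec ℕ n → ℚ
    R = run X A M (L ℕ.+ t) (level X A)
    ψ : Vec ℕ n → ℚ
    ψ f₁ = (C + N) * R f₁ + (- C * level X A f₁ + - (N * l))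
    run-ψ : run X A L t ψ f ≡ (C + N) * run X A L t R f + (- C * run X A L t (level X A) f + - (N * l))
    run-ψ = trans (run-+ X A _ _ L t f) (cong₂ _+_ (run-* X A (C + N) R L t f)
      (trans (run-+ X A _ _ L t f) (cong₂ _+_ (run-* X A (- C) (level X A) L t f) (run-const X A (- (N * l)) L t f))))
    combined : ∀ C N l rl rr → (C + (1ℚ + N)) * (rr - l) - (C * (rl - l) + ((C + N) * rr + (- C * rl + - (N * l)))) ≡ rr - l
    combined = solve-∀ ring
    tail : shortfalls ι d s gs f ≤ run X A L t ψ f
    tail = subst (_≤ run X A L t ψ f) (run-const X A (shortfalls ι d s gs f) L t f)
      (run-mono-inv X A (λ f₁ → s ℕ.≤ total ι f₁ × total A f ℕ.≤ total A f₁)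
        (λ { t x y f₁ (s≤ , ≤f₁) → ℕ.≤-trans s≤ (total-play₁-≥ (X t) ι ι-inj (punchIn d x) (punchIn d y) f₁)
                                 , ℕ.≤-trans ≤f₁ (total-play₁-≥ (X t) A A-inj x y f₁) })
        pointwise L t f (s≤f , ℕ.≤-refl))
      where
      rearranged : ∀ C N l l₁ r → (C + N) * (r - l₁) + N * (l₁ - l) ≡ (C + N) * r + (- C * l₁ + - (N * l))
      rearranged = solve-∀ ring
      pointwise : ∀ f₁ → s ℕ.≤ total ι f₁ × total A f ℕ.≤ total A f₁ → shortfalls ι d s gs f ≤ ψ f₁
      pointwise f₁ (s≤f₁ , f≤f₁) = ≤-trans (shortfalls-drop gs f≤f₁)
        (≤-trans (+-monoˡ-≤ (N * (level X A f₁ - l)) (growth-windows gs (L ℕ.+ t) f₁ thrs s≤f₁))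
          (≤-reflexive (rearranged C N l (level X A f₁) (R f₁))))

-- Parities of the fills

parity : ℕ → ℕ
parity zero    = 0
parity (suc a) = 1 ℕ.∸ parity a

parity≤1 : ∀ a → parity a ℕ.≤ 1
parity≤1 zero    = z≤n
parity≤1 (suc a) = ℕ.m∸n≤m 1 (parity a)

parity-suc : ∀ a → parity (suc a) ℕ.+ parity a ≡ 1
parity-suc a = ℕ.m∸n+n≡m (parity≤1 a)

parity-2+ : ∀ a → parity (2 ℕ.+ a) ≡ parity a
parity-2+ a = ℕ.m∸[m∸n]≡n (parity≤1 a)

parity-double : ∀ a → parity (a ℕ.+ a) ≡ 0
parity-double zero    = refl
parity-double (suc a) = trans (cong (λ b → parity (suc b)) (ℕ.+-suc a a)) (trans (parity-2+ (a ℕ.+ a)) (parity-double a))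

-- The emptier removes two half units or nothing, so the parities are governed by the filler alone,
-- whatever the emptier does.
parity-move : ∀ {n} (X : ScoreBased n) c f i → parity (lookup (move X f) i ℕ.+ c) ≡ parity (lookup f i ℕ.+ c)
parity-move X c f i with removes X f in eq
... | false = refl
... | true with i Fin.≟ sel X f
...   | no i≢s   = cong (λ a → parity (a ℕ.+ c)) (Vec.lookup∘updateAt′ i (sel X f) i≢s f)
...   | yes refl = trans (cong (λ a → parity (a ℕ.+ c)) (Vec.lookup∘updateAt (sel X f) f))
                     (lowered (lookup f (sel X f)) (removes⇒2≤ X f eq))
  where
  lowered : ∀ a → 2 ℕ.≤ a → parity (a ℕ.∸ 2 ℕ.+ c) ≡ parity (a ℕ.+ c)
  lowered (suc zero) (s≤s ())
  lowered (suc (suc a)) _ = sym (parity-2+ (a ℕ.+ c))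

odd : ∀ {k n} → (Fin k → Fin n) → (Fin k → ℕ) → Vec ℕ n → ℕ
odd ι g f = sum λ x → parity (lookup f (ι x) ℕ.+ g x)

odd-pour : ∀ {k n} (ι : Fin k → Fin n) → Distinct ι → ∀ g x f →
           odd ι g (f [ ι x ]%= suc) ℕ.+ 2 ℕ.* parity (lookup f (ι x) ℕ.+ g x) ≡ 1 ℕ.+ odd ι g f
odd-pour ι ι-inj g x f = begin
  odd ι g f′ ℕ.+ 2 ℕ.* p      ≡⟨ assoc (odd ι g f′) p ⟩
  (odd ι g f′ ℕ.+ p) ℕ.+ p    ≡⟨ cong (ℕ._+ p) (sum-change _ _ x λ y y≢x →
                                  cong (λ a → parity (a ℕ.+ g y)) (Vec.lookup∘updateAt′ (ι y) (ι x) (y≢x ∘ ι-inj) f)) ⟩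
  (odd ι g f ℕ.+ p′) ℕ.+ p    ≡⟨ cong (λ a → (odd ι g f ℕ.+ parity (a ℕ.+ g x)) ℕ.+ p) (Vec.lookup∘updateAt (ι x) f) ⟩
  (odd ι g f ℕ.+ parity (suc (lookup f (ι x) ℕ.+ g x))) ℕ.+ p
                              ≡⟨ ℕ.+-assoc (odd ι g f) _ p ⟩
  odd ι g f ℕ.+ (parity (suc (lookup f (ι x) ℕ.+ g x)) ℕ.+ p)
                              ≡⟨ cong (odd ι g f ℕ.+_) (parity-suc (lookup f (ι x) ℕ.+ g x)) ⟩
  odd ι g f ℕ.+ 1             ≡⟨ ℕ.+-comm (odd ι g f) 1 ⟩
  1 ℕ.+ odd ι g f             ∎
  where
  open ≡-Reasoning
  f′ = f [ ι x ]%= suc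
  p  = parity (lookup f (ι x) ℕ.+ g x)
  p′ = parity (lookup f′ (ι x) ℕ.+ g x)
  assoc : ∀ a b → a ℕ.+ 2 ℕ.* b ≡ (a ℕ.+ b) ℕ.+ b
  assoc = solveℕ

odd-move : ∀ {k n} (X : ScoreBased n) (ι : Fin k → Fin n) g f → odd ι g (move X f) ≡ odd ι g f
odd-move X ι g f = sum-cong-≗ λ x → parity-move X (g x) f (ι x)

2ℚ : ℚ
2ℚ = 1ℚ + 1ℚ

4ℚ : ℚ
4ℚ = 2ℚ + 2ℚ

0≤1ℚ : 0ℚ ≤ 1ℚ
0≤1ℚ = *≤* (ℤ.+≤+ z≤n)

0≤2ℚ : 0ℚ ≤ 2ℚ
0≤2ℚ = *≤* (ℤ.+≤+ z≤n)

0≤4ℚ : 0ℚ ≤ 4ℚ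
0≤4ℚ = *≤* (ℤ.+≤+ z≤n)

module _ {n} (X : ℕ → ScoreBased n) {k} (ι : Fin (suc (suc k)) → Fin n) (ι-inj : Distinct ι) (g : Fin (suc (suc k)) → ℕ) where

  private
    K = ⟦ suc (suc k) ⟧
    r = 1/ₛ (suc k)
    rK≡1 : r * K ≡ 1ℚ
    rK≡1 = trans (*-comm r K) (⟦⟧*1/ₛ (suc k))

  bias : Vec ℕ n → ℚ
  bias f = 2ℚ * ⟦ odd ι g f ⟧ - K

  -- A pour flips one uniformly random parity, as in the Ehrenfest urn; 1 - 2 / `K` is the
  -- eigenvalue belonging to `bias`.
  λ₁ : ℚ
  λ₁ = 1ℚ - 2ℚ * r

  0≤λ₁ : 0ℚ ≤ λ₁
  0≤λ₁ = subst (0ℚ ≤_) eq (0≤* (0≤1/ₛ (suc k)) (0≤⟦⟧ k))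
    where
    K≡ : K ≡ 2ℚ + ⟦ k ⟧
    K≡ = trans (⟦⟧-suc (suc k)) (trans (cong (λ z → 1ℚ + z) (⟦⟧-suc k)) (sym (+-assoc 1ℚ 1ℚ ⟦ k ⟧)))
    rearranged : ∀ r k → r * k ≡ r * (2ℚ + k) - 2ℚ * r
    rearranged = solve-∀ ring
    eq : r * ⟦ k ⟧ ≡ λ₁
    eq = trans (rearranged r ⟦ k ⟧) (cong (_- 2ℚ * r) (trans (cong (r *_) (sym K≡)) rK≡1))

  𝔼-parity : ∀ f → 𝔼 (λ x → ⟦ parity (lookup f (ι x) ℕ.+ g x) ⟧) ≡ r * ⟦ odd ι g f ⟧
  𝔼-parity f = trans (𝔼≡ (λ x → ⟦ parity (lookup f (ι x) ℕ.+ g x) ⟧)) (trans (cong (_* r) (sumℚ-⟦⟧ (λ x → parity (lookup f (ι x) ℕ.+ g x)))) (*-comm ⟦ odd ι g f ⟧ r))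

  bias-pour : ∀ x f → bias (f [ ι x ]%= suc) ≡ (bias f + 2ℚ) + - 4ℚ * ⟦ parity (lookup f (ι x) ℕ.+ g x) ⟧
  bias-pour x f = trans (cong (λ z → 2ℚ * z - K) odd≡) (rearranged ⟦ odd ι g f ⟧ p K)
    where
    p = ⟦ parity (lookup f (ι x) ℕ.+ g x) ⟧
    odd≡ : ⟦ odd ι g (f [ ι x ]%= suc) ⟧ ≡ (1ℚ + ⟦ odd ι g f ⟧) - 2ℚ * p
    odd≡ = trans (add-sub ⟦ odd ι g (f [ ι x ]%= suc) ⟧ (2ℚ * p)) (cong (_- 2ℚ * p) (begin
      ⟦ odd ι g (f [ ι x ]%= suc) ⟧ + 2ℚ * p
        ≡⟨ cong (λ z → ⟦ odd ι g (f [ ι x ]%= suc) ⟧ + z) (trans (cong (_* p) 2≡) (sym (⟦⟧-* 2 (parity (lookup f (ι x) ℕ.+ g x))))) ⟩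
      ⟦ odd ι g (f [ ι x ]%= suc) ⟧ + ⟦ 2 ℕ.* parity (lookup f (ι x) ℕ.+ g x) ⟧
        ≡⟨ ⟦⟧-+ (odd ι g (f [ ι x ]%= suc)) _ ⟨
      ⟦ odd ι g (f [ ι x ]%= suc) ℕ.+ 2 ℕ.* parity (lookup f (ι x) ℕ.+ g x) ⟧
        ≡⟨ cong ⟦_⟧ (odd-pour ι ι-inj g x f) ⟩
      ⟦ 1 ℕ.+ odd ι g f ⟧
        ≡⟨ ⟦⟧-suc (odd ι g f) ⟩
      1ℚ + ⟦ odd ι g f ⟧ ∎))
      where
      open ≡-Reasoning
      2≡ : 2ℚ ≡ ⟦ 2 ⟧
      2≡ = sym (trans (⟦⟧-+ 1 1) (cong₂ _+_ ⟦1⟧ ⟦1⟧))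
      add-sub : ∀ a b → a ≡ a + b - b
      add-sub = solve-∀ ring
    rearranged : ∀ z p K → 2ℚ * ((1ℚ + z) - 2ℚ * p) - K ≡ (2ℚ * z - K + 2ℚ) + - 4ℚ * p
    rearranged = solve-∀ ring

  𝔼-bias-pour : ∀ f → 𝔼 (λ x → bias (f [ ι x ]%= suc)) ≡ λ₁ * bias f
  𝔼-bias-pour f = trans (𝔼-cong λ x → bias-pour x f)
    (trans (𝔼-+ _ _) (trans (cong₂ _+_ (𝔼-const (bias f + 2ℚ)) (trans (𝔼-* (- 4ℚ) _) (cong (- 4ℚ *_) (𝔼-parity f))))
      (trans (rearranged ⟦ odd ι g f ⟧ K r) (trans (cong (λ z → λ₁ * bias f + - 2ℚ * (z - 1ℚ)) rK≡1) (vanish (λ₁ * bias f))))))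
    where
    rearranged : ∀ z K r → (2ℚ * z - K + 2ℚ) + - 4ℚ * (r * z) ≡ (1ℚ - 2ℚ * r) * (2ℚ * z - K) + - 2ℚ * (r * K - 1ℚ)
    rearranged = solve-∀ ring
    vanish : ∀ a → a + - 2ℚ * (1ℚ - 1ℚ) ≡ a
    vanish = solve-∀ ring

  decay : ℕ → ℚ
  decay zero    = 1ℚ
  decay (suc i) = λ₁ * (λ₁ * decay i)

  run-bias : ∀ i t f → run X ι i t bias f ≡ decay i * bias f
  run-bias zero    t f = sym (*-identityˡ (bias f))
  run-bias (suc i) t f = begin
    𝔼 (λ x → 𝔼 λ y → run X ι i (suc t) bias (play₁ (X t) ι x y f))
      ≡⟨ 𝔼-cong (λ x → 𝔼-cong λ y → trans (run-bias i (suc t) _)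
           (cong (λ z → decay i * (2ℚ * ⟦ z ⟧ - K)) (odd-move (X t) ι g (poured ι x y f)))) ⟩
    𝔼 (λ x → 𝔼 λ y → decay i * bias (poured ι x y f))
      ≡⟨ 𝔼-cong (λ x → trans (𝔼-* (decay i) _) (cong (decay i *_) (𝔼-bias-pour (f [ ι x ]%= suc)))) ⟩
    𝔼 (λ x → decay i * (λ₁ * bias (f [ ι x ]%= suc)))
      ≡⟨ trans (𝔼-* (decay i) _) (cong (decay i *_) (trans (𝔼-* λ₁ _) (cong (λ₁ *_) (𝔼-bias-pour f)))) ⟩
    decay i * (λ₁ * (λ₁ * bias f))
      ≡⟨ rearranged (decay i) λ₁ (bias f) ⟩
    λ₁ * (λ₁ * decay i) * bias f ∎
    where
    open ≡-Reasoning
    rearranged : ∀ d l b → d * (l * (l * b)) ≡ l * (l * d) * b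
    rearranged = solve-∀ ring

  0≤decay : ∀ i → 0ℚ ≤ decay i
  0≤decay zero    = 0≤1ℚ
  0≤decay (suc i) = 0≤* 0≤λ₁ (0≤* 0≤λ₁ (0≤decay i))

  -- Each step pours twice, so `decay i` is the power of `λ₁` with exponent 2 * i. The
  -- Bernoulli-like bound K / (K + 4 * i) replaces an exponential estimate and falls below 1 / 4
  -- within `K` steps.
  decay≤ : ∀ i → (K + 4ℚ * ⟦ i ⟧) * decay i ≤ K
  decay≤ zero    = ≤-reflexive (trans (cong (λ z → (K + 4ℚ * z) * 1ℚ) ⟦0⟧) (simplify K))
    where
    simplify : ∀ K → (K + 4ℚ * 0ℚ) * 1ℚ ≡ K
    simplify = solve-∀ ring
  decay≤ (suc i) = ≤-trans (≤-trans (≤-reflexive (trans (cong (λ z → (K + 4ℚ * z) * (λ₁ * (λ₁ * decay i))) (⟦⟧-suc i)) (pull K ⟦ i ⟧ λ₁ (decay i))))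
    (*-mono-≤ˡ (0≤decay i) step)) (≤-trans (≤-reflexive (*-comm (decay i) (K + 4ℚ * ⟦ i ⟧))) (decay≤ i))
    where
    pull : ∀ K i l d → (K + 4ℚ * (1ℚ + i)) * (l * (l * d)) ≡ d * ((K + 4ℚ * i + 4ℚ) * l * l)
    pull = solve-∀ ring
    step : (K + 4ℚ * ⟦ i ⟧ + 4ℚ) * λ₁ * λ₁ ≤ K + 4ℚ * ⟦ i ⟧
    step = by-diff-mod (4ℚ - 4ℚ * r)
      (0≤+ (0≤* (0≤* (0≤* 0≤4ℚ (0≤* 0≤4ℚ (0≤⟦⟧ i))) (0≤1/ₛ (suc k))) (0≤+ 0≤λ₁ (0≤1/ₛ (suc k))))
           (0≤* (0≤* 0≤4ℚ (0≤1/ₛ (suc k))) (0≤+ 0≤1ℚ (0≤* 0≤2ℚ 0≤λ₁))))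
      (expand K ⟦ i ⟧ r) rK≡1
      where
      expand : ∀ K i r → K + 4ℚ * i - (K + 4ℚ * i + 4ℚ) * (1ℚ - 2ℚ * r) * (1ℚ - 2ℚ * r) ≡
               4ℚ * (4ℚ * i) * r * (1ℚ - 2ℚ * r + r) + 4ℚ * r * (1ℚ + 2ℚ * (1ℚ - 2ℚ * r)) + (4ℚ - 4ℚ * r) * (r * K - 1ℚ)
      expand = solve-∀ ring

  -- At least 3/8 of the K cups are odd in expectation.
  run-odd : ∀ {i} → suc (suc k) ℕ.≤ i → ∀ t f → K + 2ℚ * K ≤ 4ℚ * (2ℚ * run X ι i t (λ f → ⟦ odd ι g f ⟧) f)
  run-odd {i} K≤i t f = by-diff
    (0≤+ (≤⇒0≤ 4KD≤K) (0≤* 0≤4ℚ (0≤* (0≤decay i) (0≤* 0≤2ℚ (0≤⟦⟧ (odd ι g f))))))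
    (trans (cong (λ z → 4ℚ * z - (K + 2ℚ * K)) 2run) (combined K (decay i) ⟦ odd ι g f ⟧))
    where
    2run : 2ℚ * run X ι i t (λ f → ⟦ odd ι g f ⟧) f ≡ decay i * bias f + K
    2run = trans (add-sub (2ℚ * run X ι i t (λ f → ⟦ odd ι g f ⟧) f) K)
      (cong (_+ K) (trans (sym (trans (run-+ X ι _ _ i t f) (cong₂ _+_ (run-* X ι 2ℚ _ i t f) (run-const X ι (- K) i t f)))) (run-bias i t f)))
      where
      add-sub : ∀ a b → a ≡ a - b + b
      add-sub = solve-∀ ring
    4KD≤K : 4ℚ * (K * decay i) ≤ K
    4KD≤K = ≤-trans (by-diff (0≤+ (0≤* (0≤* 0≤4ℚ (0≤decay i)) (≤⇒0≤ (⟦⟧-mono K≤i))) (0≤* (0≤⟦⟧ (suc (suc k))) (0≤decay i)))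
        (expand K ⟦ i ⟧ (decay i))) (decay≤ i)
      where
      expand : ∀ K i d → (K + 4ℚ * i) * d - 4ℚ * (K * d) ≡ 4ℚ * d * (i - K) + K * d
      expand = solve-∀ ring
    combined : ∀ K d z → 4ℚ * (d * (2ℚ * z - K) + K) - (K + 2ℚ * K) ≡ (K - 4ℚ * (K * d)) + 4ℚ * (d * (2ℚ * z))
    combined = solve-∀ ring

-- Two consecutive phases

sum-const : ∀ k c → sum {k} (λ _ → c) ≡ k ℕ.* c
sum-const zero    c = refl
sum-const (suc k) c = cong (c ℕ.+_) (sum-const k c)

⟦⟧*-cancel-≤ : ∀ k {p q} → ⟦ suc k ⟧ * p ≤ ⟦ suc k ⟧ * q → p ≤ q
⟦⟧*-cancel-≤ k {p} {q} le = subst₂ _≤_ (undo p) (undo q) (*-mono-≤ˡ (0≤1/ₛ k) le)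
  where
  undo : ∀ p → 1/ₛ k * (⟦ suc k ⟧ * p) ≡ p
  undo p = trans (sym (*-assoc (1/ₛ k) ⟦ suc k ⟧ p))
    (trans (cong (_* p) (trans (*-comm (1/ₛ k) ⟦ suc k ⟧) (⟦⟧*1/ₛ k))) (*-identityˡ p))

-- Twice the positive part of the integer x = a - c is x + |x|, and |x| is at least 1 if `a` and `c`
-- have different parities.
parity-gap : ∀ a c → a ℕ.+ parity (a ℕ.+ c) ℕ.≤ 2 ℕ.* (a ℕ.∸ c) ℕ.+ c
parity-gap a c with ℕ.<-cmp a c
... | tri< a<c _ _ = ℕ.≤-trans (ℕ.+-monoʳ-≤ a (parity≤1 (a ℕ.+ c)))
                       (ℕ.≤-trans (ℕ.≤-reflexive (ℕ.+-comm a 1)) (ℕ.≤-trans a<c (ℕ.m≤n+m c (2 ℕ.* (a ℕ.∸ c)))))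
... | tri≈ _ refl _ = ℕ.≤-trans (ℕ.≤-reflexive (trans (cong (a ℕ.+_) (parity-double a)) (ℕ.+-identityʳ a))) (ℕ.m≤n+m a _)
... | tri> _ _ c<a = subst (λ a → a ℕ.+ parity (a ℕ.+ c) ℕ.≤ 2 ℕ.* (a ℕ.∸ c) ℕ.+ c) (ℕ.m+[n∸m]≡n c<a) (above (a ℕ.∸ suc c))
  where
  above : ∀ e → suc c ℕ.+ e ℕ.+ parity (suc c ℕ.+ e ℕ.+ c) ℕ.≤ 2 ℕ.* (suc c ℕ.+ e ℕ.∸ c) ℕ.+ c
  above e = ℕ.≤-trans (ℕ.+-monoʳ-≤ (suc c ℕ.+ e) (parity≤1 (suc c ℕ.+ e ℕ.+ c)))
    (ℕ.≤-trans (ℕ.m≤m+n _ e) (ℕ.≤-reflexive (trans (rearranged c e)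
      (cong (λ z → 2 ℕ.* z ℕ.+ c) (sym (trans (cong (ℕ._∸ c) (sym (ℕ.+-suc c e))) (ℕ.m+n∸m≡n c (suc e))))))))
    where
    rearranged : ∀ c e → suc c ℕ.+ e ℕ.+ 1 ℕ.+ e ≡ 2 ℕ.* suc e ℕ.+ c
    rearranged = solveℕ

module _ {n k} (ι : Fin (suc (suc k)) → Fin n) (s : ℕ) (g : Fin (suc (suc k)) → ℕ) (Σg≤1+s : sum g ℕ.≤ suc s)
         (f : Vec ℕ n) (s≤f : s ℕ.≤ total ι f) where

  private
    e = total ι f ℕ.∸ s
    sf : Fin (suc (suc k)) → ℕ
    sf d = shortfall ι d s g f

  shortfall-odd : ∀ d → lookup f (ι d) ℕ.+ parity (lookup f (ι d) ℕ.+ g d) ℕ.≤ (2 ℕ.* sf d ℕ.+ 2 ℕ.* e) ℕ.+ g d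
  shortfall-odd d = ℕ.≤-trans (parity-gap (lookup f (ι d)) (g d)) (ℕ.+-monoˡ-≤ (g d)
    (ℕ.≤-trans (ℕ.*-monoʳ-≤ 2 gap) (ℕ.≤-reflexive (ℕ.*-distribˡ-+ 2 (sf d) e))))
    where
    t = total (without ι d) f
    gap : lookup f (ι d) ℕ.∸ g d ℕ.≤ sf d ℕ.+ e
    gap = ℕ.≤-trans (ℕ.≤-reflexive (trans (sym (trans (cong₂ ℕ._∸_ (ℕ.+-comm (lookup f (ι d)) t) (ℕ.+-comm (g d) t)) (ℕ.[m+n]∸[m+o]≡n∸o t (lookup f (ι d)) (g d))))
            (cong (ℕ._∸ (g d ℕ.+ t)) (trans (sym (total-without ι d f)) (sym (ℕ.m+[n∸m]≡n s≤f))))))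
          (ℕ.m≤n+o⇒m∸n≤o (s ℕ.+ e) (g d ℕ.+ t)
            (ℕ.≤-trans (ℕ.+-monoˡ-≤ e (ℕ.m≤n+m∸n s (g d ℕ.+ t))) (ℕ.≤-reflexive (ℕ.+-assoc (g d ℕ.+ t) (sf d) e))))

  -- Summing over the dropped cup sets the fills, of sum at least `s`, against the levels, of sum at
  -- most `suc s`. Every mismatch of parities must then show as an excess, up to the slack 1 and the
  -- growth `e` of the total beyond `s`.
  odd≤shortfalls : odd ι g f ℕ.≤ 2 ℕ.* sum sf ℕ.+ suc (suc k) ℕ.* (2 ℕ.* e) ℕ.+ 1
  odd≤shortfalls = ℕ.+-cancelˡ-≤ s _ _ (begin
    s ℕ.+ odd ι g f                    ≤⟨ ℕ.+-monoˡ-≤ (odd ι g f) s≤f ⟩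
    total ι f ℕ.+ odd ι g f            ≡⟨ ∑-distrib-+ (λ d → lookup f (ι d)) (λ d → parity (lookup f (ι d) ℕ.+ g d)) ⟨
    sum (λ d → lookup f (ι d) ℕ.+ parity (lookup f (ι d) ℕ.+ g d)) ≤⟨ sum-mono shortfall-odd ⟩
    sum (λ d → (2 ℕ.* sf d ℕ.+ 2 ℕ.* e) ℕ.+ g d)                   ≡⟨ ∑-distrib-+ (λ d → 2 ℕ.* sf d ℕ.+ 2 ℕ.* e) g ⟩
    sum (λ d → 2 ℕ.* sf d ℕ.+ 2 ℕ.* e) ℕ.+ sum g
      ≡⟨ cong (ℕ._+ sum g) (trans (∑-distrib-+ (λ d → 2 ℕ.* sf d) (λ _ → 2 ℕ.* e))
           (cong₂ ℕ._+_ (sym (*-distribˡ-sum 2 sf)) (sum-const (suc (suc k)) (2 ℕ.* e)))) ⟩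
    2 ℕ.* sum sf ℕ.+ suc (suc k) ℕ.* (2 ℕ.* e) ℕ.+ sum g           ≤⟨ ℕ.+-monoʳ-≤ (2 ℕ.* sum sf ℕ.+ suc (suc k) ℕ.* (2 ℕ.* e)) Σg≤1+s ⟩
    2 ℕ.* sum sf ℕ.+ suc (suc k) ℕ.* (2 ℕ.* e) ℕ.+ suc s           ≡⟨ rearranged (2 ℕ.* sum sf ℕ.+ suc (suc k) ℕ.* (2 ℕ.* e)) s ⟩
    s ℕ.+ (2 ℕ.* sum sf ℕ.+ suc (suc k) ℕ.* (2 ℕ.* e) ℕ.+ 1)       ∎)
    where
    open ℕ.≤-Reasoning
    rearranged : ∀ a s → a ℕ.+ suc s ≡ s ℕ.+ (a ℕ.+ 1)
    rearranged = solveℕ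

8ℚ : ℚ
8ℚ = 4ℚ + 4ℚ

16ℚ : ℚ
16ℚ = 8ℚ + 8ℚ

0≤8ℚ : 0ℚ ≤ 8ℚ
0≤8ℚ = *≤* (ℤ.+≤+ z≤n)

0≤½ : 0ℚ ≤ ½
0≤½ = *≤* (ℤ.+≤+ z≤n)

⟦2⟧ : ⟦ 2 ⟧ ≡ 2ℚ
⟦2⟧ = trans (⟦⟧-+ 1 1) (cong₂ _+_ ⟦1⟧ ⟦1⟧)

⟦8⟧ : ⟦ 8 ⟧ ≡ 8ℚ
⟦8⟧ = trans (⟦⟧-+ 4 4) (cong₂ _+_ ⟦4⟧ ⟦4⟧)
  where
  ⟦4⟧ : ⟦ 4 ⟧ ≡ 4ℚ
  ⟦4⟧ = trans (⟦⟧-+ 2 2) (cong₂ _+_ ⟦2⟧ ⟦2⟧)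

module _ {n} (X : ℕ → ScoreBased n) {k} (ι : Fin (suc (suc k)) → Fin n) (ι-inj : Distinct ι) (T : ℕ) where

  growth-after : ℕ → Vec ℕ n → ℚ
  growth-after t f = run X ι T t (λ f′ → 𝔼 λ d → growth X (without ι d) T (T ℕ.+ t) f′) f

  module _ (8≤K : 8 ℕ.≤ suc (suc k)) (K≤T : suc (suc k) ℕ.≤ T) (t : ℕ) (f : Vec ℕ n) where

    private
      s = total ι f
      K = ⟦ suc (suc k) ⟧
      l = level X ι f
      Δ = growth X ι T t f
      Grown : Vec ℕ n → Set
      Grown f′ = s ℕ.≤ total ι f′
      grown-step : ∀ t x y f′ → Grown f′ → Grown (play₁ (X t) ι x y f′)
      grown-step t x y f′ s≤f′ = ℕ.≤-trans s≤f′ (total-play₁-≥ (X t) ι ι-inj x y f′)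

    module _ (g : Fin (suc (suc k)) → ℕ) (Σg≤1+s : sum g ℕ.≤ suc s) where

      private
        y : Vec ℕ n → ℚ
        y f′ = 𝔼 λ d → ⟦ shortfall ι d s g f′ ⟧
        ψ : Vec ℕ n → ℚ
        ψ f′ = 2ℚ * K * y f′ + (2ℚ * K * level X ι f′ + (1ℚ - 2ℚ * K * l))

      odd≤ψ : ∀ f′ → Grown f′ → ⟦ odd ι g f′ ⟧ ≤ ψ f′
      odd≤ψ f′ s≤f′ = ≤-trans (⟦⟧-mono (odd≤shortfalls ι s g Σg≤1+s f′ s≤f′)) (≤-reflexive (begin
        ⟦ 2 ℕ.* Σsf ℕ.+ suc (suc k) ℕ.* (2 ℕ.* e) ℕ.+ 1 ⟧
          ≡⟨ trans (⟦⟧-+ _ 1) (cong₂ _+_ (⟦⟧-+ (2 ℕ.* Σsf) (suc (suc k) ℕ.* (2 ℕ.* e))) ⟦1⟧) ⟩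
        ⟦ 2 ℕ.* Σsf ⟧ + ⟦ suc (suc k) ℕ.* (2 ℕ.* e) ⟧ + 1ℚ
          ≡⟨ cong₂ (λ p q → p + q + 1ℚ) (⟦⟧-* 2 Σsf) (trans (⟦⟧-* (suc (suc k)) (2 ℕ.* e)) (cong (K *_) (⟦⟧-* 2 e))) ⟩
        ⟦ 2 ⟧ * ⟦ Σsf ⟧ + K * (⟦ 2 ⟧ * ⟦ e ⟧) + 1ℚ
          ≡⟨ cong (λ z → z * ⟦ Σsf ⟧ + K * (z * ⟦ e ⟧) + 1ℚ) ⟦2⟧ ⟩
        2ℚ * ⟦ Σsf ⟧ + K * (2ℚ * ⟦ e ⟧) + 1ℚ
          ≡⟨ cong₂ (λ p q → 2ℚ * p + K * (2ℚ * q) + 1ℚ) (sym (trans (⟦⟧*𝔼 _) (sumℚ-⟦⟧ (λ d → shortfall ι d s g f′)))) ⟦e⟧≡ ⟩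
        2ℚ * (K * y f′) + K * (2ℚ * (level X ι f′ - l)) + 1ℚ
          ≡⟨ rearranged K (y f′) (level X ι f′) l ⟩
        ψ f′ ∎))
        where
        open ≡-Reasoning
        e = total ι f′ ℕ.∸ s
        Σsf = sum λ d → shortfall ι d s g f′
        ⟦e⟧≡ : ⟦ e ⟧ ≡ level X ι f′ - l
        ⟦e⟧≡ = trans (add-sub ⟦ e ⟧ l) (cong (_- l) (trans (sym (⟦⟧-+ e s)) (cong ⟦_⟧ (ℕ.m∸n+n≡m s≤f′))))
          where
          add-sub : ∀ a b → a ≡ a + b - b
          add-sub = solve-∀ ring
        rearranged : ∀ K y l′ l → 2ℚ * (K * y) + K * (2ℚ * (l′ - l)) + 1ℚ ≡ 2ℚ * K * y + (2ℚ * K * l′ + (1ℚ - 2ℚ * K * l))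
        rearranged = solve-∀ ring

      -- On average at least 3 / 8 of the `K` cups are odd, and `K ≥ 8` makes the slack 1 at most K
      -- / 8. This leaves K / 4, bounded by 2 * K times the sum of the mean shortfall and the growth
      -- `Δ`.
      run-shortfall : 1ℚ - 8ℚ * Δ ≤ 8ℚ * run X ι T t y f
      run-shortfall = ⟦⟧*-cancel-≤ (suc k) (by-diff
        (0≤* 0≤½ (0≤+ (0≤+ (≤⇒0≤ (run-odd X ι ι-inj g K≤T t f)) (0≤* 0≤8ℚ (≤⇒0≤ odd≤)))
                      (≤⇒0≤ (subst (_≤ K) ⟦8⟧ (⟦⟧-mono 8≤K)))))
        (combined K (run X ι T t y f) (run X ι T t (level X ι) f) l (run X ι T t (λ f′ → ⟦ odd ι g f′ ⟧) f)))
        where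
        odd≤ : run X ι T t (λ f′ → ⟦ odd ι g f′ ⟧) f ≤
               2ℚ * K * run X ι T t y f + (2ℚ * K * run X ι T t (level X ι) f + (1ℚ - 2ℚ * K * l))
        odd≤ = ≤-trans (run-mono-inv X ι Grown grown-step odd≤ψ T t f ℕ.≤-refl) (≤-reflexive
          (trans (run-+ X ι _ _ T t f) (cong₂ _+_ (run-* X ι (2ℚ * K) y T t f)
            (trans (run-+ X ι _ _ T t f) (cong₂ _+_ (run-* X ι (2ℚ * K) (level X ι) T t f) (run-const X ι _ T t f))))))
        combined : ∀ K y rl l o → K * (8ℚ * y) - K * (1ℚ - 8ℚ * (rl - l)) ≡
                   ½ * ((4ℚ * (2ℚ * o) - (K + 2ℚ * K)) + 8ℚ * ((2ℚ * K * y + (2ℚ * K * rl + (1ℚ - 2ℚ * K * l))) - o) + (K - 8ℚ))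
        combined = solve-∀ ring

    run-shortfalls : ∀ {L t′} gs → Thresholds X ι L s t′ gs →
                     ⟦ length gs ⟧ * (1ℚ - 8ℚ * Δ) ≤ 8ℚ * run X ι T t (λ f′ → 𝔼 λ d → shortfalls ι d s gs f′) f
    run-shortfalls [] _ = ≤-reflexive (trans (cong (_* (1ℚ - 8ℚ * Δ)) ⟦0⟧) (trans (*-zeroˡ (1ℚ - 8ℚ * Δ))
      (sym (trans (cong (8ℚ *_) (trans (run-cong X ι (λ _ → 𝔼-const 0ℚ) T t f) (run-const X ι 0ℚ T t f))) (*-zeroʳ 8ℚ)))))
    run-shortfalls (g ∷ gs) ((Σg≤ , _) , thrs) = begin
      ⟦ suc (length gs) ⟧ * (1ℚ - 8ℚ * Δ)                         ≡⟨ cong (_* (1ℚ - 8ℚ * Δ)) (⟦⟧-suc (length gs)) ⟩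
      (1ℚ + ⟦ length gs ⟧) * (1ℚ - 8ℚ * Δ)                        ≡⟨ expand ⟦ length gs ⟧ (1ℚ - 8ℚ * Δ) ⟩
      (1ℚ - 8ℚ * Δ) + ⟦ length gs ⟧ * (1ℚ - 8ℚ * Δ)               ≤⟨ +-mono-≤ (run-shortfall g Σg≤) (run-shortfalls gs thrs) ⟩
      8ℚ * run X ι T t y f + 8ℚ * run X ι T t z f                 ≡⟨ *-distribˡ-+ 8ℚ (run X ι T t y f) (run X ι T t z f) ⟨
      8ℚ * (run X ι T t y f + run X ι T t z f)                    ≡⟨ cong (8ℚ *_) (trans (run-cong X ι (λ f′ → 𝔼-+ _ _) T t f) (run-+ X ι y z T t f)) ⟨
      8ℚ * run X ι T t (λ f′ → 𝔼 λ d → shortfalls ι d s (g ∷ gs) f′) f ∎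
      where
      open ≤-Reasoning
      y z : Vec ℕ n → ℚ
      y f′ = 𝔼 λ d → ⟦ shortfall ι d s g f′ ⟧
      z f′ = 𝔼 λ d → shortfalls ι d s gs f′
      expand : ∀ n p → (1ℚ + n) * p ≡ p + n * p
      expand = solve-∀ ring

    -- The number `N` of windows is taken equal to the constant `C` of `growth-windows`. The
    -- shortfalls of all windows are then at most 2 * N times the growth, and `N` cancels against
    -- the lower bound of `run-shortfalls`.
    two-phases : ∀ b L → 1 ℕ.≤ b → s ℕ.≤ b → suc (suc k) ℕ.* b ℕ.< L → (b ℕ.* paths k L) ℕ.* L ℕ.≤ T →
                 1ℚ ≤ 16ℚ * growth-after t f + 8ℚ * Δ
    two-phases b L 1≤b s≤b Kb<L windows≤T = decidable-stable (1ℚ ≤? _) λ ≰ →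
      ¬¬-thresholds X ι ι-inj L s (ℕ.≤-<-trans (ℕ.*-monoʳ-≤ (suc (suc k)) s≤b) Kb<L) N (T ℕ.+ t) λ { (gs , len , thrs) → ≰ (bound gs len thrs) }
      where
      N = b ℕ.* paths k L
      1≤N : 1 ℕ.≤ N
      1≤N = ℕ.*-mono-≤ 1≤b (1≤paths k L)
      bound : ∀ gs → length gs ≡ N → Thresholds X ι L s (T ℕ.+ t) gs → 1ℚ ≤ 16ℚ * growth-after t f + 8ℚ * Δ
      bound gs len thrs = by-diff (≤⇒0≤ (⟦⟧*-cancel-≤ (N ℕ.∸ 1)
        (subst (λ m → ⟦ m ⟧ * (1ℚ - 8ℚ * Δ) ≤ ⟦ m ⟧ * (16ℚ * growth-after t f)) (sym (ℕ.m+[n∸m]≡n 1≤N)) scaled)))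
        (rearranged (growth-after t f) Δ)
        where
        rearranged : ∀ g d → 16ℚ * g + 8ℚ * d - 1ℚ ≡ 16ℚ * g - (1ℚ - 8ℚ * d)
        rearranged = solve-∀ ring
        pointwise : ∀ f′ → Grown f′ → 𝔼 (λ d → shortfalls ι d s gs f′) ≤
                    (⟦ N ⟧ + ⟦ N ⟧) * 𝔼 (λ d → growth X (without ι d) T (T ℕ.+ t) f′)
        pointwise f′ s≤f′ = subst (𝔼 (λ d → shortfalls ι d s gs f′) ≤_) (𝔼-* (⟦ N ⟧ + ⟦ N ⟧) _) (𝔼-mono λ d →
          ≤-trans (growth-windows X ι ι-inj d L s b s≤b gs (T ℕ.+ t) f′ thrs s≤f′)
            (subst (λ m → (⟦ N ⟧ + ⟦ m ⟧) * growth X (without ι d) (m ℕ.* L) (T ℕ.+ t) f′ ≤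
                          (⟦ N ⟧ + ⟦ N ⟧) * growth X (without ι d) T (T ℕ.+ t) f′) (sym len)
              (*-mono-≤ˡ (0≤+ (0≤⟦⟧ N) (0≤⟦⟧ N))
                (growth-mono X (without ι d) (Distinct-without ι-inj d) windows≤T (T ℕ.+ t) f′))))
        upper : run X ι T t (λ f′ → 𝔼 λ d → shortfalls ι d s gs f′) f ≤ (⟦ N ⟧ + ⟦ N ⟧) * growth-after t f
        upper = ≤-trans (run-mono-inv X ι Grown grown-step pointwise T t f ℕ.≤-refl)
          (≤-reflexive (run-* X ι (⟦ N ⟧ + ⟦ N ⟧) _ T t f))
        scaled : ⟦ N ⟧ * (1ℚ - 8ℚ * Δ) ≤ ⟦ N ⟧ * (16ℚ * growth-after t f)
        scaled = ≤-trans (subst (λ m → ⟦ m ⟧ * (1ℚ - 8ℚ * Δ) ≤ 8ℚ * run X ι T t (λ f′ → 𝔼 λ d → shortfalls ι d s gs f′) f) len (run-shortfalls gs thrs))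
          (≤-trans (*-mono-≤ˡ 0≤8ℚ upper) (≤-reflexive (collect ⟦ N ⟧ (growth-after t f))))
          where
          collect : ∀ N g → 8ℚ * ((N + N) * g) ≡ N * (16ℚ * g)
          collect = solve-∀ ring

-- Summing over the phases

32ℚ : ℚ
32ℚ = 16ℚ + 16ℚ

64ℚ : ℚ
64ℚ = 32ℚ + 32ℚ

0≤16ℚ : 0ℚ ≤ 16ℚ
0≤16ℚ = *≤* (ℤ.+≤+ z≤n)

0≤32ℚ : 0ℚ ≤ 32ℚ
0≤32ℚ = *≤* (ℤ.+≤+ z≤n)

0≤64ℚ : 0ℚ ≤ 64ℚ
0≤64ℚ = *≤* (ℤ.+≤+ z≤n)

1/ₛ≤1 : ∀ k → 1/ₛ k ≤ 1ℚ
1/ₛ≤1 k = subst₂ _≤_ (trans (cong (_* 1/ₛ k) ⟦1⟧) (*-identityˡ (1/ₛ k))) (⟦⟧*1/ₛ k)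
  (*-monoʳ-≤-nonNeg (1/ₛ k) {{nonNegative (0≤1/ₛ k)}} (⟦⟧-mono (s≤s (z≤n {k}))))

1/ₛ-telescope : ∀ k → 1/ₛ k * (1ℚ - 1/ₛ (suc k)) ≡ 1/ₛ (suc k)
1/ₛ-telescope k = begin
  p * (1ℚ - q)               ≡⟨ cong (λ z → p * (z - q)) (sym (trans (cong (_* q) (sym (⟦⟧-suc (suc k)))) (⟦⟧*1/ₛ (suc k)))) ⟩
  p * ((1ℚ + K) * q - q)     ≡⟨ rearranged p q K ⟩
  K * p * q                  ≡⟨ cong (_* q) (⟦⟧*1/ₛ k) ⟩
  1ℚ * q                     ≡⟨ *-identityˡ q ⟩
  q                          ∎
  where
  open ≡-Reasoning
  p = 1/ₛ k
  q = 1/ₛ (suc k)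
  K = ⟦ suc k ⟧
  rearranged : ∀ p q K → p * ((1ℚ + K) * q - q) ≡ K * p * q
  rearranged = solve-∀ ring

1/ₛ≤2* : ∀ k → 1/ₛ k ≤ 2ℚ * 1/ₛ (suc k)
1/ₛ≤2* k = by-diff-mod 1ℚ (0≤* (0≤1/ₛ (suc k)) (≤⇒0≤ (1/ₛ≤1 k))) (rearranged (1/ₛ k) (1/ₛ (suc k))) (sym (1/ₛ-telescope k))
  where
  rearranged : ∀ p q → 2ℚ * q - p ≡ q * (1ℚ - p) + 1ℚ * (q - p * (1ℚ - q))
  rearranged = solve-∀ ring

-- Each cup survives the random drop with probability (k + 1) / (k + 2), which is the factor by
-- which the divisor of the average shrinks.
𝔼-level-without : ∀ {n} (X : ℕ → ScoreBased n) {k} (ι : Fin (suc (suc k)) → Fin n) f →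
                  1/ₛ k * 𝔼 (λ d → level X (without ι d) f) ≡ 1/ₛ (suc k) * level X ι f
𝔼-level-without X {k} ι f = begin
  p * 𝔼 (λ d → level X (without ι d) f)                        ≡⟨ cong (p *_) (𝔼-cong each) ⟩
  p * 𝔼 (λ d → l + - 1ℚ * ⟦ lookup f (ι d) ⟧)                  ≡⟨ cong (p *_) (trans (𝔼-+ _ _) (cong₂ _+_ (𝔼-const l) (𝔼-* (- 1ℚ) _))) ⟩
  p * (l + - 1ℚ * 𝔼 (λ d → ⟦ lookup f (ι d) ⟧))                ≡⟨ cong (λ z → p * (l + - 1ℚ * z)) (trans (𝔼≡ _) (cong (_* q) (sumℚ-⟦⟧ (λ d → lookup f (ι d))))) ⟩
  p * (l + - 1ℚ * (l * q))                                     ≡⟨ rearranged p l q ⟩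
  p * (1ℚ - q) * l                                             ≡⟨ cong (_* l) (1/ₛ-telescope k) ⟩
  q * l                                                        ∎
  where
  open ≡-Reasoning
  p = 1/ₛ k
  q = 1/ₛ (suc k)
  l = level X ι f
  each : ∀ d → level X (without ι d) f ≡ l + - 1ℚ * ⟦ lookup f (ι d) ⟧
  each d = trans (isolate ⟦ lookup f (ι d) ⟧ (level X (without ι d) f))
    (cong (_+ - 1ℚ * ⟦ lookup f (ι d) ⟧) (trans (sym (⟦⟧-+ (lookup f (ι d)) _)) (cong ⟦_⟧ (sym (total-without ι d f)))))
    where
    isolate : ∀ a b → b ≡ a + b + - 1ℚ * a
    isolate = solve-∀ ring
  rearranged : ∀ p l q → p * (l + - 1ℚ * (l * q)) ≡ p * (1ℚ - q) * l
  rearranged = solve-∀ ring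

module _ {n} (X : ℕ → ScoreBased n) (m T : ℕ) where

  -- The expected average fill of the last suc m active cups, in half units, at
  -- the end of the r phases in which suc (r + m), …, suc (suc m) cups are active.
  value : ∀ r → (Fin (suc (r ℕ.+ m)) → Fin n) → ℕ → Vec ℕ n → ℚ
  value zero    ι t f = 1/ₛ m * level X ι f
  value (suc r) ι t f = run X ι T t (λ f′ → 𝔼 λ d → value r (without ι d) (T ℕ.+ t) f′) f

  harmonic : ℕ → ℚ
  harmonic zero    = 0ℚ
  harmonic (suc r) = harmonic r + 1/ₛ (suc r ℕ.+ m)

  harmonic≤ : ∀ r → harmonic r ≤ ⟦ r ⟧
  harmonic≤ zero    = ≤-reflexive (sym ⟦0⟧)
  harmonic≤ (suc r) = ≤-trans (+-mono-≤ (harmonic≤ r) (1/ₛ≤1 (suc r ℕ.+ m)))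
    (≤-reflexive (trans (+-comm ⟦ r ⟧ 1ℚ) (sym (⟦⟧-suc r))))

  average≤value : ∀ r ι → Distinct ι → ∀ t f → 1/ₛ (r ℕ.+ m) * level X ι f ≤ value r ι t f
  average-run≤value : ∀ r ι → Distinct ι → ∀ t f →
                      1/ₛ (suc r ℕ.+ m) * run X ι T t (level X ι) f ≤ value (suc r) ι t f

  average≤value zero    ι ι-inj t f = ≤-refl
  average≤value (suc r) ι ι-inj t f =
    ≤-trans (*-mono-≤ˡ (0≤1/ₛ (suc r ℕ.+ m)) (level≤run X ι ι-inj T t f)) (average-run≤value r ι ι-inj t f)

  average-run≤value r ι ι-inj t f = subst (_≤ value (suc r) ι t f) (run-* X ι (1/ₛ (suc r ℕ.+ m)) (level X ι) T t f)
    (run-mono X ι (λ f′ → subst (_≤ 𝔼 (λ d → value r (without ι d) (T ℕ.+ t) f′))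
        (trans (𝔼-* (1/ₛ (r ℕ.+ m)) _) (𝔼-level-without X ι f′))
        (𝔼-mono λ d → average≤value r (without ι d) (Distinct-without ι-inj d) (T ℕ.+ t) f′))
      T t f)

  module _ (7≤m : 7 ℕ.≤ m) (L : ℕ) (long : n ℕ.* (n ℕ.* n) ℕ.< L) (n≤T : n ℕ.≤ T)
           (windows≤T : ((n ℕ.* n) ℕ.* (n ℕ.* n) ℕ.^ L) ℕ.* L ℕ.≤ T) where

    -- A total above n * n outweighs the harmonic sum by itself, so that wasted
    -- steps are only needed for bounded totals.
    value-≥ : ∀ r ι → Distinct ι → suc (suc r ℕ.+ m) ℕ.≤ n → ∀ t f →
              16ℚ * 1/ₛ (suc r ℕ.+ m) * (2ℚ * level X ι f + growth X ι T t f) + harmonic r ≤ 64ℚ * value (suc r) ι t f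
    value-≥ zero ι ι-inj K≤n t f = ≤-trans
      (by-diff (0≤+ (0≤* (0≤* 0≤16ℚ 0≤q) (0≤+ (0≤* 0≤2ℚ (0≤⟦⟧ (total ι f))) (0≤* 0≤2ℚ (0≤growth X ι ι-inj T t f)))) (0≤* 0≤16ℚ (0≤* 0≤q (0≤growth X ι ι-inj T t f))))
        (rearranged (1/ₛ (suc m)) (level X ι f) (run X ι T t (level X ι) f)))
      (*-mono-≤ˡ 0≤64ℚ (average-run≤value zero ι ι-inj t f))
      where
      0≤q = 0≤1/ₛ (suc m)
      rearranged : ∀ q l r → 64ℚ * (q * r) - (16ℚ * q * (2ℚ * l + (r - l)) + 0ℚ) ≡
                   16ℚ * q * (2ℚ * l + 2ℚ * (r - l)) + 16ℚ * (q * (r - l))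
      rearranged = solve-∀ ring
    value-≥ (suc r) ι ι-inj K≤n t f = case total ι f ℕ.≤? n ℕ.* n of λ
      { (yes low)  → low-case low
      ; (no  high) → ≤-trans (high-case (ℕ.<⇒≤ (ℕ.≰⇒> high))) (*-mono-≤ˡ 0≤64ℚ (average-run≤value (suc r) ι ι-inj t f))
      }
      where
      k = suc r ℕ.+ m
      p = 1/ₛ k
      q = 1/ₛ (suc k)
      l = level X ι f
      rl = run X ι T t (level X ι) f
      Δ = growth X ι T t f
      G = growth-after X ι ι-inj T t f
      H = harmonic r
      0≤Δ = 0≤growth X ι ι-inj T t f
      -- The average `q * l` is at least the number `suc r` of harmonic terms, each of which is at
      -- most 1.
      high-case : n ℕ.* n ℕ.≤ total ι f → 16ℚ * q * (2ℚ * l + Δ) + (H + p) ≤ 64ℚ * (q * rl)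
      high-case n²≤ = by-diff
        (0≤+ (0≤* 0≤32ℚ (≤⇒0≤ (≤-trans (harmonic≤ (suc r)) r≤ql))) (0≤+ (0≤* (0≤* 0≤32ℚ (0≤1/ₛ (suc k))) 0≤Δ)
          (0≤+ (0≤* (0≤* 0≤16ℚ (0≤1/ₛ (suc k))) 0≤Δ) (0≤* (0≤+ 0≤16ℚ (0≤+ 0≤8ℚ (0≤+ 0≤4ℚ (0≤+ 0≤2ℚ 0≤1ℚ)))) 0≤H+p))))
        (rearranged q l rl (H + p))
        where
        0≤harmonic : ∀ r → 0ℚ ≤ harmonic r
        0≤harmonic zero    = ≤-refl
        0≤harmonic (suc r) = 0≤+ (0≤harmonic r) (0≤1/ₛ (suc r ℕ.+ m))
        0≤H+p : 0ℚ ≤ H + p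
        0≤H+p = 0≤harmonic (suc r)
        r≤ql : ⟦ suc r ⟧ ≤ q * l
        r≤ql = ⟦⟧*-cancel-≤ (suc k) (≤-trans (≤-reflexive (sym (⟦⟧-* (suc (suc k)) (suc r))))
          (≤-trans (⟦⟧-mono (ℕ.≤-trans (ℕ.*-mono-≤ K≤n (ℕ.≤-trans (ℕ.≤-trans (ℕ.m≤m+n (suc r) m) (ℕ.≤-trans (ℕ.n≤1+n k) (ℕ.n≤1+n (suc k)))) K≤n)) n²≤))
            (≤-reflexive (sym (trans (sym (*-assoc ⟦ suc (suc k) ⟧ q l)) (trans (cong (_* l) (⟦⟧*1/ₛ (suc k))) (*-identityˡ l)))))))
        rearranged : ∀ q l rl h → 64ℚ * (q * rl) - (16ℚ * q * (2ℚ * l + (rl - l)) + h) ≡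
                     32ℚ * (q * l - h) + (32ℚ * q * (rl - l) + (16ℚ * q * (rl - l) + (16ℚ + (8ℚ + (4ℚ + (2ℚ + 1ℚ)))) * h))
        rearranged = solve-∀ ring
      low-case : total ι f ℕ.≤ n ℕ.* n → 16ℚ * q * (2ℚ * l + Δ) + (H + p) ≤ 64ℚ * value (suc (suc r)) ι t f
      -- Over the phase the term in the level rises by 32 * q * Δ. Half of this pays for the term 16
      -- * q * Δ of the bound. The other half is at least 8 * p * Δ, as p ≤ 2 * q, and together with
      -- 16 * p * G from the next phase it pays for the new harmonic term `p`.
      low-case ≤n² = ≤-trans
        (by-diff (0≤+ (0≤* (0≤* 0≤8ℚ 0≤Δ) (≤⇒0≤ (1/ₛ≤2* k))) (0≤* (0≤1/ₛ k) (≤⇒0≤ two)))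
          (rearranged p q l rl G H))
        (subst₂ _≤_ run-ψ (run-* X ι 64ℚ _ T t f) (run-mono X ι pointwise T t f))
        where
        n>0 : 1 ℕ.≤ n
        n>0 = ℕ.≤-trans (s≤s z≤n) K≤n
        two : 1ℚ ≤ 16ℚ * G + 8ℚ * Δ
        two = two-phases X ι ι-inj T (ℕ.≤-trans (s≤s 7≤m) (ℕ.≤-trans (s≤s (ℕ.m≤n+m m r)) (ℕ.≤-trans (ℕ.n≤1+n (suc (r ℕ.+ m))) (ℕ.n≤1+n (suc k)))))
          (ℕ.≤-trans K≤n n≤T) t f (n ℕ.* n) L (ℕ.*-mono-≤ n>0 n>0) ≤n²
          (ℕ.≤-<-trans (ℕ.*-monoˡ-≤ (n ℕ.* n) K≤n) long)
          (ℕ.≤-trans (ℕ.*-monoˡ-≤ L (ℕ.*-monoʳ-≤ (n ℕ.* n) (ℕ.^-monoˡ-≤ L (ℕ.*-mono-≤ k≤n k≤n)))) windows≤T)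
          where
          k≤n : suc k ℕ.≤ n
          k≤n = ℕ.≤-trans (ℕ.n≤1+n (suc k)) K≤n
        ψ : Vec ℕ n → ℚ
        ψ f′ = 32ℚ * q * level X ι f′ + (16ℚ * p * 𝔼 (λ d → growth X (without ι d) T (T ℕ.+ t) f′) + H)
        run-ψ : run X ι T t ψ f ≡ 32ℚ * q * rl + (16ℚ * p * G + H)
        run-ψ = trans (run-+ X ι _ _ T t f) (cong₂ _+_ (run-* X ι (32ℚ * q) (level X ι) T t f)
          (trans (run-+ X ι _ _ T t f) (cong₂ _+_ (run-* X ι (16ℚ * p) _ T t f) (run-const X ι H T t f))))
        pointwise : ∀ f′ → ψ f′ ≤ 64ℚ * 𝔼 (λ d → value (suc r) (without ι d) (T ℕ.+ t) f′)
        pointwise f′ = subst₂ _≤_ collected (𝔼-* 64ℚ _)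
          (𝔼-mono λ d → value-≥ r (without ι d) (Distinct-without ι-inj d) (ℕ.≤-trans (ℕ.n≤1+n (suc k)) K≤n) (T ℕ.+ t) f′)
          where
          lev gro : Fin (suc (suc k)) → ℚ
          lev d = level X (without ι d) f′
          gro d = growth X (without ι d) T (T ℕ.+ t) f′
          collected : 𝔼 (λ d → 16ℚ * p * (2ℚ * lev d + gro d) + H) ≡ ψ f′
          collected = trans (𝔼-+ _ _) (trans (cong₂ _+_ (trans (𝔼-* (16ℚ * p) _)
              (cong (16ℚ * p *_) (trans (𝔼-+ _ _) (cong (_+ 𝔼 gro) (𝔼-* 2ℚ lev))))) (𝔼-const H))
            (trans (expand p (𝔼 lev) (𝔼 gro) H) (trans (cong (λ z → 32ℚ * z + (16ℚ * p * 𝔼 gro + H)) (𝔼-level-without X ι f′))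
              (cong (_+ (16ℚ * p * 𝔼 gro + H)) (sym (*-assoc 32ℚ q (level X ι f′)))))))
            where
            expand : ∀ p a b h → 16ℚ * p * (2ℚ * a + b) + h ≡ 32ℚ * (p * a) + (16ℚ * p * b + h)
            expand = solve-∀ ring
        rearranged : ∀ p q l rl G H → (32ℚ * q * rl + (16ℚ * p * G + H)) - (16ℚ * q * (2ℚ * l + (rl - l)) + (H + p)) ≡
                     8ℚ * (rl - l) * (2ℚ * q - p) + p * (16ℚ * G + 8ℚ * (rl - l) - 1ℚ)
        rearranged = solve-∀ ring

-- Averages over the filler's outcomes

listSum : {A : Set} → List A → (A → ℚ) → ℚ
listSum xs f = foldr _+_ 0ℚ (map f xs)

module _ {A : Set} where

  ⟦⟧*mean : ∀ (xs : List A) f → ⟦ length xs ⟧ * mean xs f ≡ listSum xs f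
  ⟦⟧*mean []       f = *-zeroʳ ⟦ 0 ⟧
  ⟦⟧*mean (x ∷ xs) f = trans (cong (λ r → ⟦ suc (length xs) ⟧ * (listSum (x ∷ xs) f * r)) (sym (1/ₛ≡ (length xs))))
    (trans (rearranged ⟦ suc (length xs) ⟧ (listSum (x ∷ xs) f) (1/ₛ (length xs)))
      (trans (cong (_* listSum (x ∷ xs) f) (⟦⟧*1/ₛ (length xs))) (*-identityˡ _)))
    where
    rearranged : ∀ l s r → l * (s * r) ≡ l * r * s
    rearranged = solve-∀ ring

  mean-unique : ∀ (xs : List A) f {q} → 1 ℕ.≤ length xs → ⟦ length xs ⟧ * q ≡ listSum xs f → mean xs f ≡ q
  mean-unique (x ∷ xs) f {q} _ eq = ≤-antisym (⟦⟧*-cancel-≤ (length xs) (≤-reflexive (trans (⟦⟧*mean (x ∷ xs) f) (sym eq))))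
    (⟦⟧*-cancel-≤ (length xs) (≤-reflexive (trans eq (sym (⟦⟧*mean (x ∷ xs) f)))))

  listSum-cong : ∀ (xs : List A) {f g} → (∀ x → f x ≡ g x) → listSum xs f ≡ listSum xs g
  listSum-cong xs eq = cong (foldr _+_ 0ℚ) (List.map-cong eq xs)

  mean-cong : ∀ (xs : List A) {f g} → (∀ x → f x ≡ g x) → mean xs f ≡ mean xs g
  mean-cong []       eq = refl
  mean-cong (x ∷ xs) eq = cong (_* _) (listSum-cong (x ∷ xs) eq)

  listSum-* : ∀ c (xs : List A) f → listSum xs (λ x → c * f x) ≡ c * listSum xs f
  listSum-* c []       f = sym (*-zeroʳ c)
  listSum-* c (x ∷ xs) f = trans (cong (λ z → c * f x + z) (listSum-* c xs f)) (sym (*-distribˡ-+ c (f x) (listSum xs f)))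

  mean-* : ∀ c (xs : List A) f → mean xs (λ x → c * f x) ≡ c * mean xs f
  mean-* c []       f = sym (*-zeroʳ c)
  mean-* c (x ∷ xs) f = trans (cong (_* _) (listSum-* c (x ∷ xs) f)) (*-assoc c (listSum (x ∷ xs) f) _)

  listSum-const : ∀ c (xs : List A) → listSum xs (λ _ → c) ≡ ⟦ length xs ⟧ * c
  listSum-const c []       = sym (trans (cong (_* c) ⟦0⟧) (*-zeroˡ c))
  listSum-const c (x ∷ xs) = trans (cong (λ z → c + z) (listSum-const c xs)) (trans (factor c ⟦ length xs ⟧) (cong (_* c) (sym (⟦⟧-suc (length xs)))))
    where
    factor : ∀ c k → c + k * c ≡ (1ℚ + k) * c
    factor = solve-∀ ring

  mean-const : ∀ c (xs : List A) → 1 ℕ.≤ length xs → mean xs (λ _ → c) ≡ c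
  mean-const c xs ne = mean-unique xs (λ _ → c) ne (sym (listSum-const c xs))

  listSum-++ : ∀ (xs ys : List A) f → listSum (xs ++ ys) f ≡ listSum xs f + listSum ys f
  listSum-++ []       ys f = sym (+-identityˡ _)
  listSum-++ (x ∷ xs) ys f = trans (cong (λ z → f x + z) (listSum-++ xs ys f)) (sym (+-assoc (f x) (listSum xs f) (listSum ys f)))

listSum-map : {A B : Set} (g : A → B) (xs : List A) (f : B → ℚ) → listSum (map g xs) f ≡ listSum xs (f ∘ g)
listSum-map g xs f = cong (foldr _+_ 0ℚ) (sym (List.map-∘ xs))

mean-map : {A B : Set} (g : A → B) (xs : List A) (f : B → ℚ) → mean (map g xs) f ≡ mean xs (f ∘ g)
mean-map g []       f = refl
mean-map g (x ∷ xs) f = cong₂ (λ s l → s * ((+ 1) / suc l)) (listSum-map g (x ∷ xs) f) (List.length-map g xs)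

module _ {A B C : Set} (h : A → B → C) where

  listSum-product : ∀ xs ys f → listSum (cartesianProductWith h xs ys) f ≡ listSum xs (λ x → listSum ys (λ y → f (h x y)))
  listSum-product []       ys f = refl
  listSum-product (x ∷ xs) ys f = trans (listSum-++ (map (h x) ys) _ f) (cong₂ _+_ (listSum-map (h x) ys f) (listSum-product xs ys f))

  length-product : ∀ xs ys → length (cartesianProductWith h xs ys) ≡ length xs ℕ.* length ys
  length-product []       ys = refl
  length-product (x ∷ xs) ys = trans (List.length-++ (map (h x) ys)) (cong₂ ℕ._+_ (List.length-map (h x) ys) (length-product xs ys))

  product-nonempty : ∀ xs ys → 1 ℕ.≤ length xs → 1 ℕ.≤ length ys → 1 ℕ.≤ length (cartesianProductWith h xs ys)
  product-nonempty xs ys nx ny = subst (1 ℕ.≤_) (sym (length-product xs ys)) (ℕ.*-mono-≤ nx ny)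

  mean-product : ∀ xs ys f → 1 ℕ.≤ length xs → 1 ℕ.≤ length ys →
                 mean (cartesianProductWith h xs ys) f ≡ mean xs (λ x → mean ys (λ y → f (h x y)))
  mean-product xs ys f nx ny = mean-unique (cartesianProductWith h xs ys) f (product-nonempty xs ys nx ny) (begin
    ⟦ length (cartesianProductWith h xs ys) ⟧ * mean xs inner      ≡⟨ cong (λ l → ⟦ l ⟧ * mean xs inner) (length-product xs ys) ⟩
    ⟦ length xs ℕ.* length ys ⟧ * mean xs inner                    ≡⟨ cong (_* mean xs inner) (⟦⟧-* (length xs) (length ys)) ⟩
    ⟦ length xs ⟧ * ⟦ length ys ⟧ * mean xs inner                  ≡⟨ rearranged ⟦ length xs ⟧ ⟦ length ys ⟧ (mean xs inner) ⟩
    ⟦ length ys ⟧ * (⟦ length xs ⟧ * mean xs inner)                ≡⟨ cong (⟦ length ys ⟧ *_) (⟦⟧*mean xs inner) ⟩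
    ⟦ length ys ⟧ * listSum xs inner                               ≡⟨ listSum-* ⟦ length ys ⟧ xs inner ⟨
    listSum xs (λ x → ⟦ length ys ⟧ * inner x)                     ≡⟨ listSum-cong xs (λ x → ⟦⟧*mean ys (λ y → f (h x y))) ⟩
    listSum xs (λ x → listSum ys (λ y → f (h x y)))                ≡⟨ listSum-product xs ys f ⟨
    listSum (cartesianProductWith h xs ys) f                       ∎)
    where
    open ≡-Reasoning
    inner : A → ℚ
    inner x = mean ys (λ y → f (h x y))
    rearranged : ∀ a b c → a * b * c ≡ b * (a * c)
    rearranged = solve-∀ ring

mean-allFin : ∀ {k} (f : Fin (suc k) → ℚ) → mean (allFin (suc k)) f ≡ 𝔼 f
mean-allFin {k} f = mean-unique (allFin (suc k)) f (s≤s z≤n)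
  (trans (cong (λ l → ⟦ l ⟧ * 𝔼 f) (List.length-tabulate {n = suc k} (λ x → x))) (trans (⟦⟧*𝔼 f) (sym (sum-tabulate (λ x → x) f))))
  where
  sum-tabulate : ∀ {k} {A : Set} (g : Fin k → A) (f : A → ℚ) → listSum (tabulate g) f ≡ ℚΣ.sum (λ x → f (g x))
  sum-tabulate {zero}  g f = refl
  sum-tabulate {suc k} g f = cong (λ z → f (g zero) + z) (sum-tabulate (g ∘ suc) f)

firstCups≡ : ∀ {n k} (k≤n : k ℕ.≤ n) → firstCups n k ≡ map (λ x → inject≤ x k≤n) (allFin k)
firstCups≡ {n}     {zero}  k≤n = none (allFin n)
  where
  none : ∀ {n} (xs : List (Fin n)) → filter (λ x → toℕ x ℕ.<? 0) xs ≡ []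
  none []       = refl
  none (x ∷ xs) = none xs
firstCups≡ {suc n} {suc k} k≤n = cong (zero ∷_) (begin
  filter (λ x → toℕ x ℕ.<? suc k) (tabulate suc)             ≡⟨ cong (filter (λ x → toℕ x ℕ.<? suc k)) (sym (List.map-tabulate {n = n} (λ x → x) suc)) ⟩
  filter (λ x → toℕ x ℕ.<? suc k) (map suc (allFin n))       ≡⟨ shift (allFin n) ⟩
  map suc (firstCups n k)                                    ≡⟨ cong (map suc) (firstCups≡ (ℕ.≤-pred k≤n)) ⟩
  map suc (map (λ x → inject≤ x (ℕ.≤-pred k≤n)) (allFin k))  ≡⟨ List.map-∘ (allFin k) ⟨
  map (λ x → suc (inject≤ x (ℕ.≤-pred k≤n))) (allFin k)      ≡⟨ List.map-tabulate {n = k} (λ x → x) _ ⟩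
  tabulate (λ x → suc (inject≤ x (ℕ.≤-pred k≤n)))            ≡⟨ List.map-tabulate {n = k} suc _ ⟨
  map (λ x → inject≤ x k≤n) (tabulate suc)                   ∎)
  where
  open ≡-Reasoning
  shift : ∀ xs → filter (λ x → toℕ x ℕ.<? suc k) (map suc xs) ≡ map suc (filter (λ x → toℕ x ℕ.<? k) xs)
  shift []       = refl
  shift (x ∷ xs) with toℕ x ℕ.<ᵇ k
  ... | true  = cong (suc x ∷_) (shift xs)
  ... | false = shift xs

mean-firstCups : ∀ {n k} (k≤n : suc k ℕ.≤ n) f → mean (firstCups n (suc k)) f ≡ 𝔼 (λ x → f (inject≤ x k≤n))
mean-firstCups {k = k} k≤n f = trans (cong (λ xs → mean xs f) (firstCups≡ k≤n))
  (trans (mean-map (λ x → inject≤ x k≤n) (allFin (suc k)) f) (mean-allFin (λ x → f (inject≤ x k≤n))))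

firstCups-nonempty : ∀ {n k} → suc k ℕ.≤ n → 1 ℕ.≤ length (firstCups n (suc k))
firstCups-nonempty k≤n = subst (λ xs → 1 ℕ.≤ length xs) (sym (firstCups≡ k≤n)) (s≤s z≤n)

cupPairs : ∀ n → ℕ → List (Fin n × Fin n)
cupPairs n k = cartesianProduct (firstCups n k) (firstCups n k)

mean-cupPairs : ∀ {n k} (k≤n : suc k ℕ.≤ n) f →
                mean (cupPairs n (suc k)) f ≡ 𝔼 (λ x → 𝔼 (λ y → f (inject≤ x k≤n , inject≤ y k≤n)))
mean-cupPairs {n} {k} k≤n f = trans (mean-product _,_ (firstCups n (suc k)) (firstCups n (suc k)) f (firstCups-nonempty k≤n) (firstCups-nonempty k≤n))
  (trans (mean-firstCups k≤n (λ x → mean (firstCups n (suc k)) (λ y → f (x , y))))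
    (𝔼-cong λ x → mean-firstCups k≤n (λ y → f (inject≤ x k≤n , y))))

phases : ℕ → ℕ → ℕ → List ℕ
phases m T zero    = []
phases m T (suc r) = replicate T (suc (suc r ℕ.+ m)) ++ phases m T r

schedule≡phases : ∀ m T r → schedule (suc (r ℕ.+ m)) (suc m) T ≡ phases m T r
schedule≡phases m T r = trans (cong (λ j → concatMap (λ i → replicate T (suc (r ℕ.+ m) ℕ.∸ i)) (upTo j)) (ℕ.m+n∸n≡m r m)) (go r)
  where
  go : ∀ r → concatMap (λ i → replicate T (suc (r ℕ.+ m) ℕ.∸ i)) (upTo r) ≡ phases m T r
  go zero    = refl
  go (suc r) = cong (replicate T (suc (suc r ℕ.+ m)) ++_) (begin
    concatMap (λ i → replicate T (suc (suc r ℕ.+ m) ℕ.∸ i)) (applyUpTo suc r)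
      ≡⟨ cong (concatMap (λ i → replicate T (suc (suc r ℕ.+ m) ℕ.∸ i))) (sym (List.map-upTo suc r)) ⟩
    concatMap (λ i → replicate T (suc (suc r ℕ.+ m) ℕ.∸ i)) (map suc (upTo r))
      ≡⟨ List.concatMap-map (λ i → replicate T (suc (suc r ℕ.+ m) ℕ.∸ i)) suc (upTo r) ⟩
    concatMap (λ i → replicate T (suc (r ℕ.+ m) ℕ.∸ i)) (upTo r)
      ≡⟨ go r ⟩
    phases m T r ∎)
    where open ≡-Reasoning

sequences-nonempty : ∀ {n} ks → (∀ {k} → k ∈ ks → 1 ℕ.≤ k × k ℕ.≤ n) → 1 ℕ.≤ length (sequences (map (cupPairs n) ks))
sequences-nonempty []           _     = s≤s z≤n
sequences-nonempty {n} (k ∷ ks) range with k | range (here refl)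
... | suc j | _ , k≤n = product-nonempty _∷_ (cupPairs n (suc j)) _
  (product-nonempty _,_ (firstCups n (suc j)) _ (firstCups-nonempty k≤n) (firstCups-nonempty k≤n)) (sequences-nonempty ks (range ∘ there))

∈-replicate⁻ : ∀ i {j k : ℕ} → j ∈ replicate i k → j ≡ k
∈-replicate⁻ (suc i) (here eq) = eq
∈-replicate⁻ (suc i) (there p) = ∈-replicate⁻ i p

phases-range : ∀ {n} m T r → suc (r ℕ.+ m) ℕ.≤ n → ∀ {k} → k ∈ phases m T r → 1 ℕ.≤ k × k ℕ.≤ n
phases-range m T (suc r) ≤n k∈ with ∈-++⁻ (replicate T (suc (suc r ℕ.+ m))) k∈
... | inj₂ k∈phases = phases-range m T r (ℕ.≤-trans (ℕ.n≤1+n _) ≤n) k∈phases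
... | inj₁ k∈block with ∈-replicate⁻ T k∈block
...   | refl = s≤s z≤n , ≤n

half≡½* : ∀ a → half a ≡ ½ * ⟦ a ⟧
half≡½* zero    = trans (half≡/2 0) (sym (cong (½ *_) ⟦0⟧))
half≡½* (suc a) = trans (half-suc a) (trans (cong (_+ ½) (half≡½* a)) (trans (factor ⟦ a ⟧) (cong (½ *_) (sym (⟦⟧-suc a)))))
  where
  factor : ∀ a → ½ * a + ½ ≡ ½ * (1ℚ + a)
  factor = solve-∀ ring

module _ {n} (X : ℕ → ScoreBased n) (m T : ℕ) where

  -- As `value`, for the cups as labelled by the filler, who drops the cup with
  -- the last label.
  labelledValue : ∀ r → (Fin (suc (r ℕ.+ m)) → Fin n) → ℕ → Vec ℕ n → ℚ
  labelledValue zero    ρ t f = 1/ₛ m * level X ρ f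
  labelledValue (suc r) ρ t f = run X ρ T t (labelledValue r (ρ ∘ inject₁) (T ℕ.+ t)) f

  run-cong-cups : ∀ {k} {ι ι′ : Fin (suc k) → Fin n} → (∀ x → ι x ≡ ι′ x) → ∀ φ i t f → run X ι i t φ f ≡ run X ι′ i t φ f
  run-cong-cups eq φ zero    t f = refl
  run-cong-cups {ι = ι} {ι′} eq φ (suc i) t f = 𝔼-cong λ x → 𝔼-cong λ y →
    trans (run-cong-cups eq φ i (suc t) (play₁ (X t) ι x y f))
      (cong₂ (λ a b → run X ι′ i (suc t) φ (turn (X t) a b f)) (eq x) (eq y))

  level-cong : ∀ {k} {ι ι′ : Fin (suc k) → Fin n} → (∀ x → ι x ≡ ι′ x) → ∀ f → level X ι f ≡ level X ι′ f
  level-cong eq f = cong ⟦_⟧ (sum-cong-≗ λ x → cong (lookup f) (eq x))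

  labelledValue-cong : ∀ r {ρ ρ′} → (∀ x → ρ x ≡ ρ′ x) → ∀ t f → labelledValue r ρ t f ≡ labelledValue r ρ′ t f
  labelledValue-cong zero    eq t f = cong (1/ₛ m *_) (level-cong eq f)
  labelledValue-cong (suc r) {ρ} eq t f = trans (run-cong-cups eq _ T t f)
    (run-cong X _ (labelledValue-cong r (eq ∘ inject₁) (T ℕ.+ t)) T t f)

  module _ (π : Permutation′ n) where

    label : ∀ {k} → k ℕ.≤ n → Fin k → Fin n
    label k≤n x = π ⟨$⟩ʳ inject≤ x k≤n

    choices : List ℕ → List (List (Fin n × Fin n))
    choices ks = sequences (map (cupPairs n) ks)

    mean-step : ∀ {k} ks (k≤n : suc k ℕ.≤ n) → 1 ℕ.≤ length (choices ks) → ∀ (φ : State n → ℚ) t f →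
                mean (choices (suc k ∷ ks)) (λ cs → φ (play X π t (Vec.map half f) cs)) ≡
                𝔼 λ x → 𝔼 λ y → mean (choices ks) (λ cs → φ (play X π (suc t) (Vec.map half (play₁ (X t) (label k≤n) x y f)) cs))
    mean-step {k} ks k≤n ne φ t f = trans
      (mean-product _∷_ (cupPairs n (suc k)) (choices ks) _
        (product-nonempty _,_ (firstCups n (suc k)) (firstCups n (suc k)) (firstCups-nonempty k≤n) (firstCups-nonempty k≤n)) ne)
      (trans (mean-cupPairs k≤n _) (𝔼-cong λ x → 𝔼-cong λ y →
        cong (λ s → mean (choices ks) (λ cs → φ (play X π (suc t) s cs))) (turn-half (X t) (label k≤n x) (label k≤n y) f)))

    mean-block : ∀ {k} i ks (k≤n : suc k ℕ.≤ n) → (∀ {j} → j ∈ ks → 1 ℕ.≤ j × j ℕ.≤ n) → ∀ (φ : State n → ℚ) t f →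
                 mean (choices (replicate i (suc k) ++ ks)) (λ cs → φ (play X π t (Vec.map half f) cs)) ≡
                 run X (label k≤n) i t (λ f′ → mean (choices ks) (λ cs → φ (play X π (i ℕ.+ t) (Vec.map half f′) cs))) f
    mean-block         zero    ks k≤n range φ t f = refl
    mean-block {k} (suc i) ks k≤n range φ t f = trans
      (mean-step (replicate i (suc k) ++ ks) k≤n (sequences-nonempty (replicate i (suc k) ++ ks) range′) φ t f)
      (𝔼-cong λ x → 𝔼-cong λ y → trans (mean-block i ks k≤n range φ (suc t) (play₁ (X t) (label k≤n) x y f))
        (cong (λ u → run X (label k≤n) i (suc t) (λ f′ → mean (choices ks) (λ cs → φ (play X π u (Vec.map half f′) cs)))
                       (play₁ (X t) (label k≤n) x y f)) (ℕ.+-suc i t)))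
      where
      range′ : ∀ {j} → j ∈ replicate i (suc k) ++ ks → 1 ℕ.≤ j × j ℕ.≤ n
      range′ j∈ with ∈-++⁻ (replicate i (suc k)) j∈
      ... | inj₂ j∈ks = range j∈ks
      ... | inj₁ j∈block rewrite ∈-replicate⁻ i j∈block = s≤s z≤n , k≤n

    averageFill-half : ∀ (m≤n : suc m ℕ.≤ n) f → averageFill (suc m) π (Vec.map half f) ≡ ½ * (1/ₛ m * level X (label m≤n) f)
    averageFill-half m≤n f = trans (mean-firstCups m≤n _) (trans (𝔼-cong λ x →
        trans (Vec.lookup-map (label m≤n x) half f) (half≡½* (lookup f (label m≤n x))))
      (trans (𝔼-* ½ (λ x → ⟦ lookup f (label m≤n x) ⟧)) (cong (½ *_) (trans (𝔼≡ (λ x → ⟦ lookup f (label m≤n x) ⟧)) (trans (cong (_* 1/ₛ m) (sumℚ-⟦⟧ (λ x → lookup f (label m≤n x))))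
        (*-comm (level X (label m≤n) f) (1/ₛ m)))))))

    mean-phases : ∀ r (k≤n : suc (r ℕ.+ m) ℕ.≤ n) t f →
                  mean (choices (phases m T r)) (λ cs → averageFill (suc m) π (play X π t (Vec.map half f) cs)) ≡
                  ½ * labelledValue r (label k≤n) t f
    mean-phases zero    k≤n t f = trans (mean-const (averageFill (suc m) π (Vec.map half f)) (choices []) (s≤s z≤n)) (averageFill-half k≤n f)
    mean-phases (suc r) k≤n t f = trans (mean-block T (phases m T r) k≤n (phases-range m T r k′≤n) (averageFill (suc m) π) t f)
      (trans (run-cong X _ (λ f′ → trans (mean-phases r k′≤n (T ℕ.+ t) f′)
          (cong (½ *_) (labelledValue-cong r (λ x → cong (π ⟨$⟩ʳ_) (inject≤-inject₁ x)) (T ℕ.+ t) f′))) T t f)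
        (run-* X _ ½ _ T t f))
      where
      k′≤n = ℕ.≤-trans (ℕ.n≤1+n (suc (r ℕ.+ m))) k≤n
      inject≤-inject₁ : ∀ x → inject≤ x k′≤n ≡ inject≤ (inject₁ x) k≤n
      inject≤-inject₁ x = Fin.toℕ-injective (trans (Fin.toℕ-inject≤ x k′≤n)
        (sym (trans (Fin.toℕ-inject≤ (inject₁ x) k≤n) (Fin.toℕ-inject₁ x))))

-- Random permutations

insertFirst : ∀ {k n} → Fin (suc n) → (Fin k → Fin n) → Fin (suc k) → Fin (suc n)
insertFirst j ρ zero    = j
insertFirst j ρ (suc x) = punchIn j (ρ x)

insertLast : ∀ {k n} → Fin (suc n) → (Fin k → Fin n) → Fin (suc k) → Fin (suc n)
insertLast {zero}  j ρ zero    = j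
insertLast {suc k} j ρ zero    = punchIn j (ρ zero)
insertLast {suc k} j ρ (suc x) = insertLast j (ρ ∘ suc) x

insertLast-inject₁ : ∀ {k n} j (ρ : Fin k → Fin n) x → insertLast j ρ (inject₁ x) ≡ punchIn j (ρ x)
insertLast-inject₁ {suc k} j ρ zero    = refl
insertLast-inject₁ {suc k} j ρ (suc x) = insertLast-inject₁ j (ρ ∘ suc) x

-- The position of i among the elements other than punchIn i j: choosing
-- punchIn i j first and i second amounts to choosing i first and then j.
twin : ∀ {n} → Fin (suc n) → Fin n → Fin n
twin {zero}  zero    ()
twin {suc n} zero    j       = zero
twin         (suc i) zero    = i
twin         (suc i) (suc j) = suc (twin i j)

punchIn-twin : ∀ {n} (i : Fin (suc n)) j → punchIn (punchIn i j) (twin i j) ≡ i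
punchIn-twin {zero}  zero    ()
punchIn-twin {suc n} zero    j       = refl
punchIn-twin         (suc i) zero    = refl
punchIn-twin         (suc i) (suc j) = cong suc (punchIn-twin i j)

punchIn-punchIn : ∀ {n} (i : Fin (suc (suc n))) j (x : Fin n) →
                  punchIn i (punchIn j x) ≡ punchIn (punchIn i j) (punchIn (twin i j) x)
punchIn-punchIn zero    j       x       = refl
punchIn-punchIn (suc i) zero    x       = refl
punchIn-punchIn (suc i) (suc j) zero    = refl
punchIn-punchIn (suc i) (suc j) (suc x) = cong suc (punchIn-punchIn i j x)

-- A pair (i , j) encodes the two distinct elements `i` and `punchIn i j` in this order, and the
-- reindexing exchanges them. In the induction, the pairs starting with zero trade places with those
-- ending in zero.
sumℚ-twin : ∀ n (R : Fin (suc n) → Fin n → ℚ) →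
            ℚΣ.sum (λ i → ℚΣ.sum (λ j → R (punchIn i j) (twin i j))) ≡ ℚΣ.sum (λ i → ℚΣ.sum (R i))
sumℚ-twin zero    R = refl
sumℚ-twin (suc n) R = begin
  a + ℚΣ.sum (λ i → R zero i + ℚΣ.sum (λ j → R (suc (punchIn i j)) (suc (twin i j))))
    ≡⟨ cong (λ z → a + z) (trans (ℚΣ.∑-distrib-+ (R zero) (λ i → ℚΣ.sum (λ j → R (suc (punchIn i j)) (suc (twin i j))))) (cong (λ z → b + z) (sumℚ-twin n (λ i j → R (suc i) (suc j))))) ⟩
  a + (b + c)
    ≡⟨ rearranged a b c ⟩
  b + (a + c)
    ≡⟨ cong (λ z → b + z) (sym (ℚΣ.∑-distrib-+ (λ i → R (suc i) zero) (λ i → ℚΣ.sum (λ j → R (suc i) (suc j))))) ⟩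
  b + ℚΣ.sum (λ i → ℚΣ.sum (R (suc i))) ∎
  where
  open ≡-Reasoning
  a = ℚΣ.sum (λ j → R (suc j) zero)
  b = ℚΣ.sum (R zero)
  c = ℚΣ.sum (λ i → ℚΣ.sum (λ j → R (suc i) (suc j)))
  rearranged : ∀ a b c → a + (b + c) ≡ b + (a + c)
  rearranged = solve-∀ ring

𝔼-twin : ∀ {n} (R : Fin (suc (suc n)) → Fin (suc n) → ℚ) →
         𝔼 (λ i → 𝔼 (λ j → R (punchIn i j) (twin i j))) ≡ 𝔼 (λ i → 𝔼 (λ j → R i j))
𝔼-twin {n} R = trans (unfold (λ i j → R (punchIn i j) (twin i j))) (trans (cong (λ z → z * 1/ₛ n * 1/ₛ (suc n)) (sumℚ-twin (suc n) R)) (sym (unfold R)))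
  where
  unfold : ∀ (R : Fin (suc (suc n)) → Fin (suc n) → ℚ) →
           𝔼 (λ i → 𝔼 (λ j → R i j)) ≡ ℚΣ.sum (λ i → ℚΣ.sum (R i)) * 1/ₛ n * 1/ₛ (suc n)
  unfold R = trans (𝔼≡ (λ i → 𝔼 (λ j → R i j))) (cong (_* 1/ₛ (suc n))
    (trans (ℚΣ.sum-cong-≗ λ i → 𝔼≡ (R i)) (sym (ℚΣ.*-distribʳ-sum (1/ₛ n) (λ i → ℚΣ.sum (R i))))))

permutations-nonempty : ∀ n → 1 ℕ.≤ length (permutations n)
concatMap≡product : ∀ {A B C : Set} (h : A → B → C) xs ys → concatMap (λ x → map (h x) ys) xs ≡ cartesianProductWith h xs ys
concatMap≡product h []       ys = refl
concatMap≡product h (x ∷ xs) ys = cong (map (h x) ys ++_) (concatMap≡product h xs ys)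

permutations-nonempty zero    = s≤s z≤n
permutations-nonempty (suc n) = subst (λ πs → 1 ℕ.≤ length πs) (sym (concatMap≡product (insert zero) (allFin (suc n)) (permutations n)))
  (product-nonempty (insert zero) (allFin (suc n)) (permutations n) (s≤s z≤n) (permutations-nonempty n))

-- Labellings are often equal only pointwise; this condition takes the place of function
-- extensionality.
Extensional : ∀ {k n} → ((Fin k → Fin n) → ℚ) → Set
Extensional G = ∀ {ρ ρ′} → (∀ x → ρ x ≡ ρ′ x) → G ρ ≡ G ρ′

permMean : ∀ n → ((Fin n → Fin n) → ℚ) → ℚ
permMean n G = mean (permutations n) (λ π → G (π ⟨$⟩ʳ_))

permMean-cong : ∀ n G H → (∀ (π : Permutation′ n) → G (π ⟨$⟩ʳ_) ≡ H (π ⟨$⟩ʳ_)) → permMean n G ≡ permMean n H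
permMean-cong n G H eq = mean-cong (permutations n) eq

permMean-first : ∀ n G → Extensional G → permMean (suc n) G ≡ 𝔼 λ j → permMean n (λ ρ → G (insertFirst j ρ))
permMean-first n G ext = begin
  mean (permutations (suc n)) F
    ≡⟨ cong (λ πs → mean πs F) (concatMap≡product (insert zero) (allFin (suc n)) (permutations n)) ⟩
  mean (cartesianProductWith (insert zero) (allFin (suc n)) (permutations n)) F
    ≡⟨ mean-product (insert zero) (allFin (suc n)) (permutations n) F (s≤s z≤n) (permutations-nonempty n) ⟩
  mean (allFin (suc n)) (λ j → mean (permutations n) (λ π → F (insert zero j π)))
    ≡⟨ mean-allFin (λ j → mean (permutations n) (λ π → F (insert zero j π))) ⟩
  𝔼 (λ j → mean (permutations n) (λ π → F (insert zero j π)))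
    ≡⟨ 𝔼-cong (λ j → mean-cong (permutations n) (λ π → ext (inserted j π))) ⟩
  𝔼 (λ j → permMean n (λ ρ → G (insertFirst j ρ))) ∎
  where
  open ≡-Reasoning
  F : Permutation′ (suc n) → ℚ
  F π = G (π ⟨$⟩ʳ_)
  inserted : ∀ j (π : Permutation′ n) x → insert zero j π ⟨$⟩ʳ x ≡ insertFirst j (π ⟨$⟩ʳ_) x
  inserted j π zero    = refl
  inserted j π (suc x) = insert-punchIn zero j π x

insertLast-cong : ∀ {k n} (j : Fin (suc n)) {ρ ρ′ : Fin k → Fin n} → (∀ x → ρ x ≡ ρ′ x) → ∀ x → insertLast j ρ x ≡ insertLast j ρ′ x
insertLast-cong {zero}  j eq zero    = refl
insertLast-cong {suc k} j eq zero    = cong (punchIn j) (eq zero)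
insertLast-cong {suc k} j eq (suc x) = insertLast-cong j (eq ∘ suc) x

insertFirst-cong : ∀ {k n} (j : Fin (suc n)) {ρ ρ′ : Fin k → Fin n} → (∀ x → ρ x ≡ ρ′ x) → ∀ x → insertFirst j ρ x ≡ insertFirst j ρ′ x
insertFirst-cong j eq zero    = refl
insertFirst-cong j eq (suc x) = cong (punchIn j) (eq x)

insertFirst-insertLast : ∀ {k n} (i : Fin (suc (suc n))) j (ρ : Fin k → Fin n) x →
                         insertFirst i (insertLast j ρ) x ≡ insertLast (punchIn i j) (insertFirst (twin i j) ρ) x
insertFirst-insertLast i j ρ zero    = sym (punchIn-twin i j)
insertFirst-insertLast i j ρ (suc x) = later ρ x
  where
  later : ∀ {k} (ρ : Fin k → Fin _) x → punchIn i (insertLast j ρ x) ≡ insertLast (punchIn i j) (λ x → punchIn (twin i j) (ρ x)) x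
  later {zero}  ρ zero    = refl
  later {suc k} ρ zero    = punchIn-punchIn i j (ρ zero)
  later {suc k} ρ (suc x) = later (ρ ∘ suc) x

-- The enumeration of permutations draws the image of the first label first, whereas the filler
-- gives up the last label first. The induction draws the first image and then the last one, and
-- `𝔼-twin` exchanges the two draws.
permMean-last : ∀ n G → Extensional G → permMean (suc n) G ≡ 𝔼 λ j → permMean n (λ ρ → G (insertLast j ρ))
permMean-last zero    G ext = trans (permMean-first zero G ext)
  (𝔼-cong λ j → permMean-cong zero (λ ρ → G (insertFirst j ρ)) (λ ρ → G (insertLast j ρ)) λ π → ext λ { zero → refl })
permMean-last (suc n) G ext = begin
  permMean (suc (suc n)) G
    ≡⟨ permMean-first (suc n) G ext ⟩
  𝔼 (λ i → permMean (suc n) (λ σ → G (insertFirst i σ)))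
    ≡⟨ 𝔼-cong (λ i → permMean-last n (λ σ → G (insertFirst i σ)) (λ eq → ext (insertFirst-cong i eq))) ⟩
  𝔼 (λ i → 𝔼 (λ j → permMean n (λ ρ → G (insertFirst i (insertLast j ρ)))))
    ≡⟨ 𝔼-cong (λ i → 𝔼-cong λ j → permMean-cong n (λ ρ → G (insertFirst i (insertLast j ρ)))
         (λ ρ → G (insertLast (punchIn i j) (insertFirst (twin i j) ρ))) λ π → ext (insertFirst-insertLast i j (π ⟨$⟩ʳ_))) ⟩
  𝔼 (λ i → 𝔼 (λ j → permMean n (λ ρ → G (insertLast (punchIn i j) (insertFirst (twin i j) ρ)))))
    ≡⟨ 𝔼-twin (λ a b → permMean n (λ ρ → G (insertLast a (insertFirst b ρ)))) ⟩
  𝔼 (λ a → 𝔼 (λ b → permMean n (λ ρ → G (insertLast a (insertFirst b ρ)))))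
    ≡⟨ 𝔼-cong (λ a → permMean-first n (λ σ → G (insertLast a σ)) (λ eq → ext (insertLast-cong a eq))) ⟨
  𝔼 (λ a → permMean (suc n) (λ σ → G (insertLast a σ))) ∎
  where open ≡-Reasoning

𝔼-permute : ∀ {k} (φ : Fin (suc k) → ℚ) (π : Permutation′ (suc k)) → 𝔼 (λ x → φ (π ⟨$⟩ʳ x)) ≡ 𝔼 φ
𝔼-permute {k} φ π = trans (𝔼≡ (λ x → φ (π ⟨$⟩ʳ x))) (trans (cong (_* 1/ₛ k) (sym (ℚΣ.sum-permute φ π))) (sym (𝔼≡ φ)))

module _ {n} (X : ℕ → ScoreBased n) where

  -- The filler draws uniformly from the active cups, so a phase does not depend on how they are
  -- labelled.
  run-permute : ∀ {k} (ι : Fin (suc k) → Fin n) (π : Permutation′ (suc k)) φ i t f →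
                run X (ι ∘ (π ⟨$⟩ʳ_)) i t φ f ≡ run X ι i t φ f
  run-permute ι π φ zero    t f = refl
  run-permute ι π φ (suc i) t f = begin
    𝔼 (λ x → 𝔼 (λ y → run X (ι ∘ (π ⟨$⟩ʳ_)) i (suc t) φ (next (π ⟨$⟩ʳ x) (π ⟨$⟩ʳ y))))
      ≡⟨ 𝔼-cong (λ x → 𝔼-cong λ y → run-permute ι π φ i (suc t) (next (π ⟨$⟩ʳ x) (π ⟨$⟩ʳ y))) ⟩
    𝔼 (λ x → 𝔼 (λ y → run X ι i (suc t) φ (next (π ⟨$⟩ʳ x) (π ⟨$⟩ʳ y))))
      ≡⟨ 𝔼-cong (λ x → 𝔼-permute (λ y → run X ι i (suc t) φ (next (π ⟨$⟩ʳ x) y)) π) ⟩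
    𝔼 (λ x → 𝔼 (λ y → run X ι i (suc t) φ (next (π ⟨$⟩ʳ x) y)))
      ≡⟨ 𝔼-permute (λ x → 𝔼 (λ y → run X ι i (suc t) φ (next x y))) π ⟩
    𝔼 (λ x → 𝔼 (λ y → run X ι i (suc t) φ (next x y))) ∎
    where
    open ≡-Reasoning
    next : Fin _ → Fin _ → Vec ℕ n
    next x y = play₁ (X t) ι x y f

  run-mean : ∀ {k} (ι : Fin (suc k) → Fin n) {A : Set} (xs : List A) (φ : A → Vec ℕ n → ℚ) i t f →
             mean xs (λ a → run X ι i t (φ a) f) ≡ run X ι i t (λ f → mean xs (λ a → φ a f)) f
  run-mean ι []       φ i t f = sym (run-const X ι 0ℚ i t f)
  run-mean ι (x ∷ xs) φ i t f = trans (*-comm (listSum (x ∷ xs) (λ a → run X ι i t (φ a) f)) r)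
    (trans (cong (r *_) (sums (x ∷ xs)))
      (trans (sym (run-* X ι r (λ f → listSum (x ∷ xs) (λ a → φ a f)) i t f))
        (run-cong X ι (λ f → *-comm r (listSum (x ∷ xs) (λ a → φ a f))) i t f)))
    where
    r = (+ 1) / suc (length xs)
    sums : ∀ ys → listSum ys (λ a → run X ι i t (φ a) f) ≡ run X ι i t (λ f → listSum ys (λ a → φ a f)) f
    sums []       = sym (run-const X ι 0ℚ i t f)
    sums (y ∷ ys) = trans (cong (λ z → run X ι i t (φ y) f + z) (sums ys)) (sym (run-+ X ι (φ y) (λ f → listSum ys (λ a → φ a f)) i t f))

  -- The random labelling is fixed before the game, but a phase ignores the labels within its set of
  -- cups. Hence the image of the last label can be drawn separately, as the dropped cup, and
  -- `run-𝔼` moves this draw behind the phase.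
  permMean-labelledValue : ∀ m T r (ι : Fin (suc (r ℕ.+ m)) → Fin n) t f →
                           permMean (suc (r ℕ.+ m)) (λ σ → labelledValue X m T r (ι ∘ σ) t f) ≡ value X m T r ι t f
  permMean-labelledValue m T zero    ι t f = trans
    (permMean-cong (suc m) (λ σ → 1/ₛ m * level X (ι ∘ σ) f) (λ _ → 1/ₛ m * level X ι f)
      λ π → cong (λ a → 1/ₛ m * ⟦ a ⟧) (sym (sum-permute (λ x → lookup f (ι x)) π)))
    (mean-const (1/ₛ m * level X ι f) (permutations (suc m)) (permutations-nonempty (suc m)))
  permMean-labelledValue m T (suc r) ι t f = begin
    permMean (suc (suc r ℕ.+ m)) (λ σ → labelledValue X m T (suc r) (ι ∘ σ) t f)
      ≡⟨ permMean-cong (suc (suc r ℕ.+ m)) (λ σ → labelledValue X m T (suc r) (ι ∘ σ) t f)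
           (λ σ → run X ι T t (LV (ι ∘ σ ∘ inject₁)) f) (λ π → run-permute ι π (LV (ι ∘ (π ⟨$⟩ʳ_) ∘ inject₁)) T t f) ⟩
    permMean (suc (suc r ℕ.+ m)) (λ σ → run X ι T t (LV (ι ∘ σ ∘ inject₁)) f)
      ≡⟨ permMean-last (suc (r ℕ.+ m)) (λ σ → run X ι T t (LV (ι ∘ σ ∘ inject₁)) f) (λ eq → run-cong X ι (LV-cong (λ x → cong ι (eq (inject₁ x)))) T t f) ⟩
    𝔼 (λ j → permMean (suc (r ℕ.+ m)) (λ ρ → run X ι T t (LV (ι ∘ insertLast j ρ ∘ inject₁)) f))
      ≡⟨ 𝔼-cong (λ j → permMean-cong (suc (r ℕ.+ m)) (λ ρ → run X ι T t (LV (ι ∘ insertLast j ρ ∘ inject₁)) f)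
           (λ ρ → run X ι T t (LV (without ι j ∘ ρ)) f)
           (λ π → run-cong X ι (LV-cong (λ x → cong ι (insertLast-inject₁ j (π ⟨$⟩ʳ_) x))) T t f)) ⟩
    𝔼 (λ j → permMean (suc (r ℕ.+ m)) (λ ρ → run X ι T t (LV (without ι j ∘ ρ)) f))
      ≡⟨ 𝔼-cong (λ j → trans (run-mean ι (permutations (suc (r ℕ.+ m))) (λ π → LV (without ι j ∘ (π ⟨$⟩ʳ_))) T t f)
           (run-cong X ι (permMean-labelledValue m T r (without ι j) (T ℕ.+ t)) T t f)) ⟩
    𝔼 (λ j → run X ι T t (value X m T r (without ι j) (T ℕ.+ t)) f)
      ≡⟨ run-𝔼 X ι (λ j → value X m T r (without ι j) (T ℕ.+ t)) T t f ⟨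
    value X m T (suc r) ι t f ∎
    where
    open ≡-Reasoning
    LV : (Fin (suc (r ℕ.+ m)) → Fin n) → Vec ℕ n → ℚ
    LV ρ = labelledValue X m T r ρ (T ℕ.+ t)
    LV-cong : ∀ {ρ ρ′} → (∀ x → ρ x ≡ ρ′ x) → ∀ f → LV ρ f ≡ LV ρ′ f
    LV-cong eq f = labelledValue-cong X m T r eq (T ℕ.+ t) f

expectedAverageFill≡ : ∀ m T r (X : DynamicScoreBased (suc (r ℕ.+ m))) →
                       expectedAverageFill X (suc m) T ≡ ½ * value X m T r (λ x → x) 0 (Vec.replicate _ 0)
expectedAverageFill≡ m T r X = begin
  mean (cartesianProduct (permutations n) (fillerChoices n (suc m) T)) outcome
    ≡⟨ cong (λ css → mean (cartesianProduct (permutations n) css) outcome) (cong (λ ks → sequences (map (cupPairs n) ks)) (schedule≡phases m T r)) ⟩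
  mean (cartesianProduct (permutations n) css) outcome
    ≡⟨ mean-product _,_ (permutations n) css outcome (permutations-nonempty n)
         (sequences-nonempty (phases m T r) (phases-range m T r ℕ.≤-refl)) ⟩
  mean (permutations n) (λ π → mean css (λ cs → outcome (π , cs)))
    ≡⟨ mean-cong (permutations n) (λ π → trans
         (cong (λ s → mean css (λ cs → averageFill (suc m) π (play X π 0 s cs))) empty)
         (trans (mean-phases X m T π r ℕ.≤-refl 0 zeros)
           (cong (½ *_) (labelledValue-cong X m T r (λ x → cong (π ⟨$⟩ʳ_) (Fin.inject≤-refl x ℕ.≤-refl)) 0 zeros)))) ⟩
  mean (permutations n) (λ π → ½ * labelledValue X m T r (π ⟨$⟩ʳ_) 0 zeros)
    ≡⟨ mean-* ½ (permutations n) (λ π → labelledValue X m T r (π ⟨$⟩ʳ_) 0 zeros) ⟩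
  ½ * permMean n (λ σ → labelledValue X m T r σ 0 zeros)
    ≡⟨ cong (½ *_) (permMean-labelledValue X m T r (λ x → x) 0 zeros) ⟩
  ½ * value X m T r (λ x → x) 0 zeros ∎
  where
  open ≡-Reasoning
  n = suc (r ℕ.+ m)
  zeros : Vec ℕ n
  zeros = Vec.replicate n 0
  css = sequences (map (cupPairs n) (phases m T r))
  outcome : Permutation′ n × List (Fin n × Fin n) → ℚ
  outcome (π , cs) = averageFill (suc m) π (play X π 0 (Vec.replicate n 0ℚ) cs)
  empty : Vec.replicate n 0ℚ ≡ Vec.map half zeros
  empty = sym (trans (Vec.map-replicate half 0 n) (cong (Vec.replicate n) (half≡/2 0)))

-- Harmonic sums and the logarithm

1/ₛ-antitone : ∀ {p q} → p ℕ.≤ q → 1/ₛ q ≤ 1/ₛ p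
1/ₛ-antitone {p} {q} p≤q = ⟦⟧*-cancel-≤ q (≤-trans (≤-reflexive (trans (⟦⟧*1/ₛ q) (sym (⟦⟧*1/ₛ p))))
  (*-monoʳ-≤-nonNeg (1/ₛ p) {{nonNegative (0≤1/ₛ p)}} (⟦⟧-mono (s≤s p≤q))))

2^e*[2+m]≡2+ : ∀ e m → let a = 2 ℕ.^ e ℕ.* suc (suc m) in a ≡ suc (suc (a ℕ.∸ suc (suc m) ℕ.+ m))
2^e*[2+m]≡2+ e m = trans (sym (ℕ.m∸n+n≡m m+2≤a)) (trans (ℕ.+-suc r (suc m)) (cong suc (ℕ.+-suc r m)))
  where
  a = 2 ℕ.^ e ℕ.* suc (suc m)
  r = a ℕ.∸ suc (suc m)
  m+2≤a : suc (suc m) ℕ.≤ a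
  m+2≤a = subst (ℕ._≤ a) (ℕ.*-identityˡ (suc (suc m))) (ℕ.*-monoˡ-≤ (suc (suc m)) (ℕ.m^n>0 2 e))

module _ {n} (X : ℕ → ScoreBased n) (m T : ℕ) where

  private
    h = harmonic X m T

  harmonic-+ : ∀ r a {q} → r ℕ.+ a ℕ.+ m ℕ.≤ q → h r + ⟦ a ⟧ * 1/ₛ q ≤ h (r ℕ.+ a)
  harmonic-+ r zero    {q} ≤q = ≤-reflexive (trans (cong (λ z → h r + z * 1/ₛ q) ⟦0⟧)
    (trans (vanish (h r) (1/ₛ q)) (cong h (sym (ℕ.+-identityʳ r)))))
    where
    vanish : ∀ a b → a + 0ℚ * b ≡ a
    vanish = solve-∀ ring
  harmonic-+ r (suc a) {q} ≤q = subst (λ s → h r + ⟦ suc a ⟧ * 1/ₛ q ≤ h s) (sym (ℕ.+-suc r a))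
    (≤-trans (≤-reflexive (trans (cong (λ z → h r + z * 1/ₛ q) (⟦⟧-suc a)) (expand (h r) ⟦ a ⟧ (1/ₛ q))))
      (+-mono-≤ (harmonic-+ r a (ℕ.≤-trans (ℕ.n≤1+n _) ≤q′)) (1/ₛ-antitone ≤q′)))
    where
    ≤q′ : suc (r ℕ.+ a) ℕ.+ m ℕ.≤ q
    ≤q′ = subst (λ s → s ℕ.+ m ℕ.≤ q) (ℕ.+-suc r a) ≤q
    expand : ∀ h a u → h + (1ℚ + a) * u ≡ h + a * u + u
    expand = solve-∀ ring

  harmonic-mono : ∀ {r s} → r ℕ.≤ s → h r ≤ h s
  harmonic-mono {r} {s} r≤s = subst (λ s → h r ≤ h s) (ℕ.m+[n∸m]≡n r≤s)
    (≤-trans (subst (_≤ h r + ⟦ s ℕ.∸ r ⟧ * 1/ₛ _) (+-identityʳ (h r)) (+-monoʳ-≤ (h r) (0≤* (0≤⟦⟧ (s ℕ.∸ r)) (0≤1/ₛ _))))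
      (harmonic-+ r (s ℕ.∸ r) ℕ.≤-refl))

  -- Each doubling of the number of terms adds at least one half.
  harmonic-doubling : ∀ e r → 2 ℕ.^ e ℕ.* suc (suc m) ≡ suc (suc (r ℕ.+ m)) → ⟦ e ⟧ ≤ 2ℚ * h r
  harmonic-doubling zero    r eq = subst (_≤ 2ℚ * h r) (sym ⟦0⟧) (0≤* 0≤2ℚ (harmonic-mono (z≤n {r})))
  harmonic-doubling (suc e) r eq = subst (λ s → ⟦ suc e ⟧ ≤ 2ℚ * h s) r≡
    (≤-trans (≤-trans (≤-reflexive (trans (⟦⟧-suc e) (+-comm 1ℚ ⟦ e ⟧))) (+-mono-≤ (harmonic-doubling e r₀ a≡) half-more))
      (≤-trans (≤-reflexive (sym (*-distribˡ-+ 2ℚ (h r₀) (⟦ a ⟧ * 1/ₛ q)))) (*-mono-≤ˡ 0≤2ℚ (harmonic-+ r₀ a ℕ.≤-refl))))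
    where
    a = 2 ℕ.^ e ℕ.* suc (suc m)
    r₀ = a ℕ.∸ suc (suc m)
    q = r₀ ℕ.+ a ℕ.+ m
    a≡ : a ≡ suc (suc (r₀ ℕ.+ m))
    a≡ = 2^e*[2+m]≡2+ e m
    twice : 2 ℕ.^ suc e ℕ.* suc (suc m) ≡ a ℕ.+ a
    twice = rearranged (2 ℕ.^ e) (suc (suc m))
      where
      rearranged : ∀ p s → 2 ℕ.* p ℕ.* s ≡ p ℕ.* s ℕ.+ p ℕ.* s
      rearranged = solveℕ
    a+a≡ : a ℕ.+ a ≡ suc (suc q)
    a+a≡ = trans (cong (ℕ._+ a) a≡) (rearranged r₀ a m)
      where
      rearranged : ∀ r a m → suc (suc (r ℕ.+ m)) ℕ.+ a ≡ suc (suc (r ℕ.+ a ℕ.+ m))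
      rearranged = solveℕ
    r≡ : r₀ ℕ.+ a ≡ r
    r≡ = ℕ.+-cancelʳ-≡ m _ _ (ℕ.suc-injective (ℕ.suc-injective (trans (sym a+a≡) (trans (sym twice) eq))))
    half-more : 1ℚ ≤ 2ℚ * (⟦ a ⟧ * 1/ₛ q)
    half-more = ≤-trans (≤-reflexive (sym (⟦⟧*1/ₛ q)))
      (≤-trans (*-monoʳ-≤-nonNeg (1/ₛ q) {{nonNegative (0≤1/ₛ q)}} (⟦⟧-mono (ℕ.≤-trans (ℕ.n≤1+n (suc q)) (ℕ.≤-reflexive (sym a+a≡)))))
        (≤-reflexive (trans (cong (_* 1/ₛ q) (⟦⟧-+ a a)) (double ⟦ a ⟧ (1/ₛ q)))))
      where
      double : ∀ a u → (a + a) * u ≡ 2ℚ * (a * u)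
      double = solve-∀ ring

  harmonic-≥ : ∀ e r → 2 ℕ.^ e ℕ.* suc (suc m) ℕ.≤ suc (suc (r ℕ.+ m)) → ⟦ e ⟧ ≤ 2ℚ * h r
  harmonic-≥ e r ≤r = ≤-trans (harmonic-doubling e r₀ a≡) (*-mono-≤ˡ 0≤2ℚ (harmonic-mono
    (ℕ.+-cancelʳ-≤ m r₀ r (ℕ.≤-pred (ℕ.≤-pred (ℕ.≤-trans (ℕ.≤-reflexive (sym a≡)) ≤r))))))
    where
    a = 2 ℕ.^ e ℕ.* suc (suc m)
    r₀ = a ℕ.∸ suc (suc m)
    a≡ : a ≡ suc (suc (r₀ ℕ.+ m))
    a≡ = 2^e*[2+m]≡2+ e m

⌈log₂⌉≤ : ∀ {n} e → n ℕ.≤ 2 ℕ.^ e → ⌈log₂ n ⌉ ℕ.≤ e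
⌈log₂⌉≤ {n} e n≤ = ℕ.≤-trans (⌈log₂⌉-mono-≤ n≤) (ℕ.≤-reflexive (⌈log₂2^n⌉≡n e))

-- Since `q` is below n^(2/3), the ratio n / q exceeds n^(1/3), which leaves room for about a third
-- of log n doublings. If they did not fit, `4p≤n` would absorb the `+ 2` and give n < 2 * p * q;
-- cubing this and using q^3 < n^2 gives n ≤ 8 * p^3, against the choice of `e`.
doublings-fit : ∀ {n} q e → 3 ℕ.* e ℕ.+ 4 ℕ.≤ ⌈log₂ n ⌉ → q ℕ.^ 3 ℕ.< n ℕ.^ 2 → 2 ℕ.^ e ℕ.* suc (suc q) ℕ.≤ n
doublings-fit {n} q e 3e+4≤ q³<n² = ℕ.≮⇒≥ λ n< → ℕ.<⇒≱ (too-small (n<2pq n<)) 3e+4≤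
  where
  p = 2 ℕ.^ e
  4p≤n : 4 ℕ.* p ℕ.≤ n
  4p≤n = ℕ.≮⇒≥ λ n<4p → ℕ.<⇒≱ (ℕ.≤-<-trans (⌈log₂⌉≤ (2 ℕ.+ e) (ℕ.≤-trans (ℕ.<⇒≤ n<4p) (ℕ.≤-reflexive (ℕ.*-assoc 2 2 p))))
    (ℕ.≤-trans (ℕ.≤-reflexive (rearranged e)) (ℕ.m≤m+n (e ℕ.+ 3) (2 ℕ.* e ℕ.+ 1)))) (subst (ℕ._≤ ⌈log₂ n ⌉) (split e) 3e+4≤)
    where
    rearranged : ∀ e → suc (2 ℕ.+ e) ≡ e ℕ.+ 3
    rearranged = solveℕ
    split : ∀ e → 3 ℕ.* e ℕ.+ 4 ≡ e ℕ.+ 3 ℕ.+ (2 ℕ.* e ℕ.+ 1)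
    split = solveℕ
  n<2pq : n ℕ.< p ℕ.* suc (suc q) → n ℕ.< 2 ℕ.* p ℕ.* q
  n<2pq n< = ℕ.+-cancelˡ-< n n (2 ℕ.* p ℕ.* q) (ℕ.≤-trans (ℕ.+-mono-< n< n<)
    (ℕ.≤-trans (ℕ.≤-reflexive (rearranged p q)) (ℕ.+-monoˡ-≤ (2 ℕ.* p ℕ.* q) 4p≤n)))
    where
    rearranged : ∀ p q → p ℕ.* suc (suc q) ℕ.+ p ℕ.* suc (suc q) ≡ 4 ℕ.* p ℕ.+ 2 ℕ.* p ℕ.* q
    rearranged = solveℕ
  too-small : n ℕ.< 2 ℕ.* p ℕ.* q → ⌈log₂ n ⌉ ℕ.< 3 ℕ.* e ℕ.+ 4
  too-small n< = ℕ.≤-trans (s≤s (⌈log₂⌉≤ (3 ℕ.* e ℕ.+ 3) (ℕ.≤-trans n≤ (ℕ.≤-reflexive (sym power))))) (ℕ.≤-reflexive (sym (ℕ.+-suc (3 ℕ.* e) 3)))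
    where
    power : 2 ℕ.^ (3 ℕ.* e ℕ.+ 3) ≡ p ℕ.^ 3 ℕ.* 8
    power = trans (ℕ.^-distribˡ-+-* 2 (3 ℕ.* e) 3) (cong (ℕ._* 8) (trans (cong (2 ℕ.^_) (ℕ.*-comm 3 e)) (sym (ℕ.^-*-assoc 2 e 3))))
    n³≤ : n ℕ.^ 2 ℕ.* n ℕ.≤ n ℕ.^ 2 ℕ.* (p ℕ.^ 3 ℕ.* 8)
    n³≤ = ℕ.≤-trans (ℕ.≤-reflexive (cube n)) (ℕ.≤-trans (ℕ.^-monoˡ-≤ 3 (ℕ.<⇒≤ n<))
      (ℕ.≤-trans (ℕ.≤-reflexive (expand p q)) (ℕ.*-monoˡ-≤ (p ℕ.^ 3 ℕ.* 8) (ℕ.<⇒≤ q³<n²))))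
      where
      cube : ∀ n → n ℕ.* (n ℕ.* 1) ℕ.* n ≡ n ℕ.* (n ℕ.* (n ℕ.* 1))
      cube = solveℕ
      expand : ∀ p q → (2 ℕ.* p ℕ.* q) ℕ.* ((2 ℕ.* p ℕ.* q) ℕ.* ((2 ℕ.* p ℕ.* q) ℕ.* 1)) ≡
               (q ℕ.* (q ℕ.* (q ℕ.* 1))) ℕ.* ((p ℕ.* (p ℕ.* (p ℕ.* 1))) ℕ.* 8)
      expand = solveℕ
    n≤ : n ℕ.≤ p ℕ.^ 3 ℕ.* 8
    n≤ = ℕ.*-cancelˡ-≤ (n ℕ.^ 2) {{ℕ.>-nonZero (ℕ.≤-<-trans z≤n q³<n²)}} n³≤

windowLength : ℕ → ℕ
windowLength n = suc (n ℕ.* (n ℕ.* n))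

-- Room for n * n times as many windows as there are ways to play one of them,
-- where n * n bounds the totals for which wasted steps are needed.
phaseLength : ℕ → ℕ
phaseLength n = n ℕ.+ ((n ℕ.* n) ℕ.* (n ℕ.* n) ℕ.^ windowLength n) ℕ.* windowLength n

-- The constant is 1 / (2 * 64 * 2 * 9): half units, the factor of `value-≥`, a harmonic gain of one
-- half per doubling, and at least a ninth of the logarithm as the number of doublings.
log-average : ∀ r m e T → let n = suc (suc r ℕ.+ m) in
              7 ℕ.≤ m → 2 ℕ.^ e ℕ.* suc (suc m) ℕ.≤ n → ⌈log₂ n ⌉ ℕ.≤ 9 ℕ.* e →
              phaseLength n ℕ.≤ T → (X : DynamicScoreBased n) →
              (+ 1) / 2304 * ((+ ⌈log₂ n ⌉) / 1) ≤ expectedAverageFill X (suc m) T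
log-average r m e T 7≤m fits log≤ T₀≤T X = subst₂ _≤_ (cong ((+ 1) / 2304 *_) (⟦⟧≡/1 ⌈log₂ n ⌉)) (sym (expectedAverageFill≡ m T (suc r) X))
  (by-diff (0≤+ (0≤* 0≤1/128 (≤⇒0≤ h≤v)) (0≤+ (0≤* 0≤1/256 (≤⇒0≤ (harmonic-≥ X m T e r fits))) (0≤* 0≤1/2304 (≤⇒0≤ log≤9e))))
    (combined v h ⟦ e ⟧ ⟦ ⌈log₂ n ⌉ ⟧))
  where
  n = suc (suc r ℕ.+ m)
  v = value X m T (suc r) (λ x → x) 0 (Vec.replicate n 0)
  h = harmonic X m T r
  0≤1/128 : 0ℚ ≤ (+ 1) / 128
  0≤1/128 = *≤* (ℤ.+≤+ z≤n)
  0≤1/256 : 0ℚ ≤ (+ 1) / 256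
  0≤1/256 = *≤* (ℤ.+≤+ z≤n)
  0≤1/2304 : 0ℚ ≤ (+ 1) / 2304
  0≤1/2304 = *≤* (ℤ.+≤+ z≤n)
  combined : ∀ v h e l → ½ * v - (+ 1) / 2304 * l ≡
             (+ 1) / 128 * (64ℚ * v - h) + ((+ 1) / 256 * (2ℚ * h - e) + (+ 1) / 2304 * ((+ 9) / 1 * e - l))
  combined = solve-∀ ring
  log≤9e : ⟦ ⌈log₂ n ⌉ ⟧ ≤ (+ 9) / 1 * ⟦ e ⟧
  log≤9e = subst (⟦ ⌈log₂ n ⌉ ⟧ ≤_) (trans (⟦⟧-* 9 e) (cong (_* ⟦ e ⟧) (⟦⟧≡/1 9))) (⟦⟧-mono log≤)
  h≤v : h ≤ 64ℚ * v
  h≤v = ≤-trans (subst (_≤ w + h) (+-identityˡ h) (+-monoˡ-≤ h 0≤w))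
    (value-≥ X m T 7≤m (windowLength n) (ℕ.n<1+n (n ℕ.* (n ℕ.* n))) (ℕ.m+n≤o⇒m≤o n T₀≤T) (ℕ.m+n≤o⇒n≤o n T₀≤T) r (λ x → x) (λ eq → eq) ℕ.≤-refl 0 (Vec.replicate n 0))
    where
    w = 16ℚ * 1/ₛ (suc r ℕ.+ m) * (2ℚ * level X (λ x → x) (Vec.replicate n 0) + growth X (λ x → x) T 0 (Vec.replicate n 0))
    0≤w : 0ℚ ≤ w
    0≤w = 0≤* (0≤* 0≤16ℚ (0≤1/ₛ (suc r ℕ.+ m)))
      (0≤+ (0≤* 0≤2ℚ (0≤⟦⟧ (total (λ x → x) (Vec.replicate n 0)))) (0≤growth X (λ x → x) (λ eq → eq) T 0 (Vec.replicate n 0)))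

8≤rounded : ∀ n m → 128 ℕ.≤ n → IsRounded-⅔-power n m → 8 ℕ.≤ m
8≤rounded n m 128≤n (_ , n²<) = ℕ.≮⇒≥ λ m<8 → ℕ.<⇒≱ n²<
  (ℕ.≤-trans (ℕ.^-monoˡ-≤ 3 (ℕ.≤-trans (ℕ.≤-reflexive (ℕ.+-comm m 1)) m<8)) (ℕ.≤-trans (ℕ.m≤m+n (8 ℕ.^ 3) (128 ℕ.^ 2 ℕ.∸ 8 ℕ.^ 3)) (ℕ.^-monoˡ-≤ 2 128≤n)))

log-average-rounded : ∀ n m T → 128 ℕ.≤ n → IsRounded-⅔-power n m → phaseLength n ℕ.≤ T → (X : DynamicScoreBased n) →
                      (+ 1) / 2304 * ((+ ⌈log₂ n ⌉) / 1) ≤ expectedAverageFill X m T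
log-average-rounded n m T 128≤n rounded T₀≤T X = go m (8≤rounded n m 128≤n rounded) (proj₁ rounded)
  where
  ℓ = ⌈log₂ n ⌉
  7≤ℓ : 7 ℕ.≤ ℓ
  7≤ℓ = ℕ.≤-trans (ℕ.≤-reflexive (sym (⌈log₂2^n⌉≡n 7))) (⌈log₂⌉-mono-≤ 128≤n)
  -- The largest number of doublings that `doublings-fit` allows.
  e = (ℓ ℕ.∸ 4) ℕ./ 3
  ρ = (ℓ ℕ.∸ 4) ℕ.% 3
  ℓ≡ : ℓ ≡ 3 ℕ.* e ℕ.+ 4 ℕ.+ ρ
  ℓ≡ = trans (sym (ℕ.m∸n+n≡m (ℕ.≤-trans (ℕ.m≤m+n 4 3) 7≤ℓ))) (trans (cong (ℕ._+ 4) (m≡m%n+[m/n]*n (ℓ ℕ.∸ 4) 3)) (rearranged ρ e))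
    where
    rearranged : ∀ ρ e → ρ ℕ.+ e ℕ.* 3 ℕ.+ 4 ≡ 3 ℕ.* e ℕ.+ 4 ℕ.+ ρ
    rearranged = solveℕ
  ρ≤2 : ρ ℕ.≤ 2
  ρ≤2 = ℕ.≤-pred (m%n<n (ℓ ℕ.∸ 4) 3)
  ℓ≤ : ℓ ℕ.≤ 3 ℕ.* e ℕ.+ 6
  ℓ≤ = ℕ.≤-trans (ℕ.≤-reflexive ℓ≡) (ℕ.≤-trans (ℕ.+-monoʳ-≤ (3 ℕ.* e ℕ.+ 4) ρ≤2) (ℕ.≤-reflexive (ℕ.+-assoc (3 ℕ.* e) 4 2)))
  -- As n ≥ 128 = 2^7, there is at least one doubling, and the additive loss 6 from rounding is at
  -- most 6 * e.
  1≤e : 1 ℕ.≤ e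
  1≤e = positive e (ℕ.≤-trans 7≤ℓ ℓ≤)
    where
    positive : ∀ e → 7 ℕ.≤ 3 ℕ.* e ℕ.+ 6 → 1 ℕ.≤ e
    positive zero    7≤6 = contradiction 7≤6 (ℕ.<⇒≱ (ℕ.n<1+n 6))
    positive (suc e) _   = s≤s z≤n
  ℓ≤9e : ℓ ℕ.≤ 9 ℕ.* e
  ℓ≤9e = ℕ.≤-trans ℓ≤ (ℕ.≤-trans (ℕ.+-monoʳ-≤ (3 ℕ.* e) (ℕ.*-monoʳ-≤ 6 1≤e)) (ℕ.≤-reflexive (sym (ℕ.*-distribʳ-+ e 3 6))))
  go : ∀ m → 8 ℕ.≤ m → (m ℕ.∸ 1) ℕ.^ 3 ℕ.< n ℕ.^ 2 → (+ 1) / 2304 * ((+ ℓ) / 1) ≤ expectedAverageFill X m T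
  go (suc m′) 8≤m cube< = at-n (n ℕ.∸ suc (suc m′)) n n≡ X T₀≤T fits ℓ≤9e
    where
    fits : 2 ℕ.^ e ℕ.* suc (suc m′) ℕ.≤ n
    fits = doublings-fit m′ e (ℕ.≤-trans (ℕ.m≤m+n _ ρ) (ℕ.≤-reflexive (sym ℓ≡))) cube<
    n≡ : n ≡ suc (suc (n ℕ.∸ suc (suc m′)) ℕ.+ m′)
    n≡ = trans (sym (ℕ.m∸n+n≡m (ℕ.≤-trans (subst (ℕ._≤ 2 ℕ.^ e ℕ.* suc (suc m′)) (ℕ.*-identityˡ _) (ℕ.*-monoˡ-≤ (suc (suc m′)) (ℕ.m^n>0 2 e))) fits)))
      (trans (ℕ.+-suc _ (suc m′)) (cong suc (ℕ.+-suc _ m′)))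
    -- Everything indexed by `n` is generalised, so that the equation can be matched against `refl`.
    at-n : ∀ r n → n ≡ suc (suc r ℕ.+ m′) → (X : DynamicScoreBased n) → phaseLength n ℕ.≤ T →
           2 ℕ.^ e ℕ.* suc (suc m′) ℕ.≤ n → ⌈log₂ n ⌉ ℕ.≤ 9 ℕ.* e →
           (+ 1) / 2304 * ((+ ⌈log₂ n ⌉) / 1) ≤ expectedAverageFill X (suc m′) T
    at-n r n refl X T₀≤T fits log≤ = log-average r m′ e T (ℕ.≤-pred 8≤m) fits log≤ T₀≤T X

theorem6p14 : Σ[ c ∈ ℚ ] 0ℚ < c × (Σ[ n₀ ∈ ℕ ] Σ[ T₀ ∈ (ℕ → ℕ) ]
    ((T : ℕ → ℕ) → (∀ n → T₀ n ℕ.≤ T n) →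
    ∀ n m → n₀ ℕ.≤ n → IsRounded-⅔-power n m →
    (X : DynamicScoreBased n) →
    c * ((+ ⌈log₂ n ⌉) / 1) ≤ expectedAverageFill X m (T n)))
theorem6p14 =
  (+ 1) / 2304 , *<* (ℤ.+<+ (s≤s z≤n)) , 128 , phaseLength ,
  λ T T₀≤T n m 128≤n rounded X → log-average-rounded n m (T n) 128≤n rounded (T₀≤T n) X
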